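{- There exists a real number $c>0$ with the following property. For all $q\in\mathbb{Z}^+$ and all $g\in\mathbb{Z}^2$, if $\mathcal{N}(q(1/\beta,1/\beta^2)-g)<c$, then $$q(1/\beta,1/\beta^2)-g=\delta(q)\quad\text{or}\quad q(1/\beta,1/\beta^2)-g=\delta(q)-(1,1).$$
   Context: Let $a,b$ be integers with $-a+1\le b\le -2$, let $\beta$ be the real dominant root of $x^3-ax^2-bx-1$, and assume its conjugates $\alpha,\overline\alpha$ are non-real. Let $T_0=1$, $T_1=a$, $T_2=a^2+b$, $T_{n+3}=aT_{n+2}+bT_{n+1}+T_n$. Each $q\in\mathbb{Z}^+$ has a unique $T$-representation $q=\sum_{j=0}^{k}d_jT_j$ with $d_j\in\{0,\dots,a-1\}$, where every block satisfies $d_jd_{j-1}\cdots d_{j-m}\le_{\mathrm{lex}}(a-1)(a+b-1)(a+b)\cdots(a+b)$ (same length). For such $q$ we write $\delta(q)=q(1/\beta,1/\beta^2)-(\sum_{j\ge1}d_jT_{j-1},\sum_{j\ge2}d_jT_{j-2})$. The Rauzy norm is $\mathcal{N}(x_1,x_2)=|(\alpha+b/\beta)x_1+x_2/\beta|$. Standing assumption of the paper: the Rauzy fractal $\mathcal{R}=\{\sum_{i\ge2}d_i\alpha^i:(d_i)_{i\ge2}\text{ admissible}\}$ has exactly 6 neighbours. A neighbour is a nonzero translation vector $u$ of the associated lattice tiling with $\mathcal{R}\cap(\mathcal{R}+u)\neq\emptyset$. -}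

module Defs where

open import Level using (0ℓ)
open import Algebra.Bundles using (CommutativeRing; RawRing)
import Algebra.Definitions.RawMonoid as RawMonoidDefs
import Algebra.Definitions.RawSemiring as RawSemiringDefs
import Algebra.Properties.Ring as RingProperties
open import Data.Fin.Base using (Fin; toℕ)
open import Data.Integer.Base as ℤ using (ℤ; +_; -[1+_])
open import Data.List.Base using (List; applyUpTo)
import Data.List.Relation.Binary.Lex.Strict as Lex
open import Data.Nat.Base as ℕ using (ℕ; zero; suc; _∸_)
open import Data.Product.Base using (Σ; ∃; _×_; _,_; proj₁; proj₂)
open import Data.Sum.Base using (_⊎_; inj₁; inj₂)
open import Function.Definitions using (Injective)
open import Relation.Binary.Core using (Rel)
open import Relation.Binary.Definitions using (tri<; tri≈; tri>)
open import Relation.Binary.PropositionalEquality.Core using (_≡_)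
open import Relation.Binary.Structures using (IsStrictTotalOrder)
open import Relation.Nullary.Negation.Core using (¬_)

------------------------------------------------------------------------
-- The real numbers, as a Dedekind-complete ordered field.  Such a field
-- is unique up to unique isomorphism, so quantifying over this record is
-- talking about ℝ.

record CompleteOrderedField : Set₁ where
  infix  4 _<_ _≤_
  infix  8 _⁻¹
  field
    commutativeRing : CommutativeRing 0ℓ 0ℓ

  open CommutativeRing commutativeRing public

  field
    _<_                : Rel Carrier 0ℓ
    isStrictTotalOrder : IsStrictTotalOrder _≈_ _<_
    0<1                : 0# < 1#
    +-monoʳ-<          : ∀ x {y z} → y < z → x + y < x + z
    *-pos              : ∀ {x y} → 0# < x → 0# < y → 0# < x * y
    -- The value of 0# ⁻¹ is left unspecified.
    _⁻¹                : Carrier → Carrier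
    *-inverseʳ         : ∀ {x} → ¬ (x ≈ 0#) → x * x ⁻¹ ≈ 1#

  _≤_ : Rel Carrier 0ℓ
  x ≤ y = (x < y) ⊎ (x ≈ y)

  IsUpperBound : (Carrier → Set) → Carrier → Set
  IsUpperBound P u = ∀ x → P x → x ≤ u

  IsSupremum : (Carrier → Set) → Carrier → Set
  IsSupremum P s = IsUpperBound P s × (∀ u → IsUpperBound P u → s ≤ u)

  field
    complete : (P : Carrier → Set) → ∃ P → ∃ (IsUpperBound P) → ∃ (IsSupremum P)

  open RawSemiringDefs (RawRing.rawSemiring rawRing) public
    using (_^_) renaming (_×_ to _·_)

  fromℤ : ℤ → Carrier
  fromℤ (+ n)    = n · 1#
  fromℤ -[1+ n ] = - (suc n · 1#)

------------------------------------------------------------------------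

module SquareRoot (ℝ : CompleteOrderedField) where
  open CompleteOrderedField ℝ
  open RingProperties ring using (-‿distribˡ-*; -‿distribʳ-*; -‿involutive)
  private module < = IsStrictTotalOrder isStrictTotalOrder

  private
    <-respˡ : ∀ {x y z} → x ≈ y → x < z → y < z
    <-respˡ = <.<-respˡ-≈

    <-respʳ : ∀ {x y z} → y ≈ z → x < y → x < z
    <-respʳ = <.<-respʳ-≈

    ≤-trans : ∀ {x y z} → x ≤ y → y ≤ z → x ≤ z
    ≤-trans (inj₁ p) (inj₁ q) = inj₁ (<.trans p q)
    ≤-trans (inj₁ p) (inj₂ q) = inj₁ (<-respʳ q p)
    ≤-trans (inj₂ p) (inj₁ q) = inj₁ (<-respˡ (sym p) q)
    ≤-trans (inj₂ p) (inj₂ q) = inj₂ (trans p q)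

    +-monoʳ-≤ : ∀ x {y z} → y ≤ z → x + y ≤ x + z
    +-monoʳ-≤ x (inj₁ p) = inj₁ (+-monoʳ-< x p)
    +-monoʳ-≤ x (inj₂ p) = inj₂ (+-congˡ p)

    x≤x+y : ∀ x {y} → 0# ≤ y → x ≤ x + y
    x≤x+y x p = ≤-trans (inj₂ (sym (+-identityʳ x))) (+-monoʳ-≤ x p)

    0<-x : ∀ {x} → x < 0# → 0# < - x
    0<-x {x} p = <-respˡ (-‿inverseˡ x) (<-respʳ (+-identityʳ (- x)) (+-monoʳ-< (- x) p))

  0≤x*x : ∀ x → 0# ≤ x * x
  0≤x*x x with <.compare 0# x
  ... | tri< p _ _ = inj₁ (*-pos p p)
  ... | tri≈ _ p _ = inj₂ (trans (sym (zeroˡ x)) (*-congʳ p))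
  ... | tri> _ _ p = inj₁ (<-respʳ -x*-x≈x*x (*-pos (0<-x p) (0<-x p)))
    where
    -x*-x≈x*x : - x * - x ≈ x * x
    -x*-x≈x*x = trans (sym (-‿distribˡ-* x (- x)))
                (trans (-‿cong (sym (-‿distribʳ-* x x))) (-‿involutive (x * x)))

  0≤x*x+y*y : ∀ x y → 0# ≤ x * x + y * y
  0≤x*x+y*y x y = ≤-trans (0≤x*x x) (x≤x+y (x * x) (0≤x*x y))

  private
    y≤1+y*y : ∀ y → y ≤ 1# + y * y
    y≤1+y*y y with <.compare y 1#
    ... | tri< p _ _ = ≤-trans (inj₁ p) (x≤x+y 1# (0≤x*x y))
    ... | tri≈ _ p _ = ≤-trans (inj₂ p) (x≤x+y 1# (0≤x*x y))
    ... | tri> _ _ p = inj₁ (<.trans y<y*y (<-respʳ (+-comm (y * y) 1#)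
                         (<-respˡ (+-identityʳ (y * y)) (+-monoʳ-< (y * y) 0<1))))
      where
      0<y-1 : 0# < - 1# + y
      0<y-1 = <-respˡ (-‿inverseˡ 1#) (+-monoʳ-< (- 1#) p)

      y+y*[y-1]≈y*y : y + y * (- 1# + y) ≈ y * y
      y+y*[y-1]≈y*y =
        trans (+-congʳ (sym (*-identityʳ y)))
        (trans (sym (distribˡ y 1# (- 1# + y)))
        (*-congˡ (trans (sym (+-assoc 1# (- 1#) y))
                 (trans (+-congʳ (-‿inverseʳ 1#)) (+-identityˡ y)))))

      y<y*y : y < y * y
      y<y*y = <-respˡ (+-identityʳ y) (<-respʳ y+y*[y-1]≈y*y
                (+-monoʳ-< y (*-pos (<.trans 0<1 p) 0<y-1)))

  √ : ∀ x → 0# ≤ x → Carrier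
  √ x 0≤x = proj₁ (complete (λ y → y * y ≤ x)
    (0# , ≤-trans (inj₂ (zeroˡ 0#)) 0≤x)
    (1# + x , λ y y*y≤x → ≤-trans (y≤1+y*y y) (+-monoʳ-≤ 1# y*y≤x)))

------------------------------------------------------------------------

module ComplexNumbers (ℝ : CompleteOrderedField) where
  private module ℝ = CompleteOrderedField ℝ
  open ℝ using (Carrier; 0#; 1#)
  open SquareRoot ℝ

  infix  4 _≈ᶜ_
  infixl 6 _+ᶜ_ _-ᶜ_
  infixl 7 _*ᶜ_

  record ℂ : Set where
    constructor _+i_
    field
      re : Carrier
      im : Carrier
  open ℂ public

  _≈ᶜ_ : Rel ℂ 0ℓ
  z ≈ᶜ w = (re z ℝ.≈ re w) × (im z ℝ.≈ im w)

  _+ᶜ_ _*ᶜ_ _-ᶜ_ : ℂ → ℂ → ℂ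
  z +ᶜ w = (re z ℝ.+ re w) +i (im z ℝ.+ im w)
  z -ᶜ w = (re z ℝ.- re w) +i (im z ℝ.- im w)
  z *ᶜ w = (re z ℝ.* re w ℝ.- im z ℝ.* im w) +i (re z ℝ.* im w ℝ.+ im z ℝ.* re w)

  ofReal : Carrier → ℂ
  ofReal x = x +i 0#

  ℂ-rawRing : RawRing 0ℓ 0ℓ
  ℂ-rawRing = record
    { Carrier = ℂ ; _≈_ = _≈ᶜ_ ; _+_ = _+ᶜ_ ; _*_ = _*ᶜ_
    ; -_ = λ z → (ℝ.- re z) +i (ℝ.- im z) ; 0# = ofReal 0# ; 1# = ofReal 1# }

  open RawSemiringDefs (RawRing.rawSemiring ℂ-rawRing) public
    using () renaming (_^_ to _^ᶜ_; _×_ to _·ᶜ_; sum to sumᶜ)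

  ∣_∣ : ℂ → Carrier
  ∣ z ∣ = √ (re z ℝ.* re z ℝ.+ im z ℝ.* im z) (0≤x*x+y*y (re z) (im z))

  HasSum : (ℕ → ℂ) → ℂ → Set
  HasSum f z = ∀ ε → 0# ℝ.< ε → ∃ λ N → ∀ n → N ℕ.≤ n →
    ∣ sumᶜ {n} (λ i → f (toℕ i)) -ᶜ z ∣ ℝ.< ε

  HasExactly : ℕ → (ℂ → Set) → Set
  HasExactly n P = Σ (Fin n → ℂ) λ f →
    Injective _≡_ _≈ᶜ_ f × (∀ i → P (f i)) × (∀ z → P z → ∃ λ i → z ≈ᶜ f i)

------------------------------------------------------------------------

module Numeration (a b : ℤ) where

  T : ℕ → ℤ
  T 0 = + 1
  T 1 = a
  T 2 = a ℤ.* a ℤ.+ b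
  T (suc (suc (suc n))) = a ℤ.* T (suc (suc n)) ℤ.+ b ℤ.* T (suc n) ℤ.+ T n

  -- The word (a-1)(a+b-1)(a+b)(a+b)…
  maximalWord : ℕ → ℤ
  maximalWord 0             = a ℤ.- + 1
  maximalWord 1             = a ℤ.+ b ℤ.- + 1
  maximalWord (suc (suc _)) = a ℤ.+ b

  infix 4 _≤lex_
  _≤lex_ : Rel (List ℤ) 0ℓ
  _≤lex_ = Lex.Lex-≤ _≡_ ℤ._<_

  -- Admissibility of the digits whose indices lie in the interval I.  The
  -- blocks d_j d_{j-1} … d_{j-m} are read from high to low index.
  Admissible : (I : ℕ → Set) → (ℕ → ℕ) → Set
  Admissible I d =
      (∀ j → I j → + d j ℤ.≤ a ℤ.- + 1)
    × (∀ j m → m ℕ.≤ j → I j → I (j ∸ m) →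
         applyUpTo (λ i → + d (j ∸ i)) (suc m) ≤lex applyUpTo maximalWord (suc m))

  Σℤ : ℕ → (ℕ → ℤ) → ℤ
  Σℤ n f = RawMonoidDefs.sum ℤ.+-0-rawMonoid {n} (λ i → f (toℕ i))

  record TRepresentation (q : ℕ) : Set where
    field
      k          : ℕ
      d          : ℕ → ℕ
      admissible : Admissible (ℕ._≤ k) d
      value      : + q ≡ Σℤ (suc k) (λ j → + d j ℤ.* T j)

    -- Σ_{j=1}^{k} d_j T_{j-1} and Σ_{j=2}^{k} d_j T_{j-2}
    shift₁ shift₂ : ℤ
    shift₁ = Σℤ k       (λ i → + d (1 ℕ.+ i) ℤ.* T i)
    shift₂ = Σℤ (k ∸ 1) (λ i → + d (2 ℕ.+ i) ℤ.* T i)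

------------------------------------------------------------------------

module Cubic (ℝ : CompleteOrderedField) (a b : ℤ) where
  open CompleteOrderedField ℝ
  open ComplexNumbers ℝ
  open Numeration a b public

  IsRoot : ℂ → Set
  IsRoot z =
    (z ^ᶜ 3) -ᶜ (ofReal (fromℤ a) *ᶜ (z ^ᶜ 2)) -ᶜ (ofReal (fromℤ b) *ᶜ z) -ᶜ ofReal 1#
      ≈ᶜ ofReal 0#

  IsDominantRoot : Carrier → Set
  IsDominantRoot β = IsRoot (ofReal β)
    × (∀ z → IsRoot z → (z ≈ᶜ ofReal β) ⊎ (∣ z ∣ < ∣ ofReal β ∣))

  module RauzyFractal (α : ℂ) where

    Rauzy : ℂ → Set
    Rauzy z = ∃ λ d → Admissible (2 ℕ.≤_) d
      × HasSum (λ i → d (2 ℕ.+ i) ·ᶜ (α ^ᶜ (2 ℕ.+ i))) z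

    -- The translates of the Rauzy fractal (with digits starting at index 2)
    -- by the lattice ℤ + ℤα tile the plane.
    Lattice : ℂ → Set
    Lattice u = ∃ λ m → ∃ λ n → u ≈ᶜ ofReal (fromℤ m) +ᶜ ofReal (fromℤ n) *ᶜ α

    Neighbour : ℂ → Set
    Neighbour u = Lattice u × ¬ (u ≈ᶜ ofReal 0#) × (∃ λ z → Rauzy z × Rauzy (z -ᶜ u))

  infix  4 _≈²_
  infixl 6 _-²_
  infixr 8 _·²_

  ℝ² : Set
  ℝ² = Carrier × Carrier

  _≈²_ : Rel ℝ² 0ℓ
  (x₁ , x₂) ≈² (y₁ , y₂) = (x₁ ≈ y₁) × (x₂ ≈ y₂)

  _-²_ : ℝ² → ℝ² → ℝ²
  (x₁ , x₂) -² (y₁ , y₂) = (x₁ - y₁) , (x₂ - y₂)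

  _·²_ : ℕ → ℝ² → ℝ²
  q ·² (x₁ , x₂) = (q · x₁) , (q · x₂)

  fromℤ² : ℤ × ℤ → ℝ²
  fromℤ² (g₁ , g₂) = fromℤ g₁ , fromℤ g₂

  module Approximation (β : Carrier) where

    θ : ℝ²
    θ = β ⁻¹ , (β ^ 2) ⁻¹

    δ : ∀ {q} → TRepresentation q → ℝ²
    δ {q} r = q ·² θ -² fromℤ² (shift₁ , shift₂)
      where open TRepresentation r

    𝒩 : ℂ → ℝ² → Carrier
    𝒩 α (x₁ , x₂) =
      ∣ (α +ᶜ ofReal (fromℤ b * β ⁻¹)) *ᶜ ofReal x₁ +ᶜ ofReal (x₂ * β ⁻¹) ∣

module Submission where

-- Multiplied by the conjugate of −βα, the vector qθ − g becomes x − u, where x = Σ d_j α^{j+2} is the point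
-- of the Rauzy fractal R with the digits of q and u ∈ ℤ + ℤα; here u = 0 and u = u* := −1 − (b+1)α
-- correspond to the two alternatives of the theorem.  By compactness of R (a König argument on digit
-- prefixes) and discreteness of ℤ + ℤα, it suffices that R contains no lattice point besides 0 and u*.
-- Since u* = α² + Σ_{i≥2} (a+b) αⁱ, the vectors ±u*, ±α, ±(u*+α) are neighbours, so they are the only ones.
-- A lattice point of R is 0 or a neighbour, the same holds for its difference with u*, and splitting off
-- the first digits of its expansion gives further points of R; this leaves only 0 and u*.

-- The threshold must serve all q at once, so a positive distance for each single x is not enough: R
-- as a whole must keep a positive distance from all lattice points outside it. Hence the constant
-- is not explicit, and excluded middle selects the infinite branch. The lattice points
-- approximating the prefixes of that branch may vary with the prefix; discreteness makes them
-- constant from some index on, so the branch converges to a lattice point and no limit in ℂ has to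
-- be constructed.
--
-- The assumption on neighbours enters as a count: six distinct ones are exhibited, so a seventh is
-- impossible. Splitting off a digit serves to turn the remaining candidates into points with m ≥ 1,
-- or with m = -1 and n ≤ 0.
--
-- If p denotes the pair of shifted sums of q, then u = m + nα with m = p₁ - g₁ and n = bm + p₂ -
-- g₂; so u = u* means g = p + (1,1), which is where the vector (1,1) comes from.

open import Defs
open import Level using (0ℓ)
open import Algebra.Bundles using (CommutativeRing)
import Algebra.Properties.Ring as RingProperties
import Algebra.Properties.Semiring.Mult as SemiringMult
import Algebra.Solver.Ring as RingSolver
open import Algebra.Solver.Ring.AlmostCommutativeRing
  using (fromCommutativeRing; _-Raw-AlmostCommutative⟶_)
open import Axiom.ExcludedMiddle using (ExcludedMiddle)
open import Data.Empty using (⊥; ⊥-elim)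
open import Data.Fin.Base as Fin using (Fin; toℕ)
open import Data.Fin.Properties using (pigeonhole; <⇒≢)
open import Data.Integer.Base as ℤ using (ℤ; +_; -[1+_])
import Data.Integer.Properties as ℤₚ
import Data.Integer.Tactic.RingSolver as ℤ-Solver
open import Data.List.Base using (List; applyUpTo)
open import Data.List.Relation.Binary.Lex.Core using (base; this; next)
open import Data.Maybe.Base using (Maybe; just; nothing)
open import Data.Nat.Base as ℕ using (ℕ; zero; suc; _∸_)
import Data.Nat.Properties as ℕₚ
import Data.Nat.Tactic.RingSolver as ℕ-Solver
open import Data.Product.Base using (∃; _×_; _,_; proj₁; proj₂)
open import Data.Sum.Base using (_⊎_; inj₁; inj₂; [_,_]′)
open import Data.Unit.Base using (⊤; tt)
open import Data.Vec.Base as Vec using (Vec; []; _∷_; lookup)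
open import Data.Vec.Membership.Propositional using (_∈_)
open import Data.Vec.Membership.Propositional.Properties using (∈-lookup)
open import Data.Vec.N-ary using (N-ary; Eq; curryⁿ; curryⁿ-cong; _$ⁿ_)
open import Data.Vec.Relation.Unary.All using (All; []; _∷_)
open import Data.Vec.Relation.Unary.All.Properties using (lookup⁺; lookup⁻)
open import Data.Vec.Relation.Unary.AllPairs using ([]; _∷_)
open import Data.Vec.Relation.Unary.Any using (here; there)
open import Data.Vec.Relation.Unary.Unique.Propositional using (Unique)
open import Data.Vec.Relation.Unary.Unique.Propositional.Properties using (lookup-injective)
open import Function.Definitions using (Injective)
open import Relation.Binary.Bundles using (StrictPartialOrder)
import Relation.Binary.Construct.StrictToNonStrict as StrictToNonStrict
open import Relation.Binary.Definitions using (tri<; tri≈; tri>)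
open import Relation.Binary.PropositionalEquality as ≡ using (_≡_)
import Relation.Binary.Reasoning.Setoid as SetoidReasoning
import Relation.Binary.Reasoning.StrictPartialOrder as StrictReasoning
open import Relation.Binary.Structures using (IsStrictTotalOrder)
open import Relation.Nullary.Decidable.Core using (Dec; yes; no)
open import Relation.Nullary.Negation.Core using (¬_)

-- Integer coefficients in a commutative ring

module IntegerCoefficients {c ℓ} (R : CommutativeRing c ℓ) where
  open CommutativeRing R
  open RingProperties ring
    using (-‿distribˡ-*; -‿distribʳ-*; -‿involutive; -‿+-comm; -0#≈0#)
  open SemiringMult semiring using (×-homo-+; ×1-homo-*) renaming (_×_ to _·_)
  open SetoidReasoning setoid

  -- The clauses are those of `fromℤ`. Since `⟦ + 1 ⟧ℤ` is `1# + 0#`, equal to `1#` only up to `≈`,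
  -- a literal `1#` enters solver goals as an additional variable.
  ⟦_⟧ℤ : ℤ → Carrier
  ⟦ + n ⟧ℤ      = n · 1#
  ⟦ -[1+ n ] ⟧ℤ = - (suc n · 1#)

  ⊖-homo : ∀ m n → ⟦ m ℤ.⊖ n ⟧ℤ ≈ m · 1# - n · 1#
  ⊖-homo m zero = sym (trans (+-congˡ -0#≈0#) (+-identityʳ _))
  ⊖-homo zero (suc n) = sym (+-identityˡ _)
  ⊖-homo (suc m) (suc n) = begin
    ⟦ suc m ℤ.⊖ suc n ⟧ℤ                 ≡⟨ ≡.cong ⟦_⟧ℤ (ℤₚ.[1+m]⊖[1+n]≡m⊖n m n) ⟩
    ⟦ m ℤ.⊖ n ⟧ℤ                         ≈⟨ ⊖-homo m n ⟩
    m · 1# - n · 1#                      ≈⟨ +-congʳ (+-identityʳ _) ⟨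
    (m · 1# + 0#) - n · 1#               ≈⟨ +-congʳ (+-congˡ (-‿inverseʳ 1#)) ⟨
    (m · 1# + (1# - 1#)) - n · 1#        ≈⟨ +-congʳ (+-assoc _ _ _) ⟨
    (m · 1# + 1# - 1#) - n · 1#          ≈⟨ +-assoc _ _ _ ⟩
    m · 1# + 1# + (- 1# - n · 1#)        ≈⟨ +-cong (+-comm _ _) (-‿+-comm 1# (n · 1#)) ⟩
    suc m · 1# - suc n · 1#              ∎

  +-homo : ∀ i j → ⟦ i ℤ.+ j ⟧ℤ ≈ ⟦ i ⟧ℤ + ⟦ j ⟧ℤ
  +-homo (+ m)    (+ n)    = ×-homo-+ 1# m n
  +-homo (+ m)    -[1+ n ] = ⊖-homo m (suc n)
  +-homo -[1+ m ] (+ n)    = trans (⊖-homo n (suc m)) (+-comm _ _)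
  +-homo -[1+ m ] -[1+ n ] = begin
    - (suc (suc (m ℕ.+ n)) · 1#)       ≡⟨ ≡.cong (λ k → - (suc k · 1#)) (≡.sym (ℕₚ.+-suc m n)) ⟩
    - ((suc m ℕ.+ suc n) · 1#)         ≈⟨ -‿cong (×-homo-+ 1# (suc m) (suc n)) ⟩
    - (suc m · 1# + suc n · 1#)        ≈⟨ -‿+-comm _ _ ⟨
    - (suc m · 1#) - suc n · 1#        ∎

  neg-homo : ∀ i → ⟦ ℤ.- i ⟧ℤ ≈ - ⟦ i ⟧ℤ
  neg-homo (+ zero)  = sym -0#≈0#
  neg-homo (+ suc n) = refl
  neg-homo -[1+ n ]  = sym (-‿involutive _)

  private
    +*-homo : ∀ m j → ⟦ + m ℤ.* j ⟧ℤ ≈ ⟦ + m ⟧ℤ * ⟦ j ⟧ℤ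
    +*-homo m (+ n) = begin
      ⟦ + m ℤ.* + n ⟧ℤ      ≡⟨ ≡.cong ⟦_⟧ℤ (ℤₚ.pos-* m n) ⟨
      (m ℕ.* n) · 1#        ≈⟨ ×1-homo-* m n ⟩
      m · 1# * (n · 1#)     ∎
    +*-homo m -[1+ n ] = begin
      ⟦ + m ℤ.* -[1+ n ] ⟧ℤ            ≡⟨ ≡.cong ⟦_⟧ℤ (ℤₚ.neg-distribʳ-* (+ m) (+ suc n)) ⟨
      ⟦ ℤ.- (+ m ℤ.* + suc n) ⟧ℤ       ≈⟨ neg-homo (+ m ℤ.* + suc n) ⟩
      - ⟦ + m ℤ.* + suc n ⟧ℤ           ≈⟨ -‿cong (+*-homo m (+ suc n)) ⟩
      - (m · 1# * (suc n · 1#))        ≈⟨ -‿distribʳ-* _ _ ⟩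
      m · 1# * - (suc n · 1#)          ∎

  *-homo : ∀ i j → ⟦ i ℤ.* j ⟧ℤ ≈ ⟦ i ⟧ℤ * ⟦ j ⟧ℤ
  *-homo (+ m) j = +*-homo m j
  *-homo -[1+ m ] j = begin
    ⟦ -[1+ m ] ℤ.* j ⟧ℤ          ≡⟨ ≡.cong ⟦_⟧ℤ (ℤₚ.neg-distribˡ-* (+ suc m) j) ⟨
    ⟦ ℤ.- (+ suc m ℤ.* j) ⟧ℤ     ≈⟨ neg-homo (+ suc m ℤ.* j) ⟩
    - ⟦ + suc m ℤ.* j ⟧ℤ         ≈⟨ -‿cong (+*-homo (suc m) j) ⟩
    - (suc m · 1# * ⟦ j ⟧ℤ)      ≈⟨ -‿distribˡ-* _ _ ⟩
    - (suc m · 1#) * ⟦ j ⟧ℤ      ∎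

  private
    morphism : ℤ.+-*-rawRing -Raw-AlmostCommutative⟶ fromCommutativeRing R
    morphism = record
      { ⟦_⟧ = ⟦_⟧ℤ ; +-homo = +-homo ; *-homo = *-homo ; -‿homo = neg-homo
      ; 0-homo = refl ; 1-homo = +-identityʳ 1# }

    coefficient-≟ : ∀ i j → Maybe (⟦ i ⟧ℤ ≈ ⟦ j ⟧ℤ)
    coefficient-≟ i j with i ℤₚ.≟ j
    ... | yes ≡.refl = just refl
    ... | no _       = nothing

  open RingSolver ℤ.+-*-rawRing (fromCommutativeRing R) morphism coefficient-≟ public
    using (Polynomial; _:=_; _:+_; _:*_; _:-_; :-_; con)
  open RingSolver ℤ.+-*-rawRing (fromCommutativeRing R) morphism coefficient-≟
    using (var; ⟦_⟧; ⟦_⟧N; normalise; prove)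

  -- Unlike the library's version, this compares normal forms syntactically: evaluating them
  -- in the ring ℂ, whose operations unfold to components, is expensive.
  solve : ∀ n (f : N-ary n (Polynomial n) (Polynomial n × Polynomial n)) →
    let p , q = f $ⁿ Vec.map var (Vec.allFin n) in
    normalise p ≡ normalise q → Eq n _≈_ (curryⁿ ⟦ p ⟧) (curryⁿ ⟦ q ⟧)
  solve n f p≡q = let p , q = f $ⁿ Vec.map var (Vec.allFin n) in
    curryⁿ-cong _≈_ ⟦ p ⟧ ⟦ q ⟧ λ ρ → prove ρ p q (reflexive (≡.cong (λ r → ⟦ r ⟧N ρ) p≡q))

-- Admissible words

Digits : Set
Digits = ℕ → ℕ

infixr 5 _▸_
_▸_ : ℕ → Digits → Digits
(c ▸ e) zero    = c
(c ▸ e) (suc i) = e i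

repeat : ℕ → Digits
repeat c _ = c

tail : Digits → Digits
tail e i = e (suc i)

Agree : ℕ → Digits → Digits → Set
Agree k e w = ∀ i → i ℕ.< k → e i ≡ w i

applyUpTo-cong : ∀ {A : Set} {f g : ℕ → A} n → (∀ i → i ℕ.< n → f i ≡ g i) →
                 applyUpTo f n ≡ applyUpTo g n
applyUpTo-cong zero    h = ≡.refl
applyUpTo-cong (suc n) h = ≡.cong₂ List._∷_ (h 0 ℕ.z<s)
  (applyUpTo-cong n λ i i<n → h (suc i) (ℕ.s<s i<n))

-- The hypotheses −a+1 ≤ b ≤ −2 say that a = s+B+3 and b = −(B+2) with s, B ≥ 0.
record Parameters (a b : ℤ) : Set where
  constructor parameters
  field
    s B : ℕ
    a≡  : a ≡ + (3 ℕ.+ (s ℕ.+ B))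
    b≡  : b ≡ -[1+ suc B ]

⇒parameters : ∀ a b → (ℤ.- a) ℤ.+ + 1 ℤ.≤ b → b ℤ.≤ -[1+ 1 ] → Parameters a b
⇒parameters a -[1+ suc B ] p (ℤ.-≤- (ℕ.s≤s ℕ.z≤n)) = parameters ℤ.∣ c ∣ B a≡ ≡.refl
  where
  c : ℤ
  -- This is a+b-1, the second digit of the maximal word; the hypothesis -a+1 ≤ b says that it is
  -- nonnegative.
  c = a ℤ.- + (3 ℕ.+ B)

  0≤c : + 0 ℤ.≤ c
  0≤c = ≡.subst₂ ℤ._≤_ (rearrange₁ a) (rearrange₂ a (+ B)) (ℤₚ.+-monoˡ-≤ (a ℤ.- + 1) p)
    where
    rearrange₁ : ∀ x → (ℤ.- x ℤ.+ + 1) ℤ.+ (x ℤ.- + 1) ≡ + 0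
    rearrange₁ = ℤ-Solver.solve-∀
    rearrange₂ : ∀ x y → ℤ.- (+ 2 ℤ.+ y) ℤ.+ (x ℤ.- + 1) ≡ x ℤ.- (+ 3 ℤ.+ y)
    rearrange₂ = ℤ-Solver.solve-∀

  a≡ : a ≡ + (3 ℕ.+ (ℤ.∣ c ∣ ℕ.+ B))
  a≡ = ≡.trans (rearrange a (+ B)) (≡.cong (λ x → + 3 ℤ.+ (x ℤ.+ + B)) (≡.sym (ℤₚ.0≤i⇒+∣i∣≡i 0≤c)))
    where
    rearrange : ∀ x y → x ≡ + 3 ℤ.+ ((x ℤ.- (+ 3 ℤ.+ y)) ℤ.+ y)
    rearrange = ℤ-Solver.solve-∀

module Words (s B : ℕ) where
  a b : ℤ
  a = + (3 ℕ.+ (s ℕ.+ B))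
  b = -[1+ suc B ]

  open Numeration a b

  top : ℕ
  top = 2 ℕ.+ (s ℕ.+ B)

  Adm : Digits → Set
  Adm = Admissible (λ _ → ⊤)

  a+b≡1+s : a ℤ.+ b ≡ + suc s
  a+b≡1+s = begin
    (3 ℕ.+ (s ℕ.+ B)) ℤ.⊖ (2 ℕ.+ B)       ≡⟨ ≡.cong (λ n → suc n ℤ.⊖ (2 ℕ.+ B)) (rearrange s B) ⟩
    (suc s ℕ.+ (2 ℕ.+ B)) ℤ.⊖ (2 ℕ.+ B)   ≡⟨ ℤₚ.⊖-≥ (ℕₚ.m≤n+m (2 ℕ.+ B) (suc s)) ⟩
    + (suc s ℕ.+ (2 ℕ.+ B) ∸ (2 ℕ.+ B))   ≡⟨ ≡.cong +_ (ℕₚ.m+n∸n≡m (suc s) (2 ℕ.+ B)) ⟩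
    + suc s                               ∎
    where
    open ≡.≡-Reasoning
    rearrange : ∀ x y → 2 ℕ.+ (x ℕ.+ y) ≡ x ℕ.+ (2 ℕ.+ y)
    rearrange = ℕ-Solver.solve-∀

  maximalWord₁ : maximalWord 1 ≡ + s
  maximalWord₁ = ≡.cong (ℤ._- + 1) a+b≡1+s

  -- The first comparison is 0 ≤ a+b-1 = s. A tie occurs only for s = 0, and is then broken by 0 <
  -- a+b.
  zeros≤lex : ∀ m (f : ℕ → ℤ) → (∀ i → i ℕ.< m → f i ≡ + 0) →
              applyUpTo f m ≤lex applyUpTo (λ i → maximalWord (suc i)) m
  zeros≤lex zero f h = base tt
  zeros≤lex (suc m) f h rewrite maximalWord₁ | h 0 ℕ.z<s = compare-s s m (λ i → f (suc i))
      (λ i i<m → h (suc i) (ℕ.s<s i<m))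
    where
    compare-s : ∀ s m (g : ℕ → ℤ) → (∀ i → i ℕ.< m → g i ≡ + 0) →
           (+ 0 List.∷ applyUpTo g m) ≤lex (+ s List.∷ applyUpTo (λ i → maximalWord (2 ℕ.+ i)) m)
    compare-s (suc _) m       g h = this (ℤ.+<+ ℕ.z<s)
    compare-s zero    zero    g h = next ≡.refl (base tt)
    compare-s zero    (suc m) g h rewrite h 0 ℕ.z<s | a+b≡1+s = next ≡.refl (this (ℤ.+<+ ℕ.z<s))

  -- A block whose first digit is below a-1 is decided there. If its first digit is a-1, only zeros
  -- follow, and `zeros≤lex` applies. All explicit words used below have this shape.
  adm : ∀ e → (∀ j → e j ℕ.< top ⊎ e j ℕ.≤ top × (∀ i → i ℕ.< j → e i ≡ 0)) → Adm e
  adm e h = digits , blocks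
    where
    digits : ∀ j → ⊤ → + e j ℤ.≤ a ℤ.- + 1
    digits j _ with h j
    ... | inj₁ p       = ℤ.+≤+ (ℕₚ.<⇒≤ p)
    ... | inj₂ (p , _) = ℤ.+≤+ p

    blocks : ∀ j m → m ℕ.≤ j → ⊤ → ⊤ →
      applyUpTo (λ i → + e (j ∸ i)) (suc m) ≤lex applyUpTo maximalWord (suc m)
    blocks j m m≤j _ _ with h j
    ... | inj₁ p = this (ℤ.+<+ p)
    ... | inj₂ (p , lower≡0) with ℕₚ.m≤n⇒m<n∨m≡n p
    ...   | inj₁ q = this (ℤ.+<+ q)
    ...   | inj₂ q = next (≡.cong +_ q) (zeros≤lex m _ λ i i<m →
      ≡.cong +_ (lower≡0 _ (ℕₚ.∸-monoʳ-< {j} {suc i} {0} ℕ.z<s (ℕₚ.≤-trans i<m m≤j))))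

  -- Blocks are read downwards and stop within the index interval, so forgetting the lowest digits
  -- only removes conditions. This is why R can be studied by splitting off first digits.
  adm-drop : ∀ n {d} → Admissible (n ℕ.≤_) d → Adm (λ i → d (n ℕ.+ i))
  adm-drop n {d} (digits , blocks) = (λ j _ → digits (n ℕ.+ j) (ℕₚ.m≤m+n n j)) , λ j m m≤j _ _ →
    ≡.subst (_≤lex applyUpTo maximalWord (suc m))
      (applyUpTo-cong (suc m) λ i i<1+m →
        ≡.cong (λ k → + d k) (ℕₚ.+-∸-assoc n (ℕₚ.≤-trans (ℕₚ.≤-pred i<1+m) m≤j)))
      (blocks (n ℕ.+ j) m (ℕₚ.≤-trans m≤j (ℕₚ.m≤n+m j n)) (ℕₚ.m≤m+n n j)
        (≡.subst (n ℕ.≤_) (≡.sym (ℕₚ.+-∸-assoc n m≤j)) (ℕₚ.m≤m+n n (j ∸ m))))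

  adm-tail : ∀ {e} → Adm e → Adm (tail e)
  adm-tail (digits , blocks) = adm-drop 1 ((λ j _ → digits j tt) , λ j m p _ _ → blocks j m p tt tt)

  adm-shift : ∀ {e} → Adm e → Admissible (2 ℕ.≤_) (λ i → e (i ∸ 2))
  adm-shift {e} (digits , blocks) = (λ j _ → digits (j ∸ 2) tt) , λ j m m≤j 2≤j 2≤j∸m →
    ≡.subst (_≤lex applyUpTo maximalWord (suc m))
      (applyUpTo-cong (suc m) λ i _ → ≡.cong (λ k → + e k) (∸-swap j i))
      (blocks (j ∸ 2) m (m≤j∸2 j m m≤j 2≤j∸m) tt tt)
    where
    ∸-swap : ∀ j i → j ∸ 2 ∸ i ≡ j ∸ i ∸ 2
    ∸-swap j i = ≡.trans (ℕₚ.∸-+-assoc j 2 i) (≡.trans (≡.cong (j ∸_) (ℕₚ.+-comm 2 i)) (≡.sym (ℕₚ.∸-+-assoc j i 2)))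
    m≤j∸2 : ∀ j m → m ℕ.≤ j → 2 ℕ.≤ j ∸ m → m ℕ.≤ j ∸ 2
    m≤j∸2 j m m≤j q = ℕₚ.m+n≤o⇒m≤o∸n m (≡.subst₂ ℕ._≤_ (ℕₚ.+-comm 2 m) (ℕₚ.m∸n+n≡m m≤j) (ℕₚ.+-monoˡ-≤ m q))

  -- Each condition concerns a block of indices at most j, hence a finite prefix; so the set of
  -- admissible words is closed.
  adm-agree : ∀ {w} → (∀ n → ∃ λ e → Adm e × Agree n e w) → Adm w
  adm-agree {w} h = digits , blocks
    where
    digits : ∀ j → ⊤ → + w j ℤ.≤ a ℤ.- + 1
    digits j _ with h (suc j)
    ... | e , (p , _) , agree = ≡.subst (λ d → + d ℤ.≤ a ℤ.- + 1) (agree j ℕₚ.≤-refl) (p j tt)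

    blocks : ∀ j m → m ℕ.≤ j → ⊤ → ⊤ →
      applyUpTo (λ i → + w (j ∸ i)) (suc m) ≤lex applyUpTo maximalWord (suc m)
    blocks j m m≤j _ _ with h (suc j)
    ... | e , (_ , q) , agree = ≡.subst (_≤lex applyUpTo maximalWord (suc m))
      (applyUpTo-cong (suc m) λ i _ → ≡.cong +_ (agree (j ∸ i) (ℕ.s≤s (ℕₚ.m∸n≤m j i))))
      (q j m m≤j tt tt)

  -- A representation constrains its digits only up to index k; zeros above turn it into an infinite
  -- admissible word, hence a point of R.
  truncate : ℕ → Digits → Digits
  truncate k d i with i ℕₚ.≤? k
  ... | yes _ = d i
  ... | no _  = 0

  truncate-≤ : ∀ {k d i} → i ℕ.≤ k → truncate k d i ≡ d i
  truncate-≤ {k} {d} {i} i≤k with i ℕₚ.≤? k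
  ... | yes _  = ≡.refl
  ... | no i≰k = ⊥-elim (i≰k i≤k)

  truncate-> : ∀ {k d i} → k ℕ.< i → truncate k d i ≡ 0
  truncate-> {k} {d} {i} k<i with i ℕₚ.≤? k
  ... | yes i≤k = ⊥-elim (ℕₚ.<⇒≱ k<i i≤k)
  ... | no _    = ≡.refl

  adm-truncate : ∀ {k d} → Admissible (ℕ._≤ k) d → Adm (truncate k d)
  adm-truncate {k} {d} (digits , blocks) = digits′ , blocks′
    where
    digits′ : ∀ j → ⊤ → + truncate k d j ℤ.≤ a ℤ.- + 1
    digits′ j _ with j ℕₚ.≤? k
    ... | yes j≤k = digits j j≤k
    ... | no _    = ℤ.+≤+ ℕ.z≤n

    blocks′ : ∀ j m → m ℕ.≤ j → ⊤ → ⊤ →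
      applyUpTo (λ i → + truncate k d (j ∸ i)) (suc m) ≤lex applyUpTo maximalWord (suc m)
    blocks′ j m m≤j _ _ = by-cases (j ℕₚ.≤? k)
      where
      by-cases : Dec (j ℕ.≤ k) →
        applyUpTo (λ i → + truncate k d (j ∸ i)) (suc m) ≤lex applyUpTo maximalWord (suc m)
      by-cases (yes j≤k) = ≡.subst (_≤lex applyUpTo maximalWord (suc m))
        (applyUpTo-cong (suc m) λ i _ →
          ≡.cong +_ (≡.sym (truncate-≤ {d = d} (ℕₚ.≤-trans (ℕₚ.m∸n≤m j i) j≤k))))
        (blocks j m m≤j j≤k (ℕₚ.≤-trans (ℕₚ.m∸n≤m j m) j≤k))
      -- Such a block starts with 0 < a-1, so its first digit decides.
      by-cases (no j≰k) rewrite truncate-> {d = d} (ℕₚ.≰⇒> j≰k) = this (ℤ.+<+ ℕ.z<s)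

  adm-zeros : Adm (repeat 0)
  adm-zeros = adm _ λ j → inj₁ ℕ.z<s

  -- The digits of u* = −1 − (b+1)α.
  u*-digits : Digits
  u*-digits = (2 ℕ.+ s) ▸ repeat (1 ℕ.+ s)

  prepend : ℕ → Digits → Digits
  prepend zero    e = e
  prepend (suc k) e = 0 ▸ prepend k e

  private
    s<top : 1 ℕ.+ s ℕ.< top
    s<top = ℕ.s≤s (ℕ.s≤s (ℕₚ.m≤m+n s B))

  -- The leading digit 2+s equals a-1 when B = 0. It is allowed even then, because there are only
  -- zeros below it.
  adm-u* : ∀ k → Adm (prepend k u*-digits)
  adm-u* k = adm _ (cases k)
    where
    cases : ∀ k j → prepend k u*-digits j ℕ.< top ⊎
      prepend k u*-digits j ℕ.≤ top × (∀ i → i ℕ.< j → prepend k u*-digits i ≡ 0)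
    cases zero zero       = inj₂ (s<top , λ _ ())
    cases zero (suc j)    = inj₁ s<top
    cases (suc k) zero    = inj₁ ℕ.z<s
    cases (suc k) (suc j) with cases k j
    ... | inj₁ p = inj₁ p
    ... | inj₂ (p , zeros) = inj₂ (p , λ { zero _ → ≡.refl ; (suc i) (ℕ.s≤s i<j) → zeros i i<j })

  adm-[B-1] : Adm ((1 ℕ.+ B) ▸ repeat 0)
  adm-[B-1] = adm _ λ { zero → inj₁ (ℕ.s≤s (ℕ.s≤s (ℕₚ.m≤n+m B s))) ; (suc j) → inj₁ ℕ.z<s }

  adm-[a-1][B-2] : Adm (top ▸ B ▸ repeat 0)
  adm-[a-1][B-2] = adm _ λ
    { zero          → inj₂ (ℕₚ.≤-refl , λ _ ())
    ; (suc zero)    → inj₁ (ℕ.s≤s (ℕₚ.≤-trans (ℕₚ.m≤n+m B s) (ℕₚ.n≤1+n _)))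
    ; (suc (suc j)) → inj₁ ℕ.z<s }

-- Matching the two equations once lets the argument run with a and b given by numerals in s and B,
-- so that digits are natural numbers throughout.
parameters-elim : (P : ℤ → ℤ → Set) → (∀ s B → P (Words.a s B) (Words.b s B)) →
  ∀ {a b} → Parameters a b → P a b
parameters-elim P h (parameters s B ≡.refl ≡.refl) = h s B

-- Words built digit by digit

update : Digits → ℕ → ℕ → Digits
update w k d i with i ℕₚ.≟ k
... | yes _ = d
... | no _  = w i

update-≡ : ∀ w k d → update w k d k ≡ d
update-≡ w k d with k ℕₚ.≟ k
... | yes _  = ≡.refl
... | no k≢k = ⊥-elim (k≢k ≡.refl)

update-≢ : ∀ w k d {i} → ¬ (i ≡ k) → update w k d i ≡ w i
update-≢ w k d {i} i≢k with i ℕₚ.≟ k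
... | yes i≡k = ⊥-elim (i≢k i≡k)
... | no _    = ≡.refl

agree-update : ∀ {k e w} → Agree k e w → Agree (suc k) e (update w k (e k))
agree-update {k} {e} {w} agree i i<1+k with ℕₚ.m≤n⇒m<n∨m≡n (ℕₚ.≤-pred i<1+k)
... | inj₁ i<k    = ≡.trans (agree i i<k) (≡.sym (update-≢ w k (e k) (ℕₚ.<⇒≢ i<k)))
... | inj₂ ≡.refl = ≡.sym (update-≡ w k (e k))

-- Integer coordinates of the six neighbours

module SixVectors (B : ℕ) where

  -- The coordinates (m , n) of ±α, ±u*, ±(u* + α), written as m + nα.
  sixVectors : Vec (ℤ × ℤ) 6
  sixVectors = (+ 0 , + 1) ∷ (+ 0 , -[1+ 0 ]) ∷ (-[1+ 0 ] , + suc B) ∷ (+ 1 , -[1+ B ]) ∷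
               (-[1+ 0 ] , + suc (suc B)) ∷ (+ 1 , -[1+ suc B ]) ∷ []

  sixVectors-unique : Unique sixVectors
  sixVectors-unique =
    ((λ ()) ∷ (λ ()) ∷ (λ ()) ∷ (λ ()) ∷ (λ ()) ∷ []) ∷
    ((λ ()) ∷ (λ ()) ∷ (λ ()) ∷ (λ ()) ∷ []) ∷
    ((λ ()) ∷ (λ ()) ∷ (λ ()) ∷ []) ∷
    ((λ ()) ∷ (λ ()) ∷ []) ∷
    ((λ ()) ∷ []) ∷
    [] ∷ []

  -- The two vectors with first coordinate 1 share a case, since one argument excludes both as
  -- points of R.
  sixVectors-elim : (P : ℤ → ℤ → Set) → P (+ 0) (+ 1) → P (+ 0) -[1+ 0 ] →
    P -[1+ 0 ] (+ suc B) → (∀ n → P (+ 1) n) → P -[1+ 0 ] (+ suc (suc B)) →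
    ∀ m n → (m , n) ∈ sixVectors → P m n
  sixVectors-elim P p₁ p₂ p₃ p₄ p₅ _ _ (here ≡.refl)                                         = p₁
  sixVectors-elim P p₁ p₂ p₃ p₄ p₅ _ _ (there (here ≡.refl))                                 = p₂
  sixVectors-elim P p₁ p₂ p₃ p₄ p₅ _ _ (there (there (here ≡.refl)))                         = p₃
  sixVectors-elim P p₁ p₂ p₃ p₄ p₅ _ _ (there (there (there (here ≡.refl))))                 = p₄ _
  sixVectors-elim P p₁ p₂ p₃ p₄ p₅ _ _ (there (there (there (there (here ≡.refl)))))         = p₅
  sixVectors-elim P p₁ p₂ p₃ p₄ p₅ _ _ (there (there (there (there (there (here ≡.refl)))))) = p₄ _

  2∉sixVectors : ∀ n → ¬ ((+ 2 , n) ∈ sixVectors)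
  2∉sixVectors n (there (there (there (there (there (there ()))))))

  positive∈sixVectors : ∀ k n → (+ suc k , n) ∈ sixVectors → k ≡ 0
  positive∈sixVectors k n (there (there (there (here ≡.refl))))                 = ≡.refl
  positive∈sixVectors k n (there (there (there (there (there (here ≡.refl)))))) = ≡.refl

  -1,-d∉sixVectors : ∀ d → ¬ ((-[1+ 0 ] , ℤ.- + d) ∈ sixVectors)
  -1,-d∉sixVectors zero    (there (there (there (there (there (there ()))))))
  -1,-d∉sixVectors (suc d) (there (there (there (there (there (there ()))))))

module _ (em : ExcludedMiddle 0ℓ) (ℝ : CompleteOrderedField) where
  private
    module ℝ = CompleteOrderedField ℝ
    module R = IntegerCoefficients ℝ.commutativeRing
    module ≈-Reasoning = SetoidReasoning ℝ.setoid
  open ComplexNumbers ℝ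
  open SquareRoot ℝ

  -- Ordered-field arithmetic

  module RealProperties where
    open ℝ
    open RingProperties ring using (-0#≈0#)
    open R
    private module < = IsStrictTotalOrder isStrictTotalOrder
    private module NonStrict = StrictToNonStrict _≈_ _<_

    strictPartialOrder : StrictPartialOrder 0ℓ 0ℓ 0ℓ
    strictPartialOrder = record { isStrictPartialOrder = <.isStrictPartialOrder }

    module ≤-Reasoning = StrictReasoning strictPartialOrder

    <-trans : ∀ {x y z} → x < y → y < z → x < z
    <-trans = <.trans

    <-respˡ : ∀ {x y z} → x ≈ y → x < z → y < z
    <-respˡ = <.<-respˡ-≈

    <-respʳ : ∀ {x y z} → y ≈ z → x < y → x < z
    <-respʳ = <.<-respʳ-≈

    <-irrefl : ∀ {x} → ¬ (x < x)
    <-irrefl = <.irrefl refl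

    ≤-refl : ∀ {x} → x ≤ x
    ≤-refl = inj₂ refl

    ≤-trans : ∀ {x y z} → x ≤ y → y ≤ z → x ≤ z
    ≤-trans = NonStrict.trans isEquivalence <.<-resp-≈ <.trans

    <-≤-trans : ∀ {x y z} → x < y → y ≤ z → x < z
    <-≤-trans = NonStrict.<-≤-trans <.trans <-respʳ

    ≤-<-trans : ∀ {x y z} → x ≤ y → y < z → x < z
    ≤-<-trans = NonStrict.≤-<-trans sym <.trans <-respˡ

    ≤-respˡ : ∀ {x y z} → x ≈ y → x ≤ z → y ≤ z
    ≤-respˡ = NonStrict.≤-respˡ-≈ sym trans <-respˡ

    ≤-respʳ : ∀ {x y z} → y ≈ z → x ≤ y → x ≤ z
    ≤-respʳ = NonStrict.≤-respʳ-≈ trans <-respʳ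

    <⇒≱ : ∀ {x y} → x < y → ¬ (y ≤ x)
    <⇒≱ x<y y≤x = <-irrefl (<-≤-trans x<y y≤x)

    ≮⇒≥ : ∀ {x y} → ¬ (x < y) → y ≤ x
    ≮⇒≥ {x} {y} x≮y with <.compare x y
    ... | tri< x<y _ _ = ⊥-elim (x≮y x<y)
    ... | tri≈ _ x≈y _ = inj₂ (sym x≈y)
    ... | tri> _ _ y<x = inj₁ y<x

    ≰⇒> : ∀ {x y} → ¬ (x ≤ y) → y < x
    ≰⇒> {x} {y} x≰y with <.compare x y
    ... | tri< x<y _ _ = ⊥-elim (x≰y (inj₁ x<y))
    ... | tri≈ _ x≈y _ = ⊥-elim (x≰y (inj₂ x≈y))
    ... | tri> _ _ y<x = y<x

    ≤-antisym : ∀ {x y} → x ≤ y → y ≤ x → x ≈ y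
    ≤-antisym = NonStrict.antisym isEquivalence <.trans <.irrefl

    +-mono-≤ : ∀ {x y u v} → x ≤ y → u ≤ v → x + u ≤ y + v
    +-mono-≤ {x} {y} {u} {v} p q = ≤-trans (right x q)
      (≤-respˡ (+-comm v x) (≤-respʳ (+-comm v y) (right v p)))
      where
      right : ∀ x {y z} → y ≤ z → x + y ≤ x + z
      right x (inj₁ p) = inj₁ (+-monoʳ-< x p)
      right x (inj₂ p) = inj₂ (+-congˡ p)

    +-monoˡ-< : ∀ x {y z} → y < z → y + x < z + x
    +-monoˡ-< x {y} {z} p = <-respˡ (+-comm x y) (<-respʳ (+-comm x z) (+-monoʳ-< x p))

    +-mono-≤-< : ∀ {x y u v} → x ≤ y → u < v → x + u < y + v
    +-mono-≤-< {u = u} p q = ≤-<-trans (+-mono-≤ p ≤-refl) (+-monoʳ-< _ q)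

    0<y-x⇒x<y : ∀ {x y} → 0# < y - x → x < y
    0<y-x⇒x<y {x} {y} p = <-respˡ (+-identityʳ x)
      (<-respʳ (solve 2 (λ x y → x :+ (y :- x) := y) ≡.refl x y) (+-monoʳ-< x p))

    x<y⇒0<y-x : ∀ {x y} → x < y → 0# < y - x
    x<y⇒0<y-x {x} p = <-respˡ (-‿inverseʳ x) (+-monoˡ-< (- x) p)

    0≤y-x⇒x≤y : ∀ {x y} → 0# ≤ y - x → x ≤ y
    0≤y-x⇒x≤y {x} {y} p = ≤-respˡ (+-identityʳ x)
      (≤-respʳ (solve 2 (λ x y → x :+ (y :- x) := y) ≡.refl x y) (+-mono-≤ (≤-refl {x}) p))

    x≤y⇒0≤y-x : ∀ {x y} → x ≤ y → 0# ≤ y - x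
    x≤y⇒0≤y-x {x} p = ≤-respˡ (-‿inverseʳ x) (+-mono-≤ p ≤-refl)

    0≤x+y : ∀ {x y} → 0# ≤ x → 0# ≤ y → 0# ≤ x + y
    0≤x+y p q = ≤-respˡ (+-identityʳ 0#) (+-mono-≤ p q)

    0<x+y : ∀ {x y} → 0# ≤ x → 0# < y → 0# < x + y
    0<x+y p q = <-respˡ (+-identityʳ 0#) (+-mono-≤-< p q)

    *-nonNeg : ∀ {x y} → 0# ≤ x → 0# ≤ y → 0# ≤ x * y
    *-nonNeg (inj₁ p) (inj₁ q) = inj₁ (*-pos p q)
    *-nonNeg {y = y} (inj₂ p) _ = inj₂ (trans (sym (zeroˡ y)) (*-congʳ p))
    *-nonNeg {x} _ (inj₂ q)     = inj₂ (trans (sym (zeroʳ x)) (*-congˡ q))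

    *-monoˡ-≤ : ∀ {x y z} → 0# ≤ x → y ≤ z → x * y ≤ x * z
    *-monoˡ-≤ {x} {y} {z} p q = 0≤y-x⇒x≤y (≤-respʳ
      (solve 3 (λ x y z → x :* (z :- y) := x :* z :- x :* y) ≡.refl x y z)
      (*-nonNeg p (x≤y⇒0≤y-x q)))

    *-monoˡ-< : ∀ {x y z} → 0# < x → y < z → x * y < x * z
    *-monoˡ-< {x} {y} {z} p q = 0<y-x⇒x<y (<-respʳ
      (solve 3 (λ x y z → x :* (z :- y) := x :* z :- x :* y) ≡.refl x y z)
      (*-pos p (x<y⇒0<y-x q)))

    *-mono-≤ : ∀ {x y u v} → 0# ≤ x → x ≤ y → 0# ≤ u → u ≤ v → x * u ≤ y * v
    *-mono-≤ {x} {y} {u} {v} 0≤x x≤y 0≤u u≤v =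
      ≤-trans (*-monoˡ-≤ 0≤x u≤v) (≤-respˡ (*-comm v x) (≤-respʳ (*-comm v y)
        (*-monoˡ-≤ (≤-trans 0≤u u≤v) x≤y)))

    square-mono-< : ∀ {x y} → 0# ≤ x → x < y → x * x < y * y
    square-mono-< {x} {y} 0≤x x<y = 0<y-x⇒x<y (<-respʳ
      (solve 2 (λ x y → (y :- x) :* (x :+ y) := y :* y :- x :* x) ≡.refl x y)
      (*-pos (x<y⇒0<y-x x<y) (0<x+y 0≤x (≤-<-trans 0≤x x<y))))

    square-cancel-≤ : ∀ {x y} → 0# ≤ y → x * x ≤ y * y → x ≤ y
    square-cancel-≤ 0≤y xx≤yy = ≮⇒≥ λ y<x → <⇒≱ (square-mono-< 0≤y y<x) xx≤yy

    square-cancel-< : ∀ {x y} → 0# ≤ y → x * x < y * y → x < y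
    square-cancel-< {x} {y} 0≤y xx<yy with <.compare x y
    ... | tri< x<y _ _ = x<y
    ... | tri≈ _ x≈y _ = ⊥-elim (<-irrefl (<-respˡ (*-cong x≈y x≈y) xx<yy))
    ... | tri> _ _ y<x = ⊥-elim (<-irrefl (<-trans xx<yy (square-mono-< 0≤y y<x)))

    square-injective : ∀ {x y} → 0# ≤ x → 0# ≤ y → x * x ≈ y * y → x ≈ y
    square-injective 0≤x 0≤y p =
      ≤-antisym (square-cancel-≤ 0≤y (inj₂ p)) (square-cancel-≤ 0≤x (inj₂ (sym p)))

    0<⇒≉0 : ∀ {x} → 0# < x → ¬ (x ≈ 0#)
    0<⇒≉0 p q = <-irrefl (<-respʳ q p)

    0<x*x : ∀ {x} → ¬ (x ≈ 0#) → 0# < x * x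
    0<x*x {x} x≉0 with 0≤x*x x
    ... | inj₁ p = p
    ... | inj₂ p = ⊥-elim (x≉0 (begin
      x                ≈⟨ *-identityʳ x ⟨
      x * 1#           ≈⟨ *-congˡ (*-inverseʳ x≉0) ⟨
      x * (x * x ⁻¹)   ≈⟨ *-assoc x x (x ⁻¹) ⟨
      x * x * x ⁻¹     ≈⟨ *-congʳ p ⟨
      0# * x ⁻¹        ≈⟨ zeroˡ _ ⟩
      0#               ∎))
      where open ≈-Reasoning

    x*x≤0⇒x≈0 : ∀ {x} → x * x ≤ 0# → x ≈ 0#
    x*x≤0⇒x≈0 {x} xx≤0 with <.compare x 0#
    ... | tri≈ _ x≈0 _ = x≈0
    ... | tri< _ x≉0 _ = ⊥-elim (<⇒≱ (0<x*x x≉0) xx≤0)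
    ... | tri> _ x≉0 _ = ⊥-elim (<⇒≱ (0<x*x x≉0) xx≤0)

    *-cancelˡ-≈0 : ∀ {x y} → ¬ (x ≈ 0#) → x * y ≈ 0# → y ≈ 0#
    *-cancelˡ-≈0 {x} {y} x≉0 xy≈0 = begin
      y                ≈⟨ *-identityˡ y ⟨
      1# * y           ≈⟨ *-congʳ (*-inverseʳ x≉0) ⟨
      x * x ⁻¹ * y     ≈⟨ solve 3 (λ x i y → x :* i :* y := i :* (x :* y)) ≡.refl x (x ⁻¹) y ⟩
      x ⁻¹ * (x * y)   ≈⟨ *-congˡ xy≈0 ⟩
      x ⁻¹ * 0#        ≈⟨ zeroʳ _ ⟩
      0#               ∎
      where open ≈-Reasoning

    inverse-pos : ∀ {x y} → 0# < x → x * y ≈ 1# → 0# < y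
    inverse-pos {x} {y} 0<x xy≈1 with <.compare 0# y
    ... | tri< p _ _ = p
    ... | tri≈ _ p _ = ⊥-elim (<-irrefl (<-respʳ (trans (sym xy≈1) (trans (*-congˡ (sym p)) (zeroʳ x))) 0<1))
    ... | tri> _ _ p = ⊥-elim (<-irrefl (<-trans 0<1 (<-respˡ xy≈1 (<-respʳ (zeroʳ x) (*-monoˡ-< 0<x p)))))

    inverse-unique : ∀ {x y z} → x * y ≈ 1# → x * z ≈ 1# → y ≈ z
    inverse-unique {x} {y} {z} p q = begin
      y             ≈⟨ *-identityʳ y ⟨
      y * 1#        ≈⟨ *-congˡ q ⟨
      y * (x * z)   ≈⟨ solve 3 (λ x y z → y :* (x :* z) := x :* y :* z) ≡.refl x y z ⟩
      x * y * z     ≈⟨ *-congʳ p ⟩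
      1# * z        ≈⟨ *-identityˡ z ⟩
      z             ∎
      where open ≈-Reasoning

    fromℤ≡⟦⟧ : ∀ i → fromℤ i ≡ ⟦ i ⟧ℤ
    fromℤ≡⟦⟧ (+ n)    = ≡.refl
    fromℤ≡⟦⟧ -[1+ n ] = ≡.refl

    0≤n·1 : ∀ n → 0# ≤ n · 1#
    0≤n·1 zero    = ≤-refl
    0≤n·1 (suc n) = 0≤x+y (inj₁ 0<1) (0≤n·1 n)

    1≤[1+n]·1 : ∀ n → 1# ≤ suc n · 1#
    1≤[1+n]·1 n = ≤-respˡ (+-identityʳ 1#) (+-mono-≤ ≤-refl (0≤n·1 n))

    n·1-mono-≤ : ∀ {m n} → m ℕ.≤ n → m · 1# ≤ n · 1#
    n·1-mono-≤ {n = n} ℕ.z≤n = 0≤n·1 n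
    n·1-mono-≤ (ℕ.s≤s p)     = +-mono-≤ ≤-refl (n·1-mono-≤ p)

    1≤⟦i⟧² : ∀ {i} → ¬ (i ≡ + 0) → 1# ≤ ⟦ i ⟧ℤ * ⟦ i ⟧ℤ
    1≤⟦i⟧² {+ zero}  i≢0 = ⊥-elim (i≢0 ≡.refl)
    1≤⟦i⟧² {+ suc n} _   = ≤-respˡ (*-identityʳ 1#)
      (*-mono-≤ (inj₁ 0<1) (1≤[1+n]·1 n) (inj₁ 0<1) (1≤[1+n]·1 n))
    1≤⟦i⟧² { -[1+ n ]} _ = ≤-respʳ
      (solve 1 (λ x → x :* x := (:- x) :* (:- x)) ≡.refl (suc n · 1#))
      (1≤⟦i⟧² {+ suc n} λ ())

    supremum-nonNeg : ∀ {x s} → 0# ≤ x → IsSupremum (λ y → y * y ≤ x) s → 0# ≤ s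
    supremum-nonNeg p (s-upper , _) = s-upper 0# (≤-trans (inj₂ (zeroˡ 0#)) p)

    -- If s² < x, put D = x - s² and t = D / (1 + 2s + D); then x - (s+t)² = t(1 + t(2s+D)) ≥ 0, so
    -- s is no upper bound. If s² > x, the Newton step s - t with t = (s²-x)/(2s) satisfies (s-t)² -
    -- x = t², so it is a smaller upper bound.
    supremum-square : ∀ {x s} → 0# ≤ x → IsSupremum (λ y → y * y ≤ x) s → s * s ≈ x
    supremum-square {x} {s} p sup@(s-upper , s-least) with <.compare (s * s) x
    ... | tri≈ _ ss≈x _ = ss≈x
    ... | tri< ss<x _ _ = ⊥-elim (<⇒≱ s<s+t (s-upper (s + t) [s+t]²≤x))
      where
      D E t : Carrier
      D = x - s * s
      E = 1# + (s + s) + D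
      t = D * E ⁻¹

      0≤s : 0# ≤ s
      0≤s = supremum-nonNeg p sup

      0<D : 0# < D
      0<D = x<y⇒0<y-x ss<x

      0<E : 0# < E
      0<E = 0<x+y (0≤x+y (inj₁ 0<1) (0≤x+y 0≤s 0≤s)) 0<D

      EE⁻¹≈1 : E * E ⁻¹ ≈ 1#
      EE⁻¹≈1 = *-inverseʳ (0<⇒≉0 0<E)

      0<t : 0# < t
      0<t = *-pos 0<D (inverse-pos 0<E EE⁻¹≈1)

      s<s+t : s < s + t
      s<s+t = <-respˡ (+-identityʳ s) (+-monoʳ-< s 0<t)

      D≈tE : D ≈ t * E
      D≈tE = trans (sym (*-identityʳ D)) (trans (*-congˡ (sym EE⁻¹≈1))
        (solve 3 (λ d e i → d :* (e :* i) := d :* i :* e) ≡.refl D E (E ⁻¹)))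

      gap : D - (s + s) * t - t * t ≈ x - (s + t) * (s + t)
      gap = solve 3 (λ x s t →
        (x :- s :* s) :- (s :+ s) :* t :- t :* t := x :- (s :+ t) :* (s :+ t)) ≡.refl x s t

      gap′ : t * (1# + t * (s + s + D)) ≈ D - (s + s) * t - t * t
      gap′ = begin
        t * (1# + t * (s + s + D))
          ≈⟨ solve 4 (λ one s d t → t :* (one :+ t :* (s :+ s :+ d)) :=
               t :* (one :+ (t :* (one :+ (s :+ s) :+ d) :- t :* one))) ≡.refl 1# s D t ⟩
        t * (1# + (t * E - t * 1#))
          ≈⟨ *-congˡ (+-congˡ (+-congʳ (sym D≈tE))) ⟩
        t * (1# + (D - t * 1#))
          ≈⟨ solve 4 (λ one s d t → t :* (one :+ (d :- t :* one)) :=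
               t :* (one :+ (s :+ s) :+ d) :- (s :+ s) :* t :- t :* (t :* one)) ≡.refl 1# s D t ⟩
        t * E - (s + s) * t - t * (t * 1#)
          ≈⟨ +-cong (+-congʳ (sym D≈tE)) (-‿cong (*-congˡ (*-identityʳ t))) ⟩
        D - (s + s) * t - t * t ∎
        where open ≈-Reasoning

      [s+t]²≤x : (s + t) * (s + t) ≤ x
      [s+t]²≤x = 0≤y-x⇒x≤y (≤-respʳ (trans gap′ gap) (*-nonNeg (inj₁ 0<t)
        (0≤x+y (inj₁ 0<1) (*-nonNeg (inj₁ 0<t) (0≤x+y (0≤x+y 0≤s 0≤s) (inj₁ 0<D))))))
    ... | tri> _ _ x<ss = ⊥-elim (<⇒≱ s-t<s (s-least (s - t) s-t-upper))
      where
      D t : Carrier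
      D = s * s - x
      t = D * (s + s) ⁻¹

      0≤s : 0# ≤ s
      0≤s = supremum-nonNeg p sup

      0<s : 0# < s
      0<s with 0≤s
      ... | inj₁ 0<s = 0<s
      ... | inj₂ 0≈s = ⊥-elim (<⇒≱ (<-respʳ (trans (*-congʳ (sym 0≈s)) (zeroˡ s)) x<ss) p)

      0<s+s : 0# < s + s
      0<s+s = 0<x+y 0≤s 0<s

      0<D : 0# < D
      0<D = x<y⇒0<y-x x<ss

      [s+s]⁻¹ : (s + s) * (s + s) ⁻¹ ≈ 1#
      [s+s]⁻¹ = *-inverseʳ (0<⇒≉0 0<s+s)

      0<i : 0# < (s + s) ⁻¹
      0<i = inverse-pos 0<s+s [s+s]⁻¹

      0<t : 0# < t
      0<t = *-pos 0<D 0<i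

      s-t<s : s - t < s
      s-t<s = 0<y-x⇒x<y (<-respʳ (solve 2 (λ s t → t := s :- (s :- t)) ≡.refl s t) 0<t)

      t[s+s]≈D : t * (s + s) ≈ D
      t[s+s]≈D = trans (solve 3 (λ d e i → d :* i :* e := d :* (e :* i)) ≡.refl D (s + s) ((s + s) ⁻¹))
        (trans (*-congˡ [s+s]⁻¹) (*-identityʳ D))

      0≤s-t : 0# ≤ s - t
      0≤s-t = ≤-respʳ eqn (*-nonNeg (0≤x+y (0≤x*x s) p) (inj₁ 0<i))
        where
        open ≈-Reasoning
        eqn : (s * s + x) * (s + s) ⁻¹ ≈ s - t
        eqn = begin
          (s * s + x) * (s + s) ⁻¹
            ≈⟨ solve 3 (λ s x i → (s :* s :+ x) :* i := s :* ((s :+ s) :* i) :- (s :* s :- x) :* i) ≡.refl s x ((s + s) ⁻¹) ⟩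
          s * ((s + s) * (s + s) ⁻¹) - t
            ≈⟨ +-congʳ (trans (*-congˡ [s+s]⁻¹) (*-identityʳ s)) ⟩
          s - t ∎

      x≤[s-t]² : x ≤ (s - t) * (s - t)
      x≤[s-t]² = 0≤y-x⇒x≤y (≤-respʳ eqn (0≤x*x t))
        where
        open ≈-Reasoning
        eqn : t * t ≈ (s - t) * (s - t) - x
        eqn = begin
          t * t
            ≈⟨ solve 3 (λ s x t → t :* t := (s :- t) :* (s :- t) :- x :+ (t :* (s :+ s) :- (s :* s :- x))) ≡.refl s x t ⟩
          (s - t) * (s - t) - x + (t * (s + s) - D)
            ≈⟨ +-congˡ (trans (+-congʳ t[s+s]≈D) (-‿inverseʳ D)) ⟩
          (s - t) * (s - t) - x + 0#
            ≈⟨ +-identityʳ _ ⟩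
          (s - t) * (s - t) - x ∎

      s-t-upper : ∀ y → y * y ≤ x → y ≤ s - t
      s-t-upper y yy≤x = square-cancel-≤ 0≤s-t (≤-trans yy≤x x≤[s-t]²)

    √-nonNeg : ∀ {x} (p : 0# ≤ x) → 0# ≤ √ x p
    √-nonNeg p = supremum-nonNeg p (proj₂ (complete _ _ _))

    √-square : ∀ {x} (p : 0# ≤ x) → √ x p * √ x p ≈ x
    √-square p = supremum-square p (proj₂ (complete _ _ _))

  -- Powers of a number between 0 and 1

  module GeometricDecay where
    open ℝ
    open RealProperties
    open R using (solve; _:=_; _:+_; _:*_; _:-_; :-_; con)
    open RingProperties ring using (-‿involutive; -0#≈0#; -‿distribʳ-*)

    neg-mono-≤ : ∀ {x y} → x ≤ y → - y ≤ - x
    neg-mono-≤ {x} {y} p = 0≤y-x⇒x≤y (≤-respʳ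
      (solve 2 (λ x y → y :- x := (:- x) :- (:- y)) ≡.refl x y) (x≤y⇒0≤y-x p))

    module _ {r : Carrier} (0<r : 0# < r) (r<1 : r < 1#) where

      ^-nonNeg : ∀ n → 0# ≤ r ^ n
      ^-nonNeg zero    = inj₁ 0<1
      ^-nonNeg (suc n) = *-nonNeg (inj₁ 0<r) (^-nonNeg n)

      ^-antitone : ∀ {m n} → m ℕ.≤ n → r ^ n ≤ r ^ m
      ^-antitone {n = zero}  ℕ.z≤n = ≤-refl
      ^-antitone {n = suc n} ℕ.z≤n = ≤-trans
        (≤-respʳ (*-identityʳ r) (*-monoˡ-≤ (inj₁ 0<r) (^-antitone {n = n} ℕ.z≤n))) (inj₁ r<1)
      ^-antitone (ℕ.s≤s p) = *-monoˡ-≤ (inj₁ 0<r) (^-antitone p)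

      -- s = sup (− rⁿ) satisfies s ≤ r⁻¹ s, hence s ≥ 0.
      ^-small : ∀ ε → 0# < ε → ∃ λ N → ∀ n → N ℕ.≤ n → r ^ n < ε
      ^-small ε 0<ε with em {P = ∃ λ N → r ^ N < ε}
      ... | yes (N , rᴺ<ε) = N , λ n N≤n → ≤-<-trans (^-antitone N≤n) rᴺ<ε
      ... | no none = ⊥-elim (<⇒≱ 0<ε (≤-respˡ (-‿involutive ε) (≤-respʳ -0#≈0#
                        (neg-mono-≤ (≤-trans 0≤s (s-least (- ε) -ε-upper))))))
        where
        P : Carrier → Set
        P y = ∃ λ n → y ≈ - (r ^ n)

        upper : ∀ b → (∀ n → - (r ^ n) ≤ b) → IsUpperBound P b
        upper b h x (n , x≈) = ≤-respˡ (sym x≈) (h n)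

        supremum : ∃ (IsSupremum P)
        supremum = complete P (- (r ^ 0) , 0 , refl)
          (0# , upper 0# λ n → ≤-respʳ -0#≈0# (neg-mono-≤ (^-nonNeg n)))

        s : Carrier
        s = proj₁ supremum

        s-upper : ∀ n → - (r ^ n) ≤ s
        s-upper n = proj₁ (proj₂ supremum) _ (n , refl)

        s-least : ∀ b → (∀ n → - (r ^ n) ≤ b) → s ≤ b
        s-least b h = proj₂ (proj₂ supremum) b (upper b h)

        rr⁻¹≈1 : r * r ⁻¹ ≈ 1#
        rr⁻¹≈1 = *-inverseʳ (0<⇒≉0 0<r)

        r⁻¹r≈1 : ∀ x → r ⁻¹ * (r * x) ≈ x
        r⁻¹r≈1 x = trans (solve 3 (λ r i x → i :* (r :* x) := r :* i :* x) ≡.refl r (r ⁻¹) x)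
          (trans (*-congʳ rr⁻¹≈1) (*-identityˡ x))

        s≤r⁻¹s : s ≤ r ⁻¹ * s
        s≤r⁻¹s = s-least _ λ n → ≤-respˡ
          (trans (*-congˡ (-‿distribʳ-* r (r ^ n))) (r⁻¹r≈1 (- (r ^ n))))
          (*-monoˡ-≤ (inj₁ (inverse-pos 0<r rr⁻¹≈1)) (s-upper (suc n)))

        rs≤s : r * s ≤ s
        rs≤s = ≤-respʳ (trans (solve 3 (λ r i s → r :* (i :* s) := i :* (r :* s)) ≡.refl r (r ⁻¹) s) (r⁻¹r≈1 s))
          (*-monoˡ-≤ (inj₁ 0<r) s≤r⁻¹s)

        0≤s : 0# ≤ s
        -- A negative s would strictly increase under multiplication by r < 1, contrary to rs ≤ s.
        0≤s = ≮⇒≥ λ s<0 → <⇒≱ (<-respˡ (*-comm s 1#) (<-respʳ (*-comm s r) (s*1<s*r s<0)))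
          (≤-respʳ (sym (*-identityˡ s)) rs≤s)
          where
          s*1<s*r : s < 0# → s * 1# < s * r
          s*1<s*r s<0 = 0<y-x⇒x<y (<-respʳ
            (solve 3 (λ s r one → (con (+ 0) :- s) :* (one :- r) := s :* r :- s :* one) ≡.refl s r 1#)
            (*-pos (x<y⇒0<y-x s<0) (x<y⇒0<y-x r<1)))

        -ε-upper : ∀ n → - (r ^ n) ≤ - ε
        -ε-upper n = neg-mono-≤ (≮⇒≥ λ rⁿ<ε → none (n , rⁿ<ε))

  -- Complex numbers

  module ComplexProperties where
    open RealProperties
    open R using (solve; _:=_; _:+_; _:*_; _:-_; :-_; con)

    -ᶜ_ : ℂ → ℂ
    -ᶜ z = (ℝ.- re z) +i (ℝ.- im z)

    0ᶜ 1ᶜ : ℂ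
    0ᶜ = ofReal ℝ.0#
    1ᶜ = ofReal ℝ.1#

    -- Equivalent to _≈ᶜ_, but a record, so that unification does not split equations into components.
    infix 4 _≋_
    infix 2 _&_
    record _≋_ (z w : ℂ) : Set where
      constructor _&_
      field
        re≈ : re z ℝ.≈ re w
        im≈ : im z ℝ.≈ im w
    open _≋_ public

    ≋⇒≈ᶜ : ∀ {z w} → z ≋ w → z ≈ᶜ w
    ≋⇒≈ᶜ (p & q) = p , q

    ≈ᶜ⇒≋ : ∀ {z w} → z ≈ᶜ w → z ≋ w
    ≈ᶜ⇒≋ (p , q) = p & q

    ℂ-commutativeRing : CommutativeRing 0ℓ 0ℓ
    ℂ-commutativeRing = record
      { Carrier = ℂ ; _≈_ = _≋_ ; _+_ = _+ᶜ_ ; _*_ = _*ᶜ_ ; -_ = -ᶜ_ ; 0# = 0ᶜ ; 1# = 1ᶜ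
      ; isCommutativeRing = record
        { isRing = record
          { +-isAbelianGroup = record
            { isGroup = record
              { isMonoid = record
                { isSemigroup = record
                  { isMagma = record
                    { isEquivalence = record
                      { refl  = ℝ.refl & ℝ.refl
                      ; sym   = λ (p & q) → ℝ.sym p & ℝ.sym q
                      ; trans = λ (p & q) (p′ & q′) → ℝ.trans p p′ & ℝ.trans q q′ }
                    ; ∙-cong = λ (p & q) (p′ & q′) → ℝ.+-cong p p′ & ℝ.+-cong q q′ }
                  ; assoc = λ x y z → ℝ.+-assoc _ _ _ & ℝ.+-assoc _ _ _ }
                ; identity = (λ x → ℝ.+-identityˡ _ & ℝ.+-identityˡ _)
                           , (λ x → ℝ.+-identityʳ _ & ℝ.+-identityʳ _) }
              ; inverse = (λ x → ℝ.-‿inverseˡ _ & ℝ.-‿inverseˡ _)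
                        , (λ x → ℝ.-‿inverseʳ _ & ℝ.-‿inverseʳ _)
              ; ⁻¹-cong = λ (p & q) → ℝ.-‿cong p & ℝ.-‿cong q }
            ; comm = λ x y → ℝ.+-comm _ _ & ℝ.+-comm _ _ }
          ; *-cong = λ (p & q) (p′ & q′) →
              ℝ.+-cong (ℝ.*-cong p p′) (ℝ.-‿cong (ℝ.*-cong q q′)) &
              ℝ.+-cong (ℝ.*-cong p q′) (ℝ.*-cong q p′)
          ; *-assoc = λ (x +i x′) (y +i y′) (z +i z′) →
              solve 6 (λ x x′ y y′ z z′ →
                (x :* y :- x′ :* y′) :* z :- (x :* y′ :+ x′ :* y) :* z′ :=
                x :* (y :* z :- y′ :* z′) :- x′ :* (y :* z′ :+ y′ :* z)) ≡.refl x x′ y y′ z z′ &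
              solve 6 (λ x x′ y y′ z z′ →
                (x :* y :- x′ :* y′) :* z′ :+ (x :* y′ :+ x′ :* y) :* z :=
                x :* (y :* z′ :+ y′ :* z) :+ x′ :* (y :* z :- y′ :* z′)) ≡.refl x x′ y y′ z z′
          ; *-identity = *-identityˡ , (λ z → ≈-trans (*-comm z 1ᶜ) (*-identityˡ z))
          ; distrib = distribˡ , λ x y z → ≈-trans (*-comm (y +ᶜ z) x) (≈-trans (distribˡ x y z)
              (ℝ.+-cong (re≈ (*-comm x y)) (re≈ (*-comm x z)) &
               ℝ.+-cong (im≈ (*-comm x y)) (im≈ (*-comm x z)))) }
        ; *-comm = *-comm } }
      where
      ≈-trans : ∀ {x y z} → x ≋ y → y ≋ z → x ≋ z
      ≈-trans (p & q) (p′ & q′) = ℝ.trans p p′ & ℝ.trans q q′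

      *-comm : ∀ x y → x *ᶜ y ≋ y *ᶜ x
      *-comm (x +i x′) (y +i y′) =
        solve 4 (λ x x′ y y′ → x :* y :- x′ :* y′ := y :* x :- y′ :* x′) ≡.refl x x′ y y′ &
        solve 4 (λ x x′ y y′ → x :* y′ :+ x′ :* y := y :* x′ :+ y′ :* x) ≡.refl x x′ y y′

      *-identityˡ : ∀ z → 1ᶜ *ᶜ z ≋ z
      *-identityˡ (x +i x′) =
        ℝ.trans (solve 3 (λ x x′ one → one :* x :- con (+ 0) :* x′ := one :* x) ≡.refl x x′ ℝ.1#) (ℝ.*-identityˡ x) &
        ℝ.trans (solve 3 (λ x x′ one → one :* x′ :+ con (+ 0) :* x := one :* x′) ≡.refl x x′ ℝ.1#) (ℝ.*-identityˡ x′)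

      distribˡ : ∀ x y z → x *ᶜ (y +ᶜ z) ≋ x *ᶜ y +ᶜ x *ᶜ z
      distribˡ (x +i x′) (y +i y′) (z +i z′) =
        solve 6 (λ x x′ y y′ z z′ → x :* (y :+ z) :- x′ :* (y′ :+ z′) :=
          (x :* y :- x′ :* y′) :+ (x :* z :- x′ :* z′)) ≡.refl x x′ y y′ z z′ &
        solve 6 (λ x x′ y y′ z z′ → x :* (y′ :+ z′) :+ x′ :* (y :+ z) :=
          (x :* y′ :+ x′ :* y) :+ (x :* z′ :+ x′ :* z)) ≡.refl x x′ y y′ z z′

    -- Polynomial in the components, so that identities about moduli reduce to ring identities
    -- without square roots.
    normSq : ℂ → ℝ.Carrier
    normSq z = re z ℝ.* re z ℝ.+ im z ℝ.* im z

    normSq-cong : ∀ {z w} → z ≋ w → normSq z ℝ.≈ normSq w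
    normSq-cong (p & q) = ℝ.+-cong (ℝ.*-cong p p) (ℝ.*-cong q q)

    normSq-* : ∀ z w → normSq (z *ᶜ w) ℝ.≈ normSq z ℝ.* normSq w
    normSq-* (x +i x′) (y +i y′) = solve 4 (λ x x′ y y′ →
      (x :* y :- x′ :* y′) :* (x :* y :- x′ :* y′) :+ (x :* y′ :+ x′ :* y) :* (x :* y′ :+ x′ :* y) :=
      (x :* x :+ x′ :* x′) :* (y :* y :+ y′ :* y′)) ≡.refl x x′ y y′

    ∣∣-nonNeg : ∀ z → ℝ.0# ℝ.≤ ∣ z ∣
    ∣∣-nonNeg z = √-nonNeg (0≤x*x+y*y (re z) (im z))

    ∣∣-square : ∀ z → ∣ z ∣ ℝ.* ∣ z ∣ ℝ.≈ normSq z
    ∣∣-square z = √-square (0≤x*x+y*y (re z) (im z))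

    ∣∣-unique : ∀ {x} z → ℝ.0# ℝ.≤ x → normSq z ℝ.≈ x ℝ.* x → ∣ z ∣ ℝ.≈ x
    ∣∣-unique z 0≤x p = square-injective (∣∣-nonNeg z) 0≤x (ℝ.trans (∣∣-square z) p)

    ∣∣-normSq : ∀ z w → normSq z ℝ.≈ normSq w → ∣ z ∣ ℝ.≈ ∣ w ∣
    ∣∣-normSq z w p = ∣∣-unique z (∣∣-nonNeg w) (ℝ.trans p (ℝ.sym (∣∣-square w)))

    ∣∣-cong : ∀ {z w} → z ≋ w → ∣ z ∣ ℝ.≈ ∣ w ∣
    ∣∣-cong {z} {w} p = ∣∣-normSq z w (normSq-cong p)

    ∣∣-* : ∀ z w → ∣ z *ᶜ w ∣ ℝ.≈ ∣ z ∣ ℝ.* ∣ w ∣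
    ∣∣-* z w = ∣∣-unique (z *ᶜ w) (*-nonNeg (∣∣-nonNeg z) (∣∣-nonNeg w))
      (ℝ.trans (normSq-* z w) (ℝ.trans (ℝ.*-cong (ℝ.sym (∣∣-square z)) (ℝ.sym (∣∣-square w)))
        (solve 2 (λ x y → (x :* x) :* (y :* y) := (x :* y) :* (x :* y)) ≡.refl ∣ z ∣ ∣ w ∣)))

    ∣∣-neg : ∀ z → ∣ -ᶜ z ∣ ℝ.≈ ∣ z ∣
    ∣∣-neg z = ∣∣-normSq (-ᶜ z) z (solve 2 (λ x y →
      (:- x) :* (:- x) :+ (:- y) :* (:- y) := x :* x :+ y :* y) ≡.refl (re z) (im z))

    -- After squaring, this is the Cauchy-Schwarz inequality, which follows from Lagrange's
    -- identity: |z|²|w|² - ⟨z,w⟩² is the square of `cross`.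
    ∣∣-triangle : ∀ z w → ∣ z +ᶜ w ∣ ℝ.≤ ∣ z ∣ ℝ.+ ∣ w ∣
    ∣∣-triangle z w = square-cancel-≤ (0≤x+y (∣∣-nonNeg z) (∣∣-nonNeg w))
      (≤-respˡ (ℝ.sym (ℝ.trans (∣∣-square (z +ᶜ w)) expandˡ)) (≤-respʳ expandʳ
        (+-mono-≤ ≤-refl (+-mono-≤ ⟨z,w⟩≤ ⟨z,w⟩≤))))
      where
      ⟨z,w⟩ : ℝ.Carrier
      ⟨z,w⟩ = re z ℝ.* re w ℝ.+ im z ℝ.* im w

      cross : ℝ.Carrier
      cross = re z ℝ.* im w ℝ.- im z ℝ.* re w

      ⟨z,w⟩≤ : ⟨z,w⟩ ℝ.≤ ∣ z ∣ ℝ.* ∣ w ∣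
      ⟨z,w⟩≤ = square-cancel-≤ (*-nonNeg (∣∣-nonNeg z) (∣∣-nonNeg w))
        (0≤y-x⇒x≤y (≤-respʳ (ℝ.trans
          (solve 4 (λ x x′ y y′ → (x :* y′ :- x′ :* y) :* (x :* y′ :- x′ :* y) :=
            (x :* x :+ x′ :* x′) :* (y :* y :+ y′ :* y′) :- (x :* y :+ x′ :* y′) :* (x :* y :+ x′ :* y′))
            ≡.refl (re z) (im z) (re w) (im w))
          (ℝ.+-congʳ (ℝ.trans (ℝ.*-cong (ℝ.sym (∣∣-square z)) (ℝ.sym (∣∣-square w)))
            (solve 2 (λ x y → (x :* x) :* (y :* y) := (x :* y) :* (x :* y)) ≡.refl ∣ z ∣ ∣ w ∣))))
          (0≤x*x cross)))

      expandˡ : normSq (z +ᶜ w) ℝ.≈ (normSq z ℝ.+ normSq w) ℝ.+ (⟨z,w⟩ ℝ.+ ⟨z,w⟩)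
      expandˡ = solve 4 (λ x x′ y y′ →
        (x :+ y) :* (x :+ y) :+ (x′ :+ y′) :* (x′ :+ y′) :=
        ((x :* x :+ x′ :* x′) :+ (y :* y :+ y′ :* y′)) :+ ((x :* y :+ x′ :* y′) :+ (x :* y :+ x′ :* y′)))
        ≡.refl (re z) (im z) (re w) (im w)

      expandʳ : (normSq z ℝ.+ normSq w) ℝ.+ (∣ z ∣ ℝ.* ∣ w ∣ ℝ.+ ∣ z ∣ ℝ.* ∣ w ∣) ℝ.≈
                (∣ z ∣ ℝ.+ ∣ w ∣) ℝ.* (∣ z ∣ ℝ.+ ∣ w ∣)
      expandʳ = ℝ.trans (ℝ.+-congʳ (ℝ.+-cong (ℝ.sym (∣∣-square z)) (ℝ.sym (∣∣-square w))))
        (solve 2 (λ x y → (x :* x :+ y :* y) :+ (x :* y :+ x :* y) := (x :+ y) :* (x :+ y))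
          ≡.refl ∣ z ∣ ∣ w ∣)

    ∣re∣²≤∣z∣² : ∀ z → re z ℝ.* re z ℝ.≤ normSq z
    ∣re∣²≤∣z∣² z = ≤-respˡ (ℝ.+-identityʳ _) (+-mono-≤ ≤-refl (0≤x*x (im z)))

    ∣im∣²≤∣z∣² : ∀ z → im z ℝ.* im z ℝ.≤ normSq z
    ∣im∣²≤∣z∣² z = ≤-respˡ (ℝ.+-identityˡ _) (+-mono-≤ (0≤x*x (re z)) ≤-refl)

  private
    module C = CommutativeRing ComplexProperties.ℂ-commutativeRing
    module I = IntegerCoefficients ComplexProperties.ℂ-commutativeRing
    module ≈ᶜ-Reasoning = SetoidReasoning C.setoid

  -- Real and integer constants in ℂ

  module ℂ-Integers where
    open RealProperties
    open ComplexProperties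
    open I using () renaming (⟦_⟧ℤ to ι) public

    ofReal-cong : ∀ {x y} → x ℝ.≈ y → ofReal x ≋ ofReal y
    ofReal-cong p = p & ℝ.refl

    ofReal-+ : ∀ x y → ofReal (x ℝ.+ y) ≋ ofReal x +ᶜ ofReal y
    ofReal-+ x y = ℝ.refl & ℝ.sym (ℝ.+-identityˡ ℝ.0#)

    ofReal-neg : ∀ x → ofReal (ℝ.- x) ≋ -ᶜ ofReal x
    ofReal-neg x = ℝ.refl & R.solve 0 (R.con (+ 0) R.:= R.:- R.con (+ 0)) ≡.refl

    ofReal-− : ∀ x y → ofReal (x ℝ.- y) ≋ ofReal x -ᶜ ofReal y
    ofReal-− x y = C.trans (ofReal-+ x (ℝ.- y)) (C.+-congˡ (ofReal-neg y))

    ofReal-* : ∀ x y → ofReal (x ℝ.* y) ≋ ofReal x *ᶜ ofReal y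
    ofReal-* x y =
      R.solve 2 (λ x y → x R.:* y R.:= x R.:* y R.:- R.con (+ 0) R.:* R.con (+ 0)) ≡.refl x y &
      R.solve 2 (λ x y → R.con (+ 0) R.:= x R.:* R.con (+ 0) R.:+ R.con (+ 0) R.:* y) ≡.refl x y

    ofReal-n·1 : ∀ n → ofReal (n ℝ.· ℝ.1#) ≋ ι (+ n)
    ofReal-n·1 zero    = C.refl
    ofReal-n·1 (suc n) = C.trans (ofReal-+ ℝ.1# (n ℝ.· ℝ.1#)) (C.+-congˡ (ofReal-n·1 n))

    ofReal-fromℤ : ∀ i → ofReal (ℝ.fromℤ i) ≋ ι i
    ofReal-fromℤ (+ n)    = ofReal-n·1 n
    ofReal-fromℤ -[1+ n ] = C.trans (ofReal-neg _) (C.-‿cong (ofReal-n·1 (suc n)))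

    normSq-ofReal : ∀ x → normSq (ofReal x) ℝ.≈ x ℝ.* x
    normSq-ofReal x = R.solve 1 (λ x → x R.:* x R.:+ R.con (+ 0) R.:* R.con (+ 0) R.:= x R.:* x) ≡.refl x

    normSq≈0⇒≈0 : ∀ {z} → normSq z ℝ.≈ ℝ.0# → z ≋ 0ᶜ
    normSq≈0⇒≈0 {z} p =
      x*x≤0⇒x≈0 (≤-respʳ p (∣re∣²≤∣z∣² z)) & x*x≤0⇒x≈0 (≤-respʳ p (∣im∣²≤∣z∣² z))

    *ᶜ-cancelˡ-≈0 : ∀ {z w} → ¬ (normSq z ℝ.≈ ℝ.0#) → z *ᶜ w ≋ 0ᶜ → w ≋ 0ᶜ
    *ᶜ-cancelˡ-≈0 {z} {w} z≉0 zw≈0 = normSq≈0⇒≈0 (*-cancelˡ-≈0 z≉0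
      (ℝ.trans (ℝ.sym (normSq-* z w)) (ℝ.trans (normSq-cong zw≈0)
        (ℝ.trans (normSq-ofReal ℝ.0#) (ℝ.zeroˡ ℝ.0#)))))

  -- The roots of the cubic

  module Roots (a b : ℤ) where
    open RealProperties
    open ComplexProperties
    open ℂ-Integers
    open Cubic ℝ a b using (IsRoot; IsDominantRoot; module Approximation; _·²_; _-²_; fromℤ²)
    open I using (solve; _:=_; _:+_; _:*_; _:-_; :-_; con)

    -- In this form the cubic equation displays the inverse of a root.
    root⇒ : ∀ {z} → IsRoot z → z *ᶜ (z *ᶜ z -ᶜ ι a *ᶜ z -ᶜ ι b) ≋ 1ᶜ
    root⇒ {z} p = begin
      z *ᶜ (z *ᶜ z -ᶜ ι a *ᶜ z -ᶜ ι b)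
        ≈⟨ solve 4 (λ z a b one → z :* (z :* z :- a :* z :- b) :=
             (z :* (z :* z) :- a :* (z :* z) :- b :* z :- one) :+ one) ≡.refl z (ι a) (ι b) 1ᶜ ⟩
      (z *ᶜ (z *ᶜ z) -ᶜ ι a *ᶜ (z *ᶜ z) -ᶜ ι b *ᶜ z -ᶜ 1ᶜ) +ᶜ 1ᶜ
        ≈⟨ C.+-congʳ (C.+-congʳ (C.+-cong (C.+-cong (C.*-congˡ z²) (C.-‿cong (C.*-cong (ofReal-fromℤ a) z²)))
             (C.-‿cong (C.*-congʳ (ofReal-fromℤ b))))) ⟨
      ((z ^ᶜ 3) -ᶜ (ofReal (ℝ.fromℤ a) *ᶜ (z ^ᶜ 2)) -ᶜ (ofReal (ℝ.fromℤ b) *ᶜ z) -ᶜ 1ᶜ) +ᶜ 1ᶜ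
        ≈⟨ C.+-congʳ (≈ᶜ⇒≋ p) ⟩
      0ᶜ +ᶜ 1ᶜ ≈⟨ C.+-identityˡ 1ᶜ ⟩
      1ᶜ ∎
      where
      open ≈ᶜ-Reasoning
      z² : z ^ᶜ 2 ≋ z *ᶜ z
      z² = C.*-congˡ (C.*-identityʳ z)

    module _ (β : ℝ.Carrier) (β-dominant : IsDominantRoot β)
             (α : ℂ) (α-root : IsRoot α) (imα≉0 : ¬ (im α ℝ.≈ ℝ.0#)) where

      private
        a′ b′ : ℝ.Carrier
        a′ = ℝ.fromℤ a
        b′ = ℝ.fromℤ b

      -- The inverse of β; also αᾱ, since the three roots have product 1.
      γ : ℝ.Carrier
      γ = β ℝ.* β ℝ.- a′ ℝ.* β ℝ.- b′

      βγ≈1 : β ℝ.* γ ℝ.≈ ℝ.1#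
      βγ≈1 = re≈ (begin
        ofReal (β ℝ.* γ)
          ≈⟨ ofReal-* β γ ⟩
        ofReal β *ᶜ ofReal γ
          ≈⟨ C.*-congˡ (ofReal-− (β ℝ.* β ℝ.- a′ ℝ.* β) b′) ⟩
        ofReal β *ᶜ (ofReal (β ℝ.* β ℝ.- a′ ℝ.* β) -ᶜ ofReal b′)
          ≈⟨ C.*-congˡ (C.+-cong (C.trans (ofReal-− (β ℝ.* β) (a′ ℝ.* β)) (C.+-cong (ofReal-* β β)
               (C.-‿cong (C.trans (ofReal-* a′ β) (C.*-congʳ (ofReal-fromℤ a)))))) (C.-‿cong (ofReal-fromℤ b))) ⟩
        ofReal β *ᶜ (ofReal β *ᶜ ofReal β -ᶜ ι a *ᶜ ofReal β -ᶜ ι b)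
          ≈⟨ root⇒ (proj₁ β-dominant) ⟩
        1ᶜ ∎)
        where
        open ≈ᶜ-Reasoning

      private
        x y : ℝ.Carrier
        x = re α
        y = im α

        -- The quadratic factor x² + (β−a)x + γ of the cubic, at α.
        Q : ℂ
        Q = α *ᶜ α +ᶜ ofReal (β ℝ.- a′) *ᶜ α +ᶜ ofReal γ

        [α-β]Q≈0 : (α -ᶜ ofReal β) *ᶜ Q ≋ 0ᶜ
        [α-β]Q≈0 = begin
          (α -ᶜ ofReal β) *ᶜ Q
            ≈⟨ C.*-congˡ (C.+-congʳ (C.+-congˡ (C.*-congʳ (C.trans (ofReal-+ β (ℝ.- a′)) (C.+-congˡ (ofReal-neg a′)))))) ⟩
          (α -ᶜ ofReal β) *ᶜ (α *ᶜ α +ᶜ (ofReal β -ᶜ A) *ᶜ α +ᶜ ofReal γ)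
            ≈⟨ solve 5 (λ α β a b γ → (α :- β) :* (α :* α :+ (β :- a) :* α :+ γ) :=
                 α :* (α :* α :- a :* α :- b) :- β :* γ :+ α :* (γ :- (β :* β :- a :* β :- b)))
                 ≡.refl α (ofReal β) A Bc (ofReal γ) ⟩
          α *ᶜ (α *ᶜ α -ᶜ A *ᶜ α -ᶜ Bc) -ᶜ ofReal β *ᶜ ofReal γ +ᶜ
            α *ᶜ (ofReal γ -ᶜ (ofReal β *ᶜ ofReal β -ᶜ A *ᶜ ofReal β -ᶜ Bc))
            ≈⟨ C.+-cong (C.+-cong rootα (C.-‿cong βγ≈1ᶜ)) (C.*-congˡ (C.trans (C.+-congˡ (C.-‿cong (C.sym γᶜ))) (C.-‿inverseʳ (ofReal γ)))) ⟩
          1ᶜ -ᶜ 1ᶜ +ᶜ α *ᶜ 0ᶜ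
            ≈⟨ C.+-cong (C.-‿inverseʳ 1ᶜ) (C.zeroʳ α) ⟩
          0ᶜ +ᶜ 0ᶜ ≈⟨ C.+-identityˡ 0ᶜ ⟩
          0ᶜ ∎
          where
          open ≈ᶜ-Reasoning
          A Bc : ℂ
          A  = ofReal a′
          Bc = ofReal b′
          βγ≈1ᶜ : ofReal β *ᶜ ofReal γ ≋ 1ᶜ
          βγ≈1ᶜ = C.trans (C.sym (ofReal-* β γ)) (ofReal-cong βγ≈1)
          γᶜ : ofReal γ ≋ ofReal β *ᶜ ofReal β -ᶜ A *ᶜ ofReal β -ᶜ Bc
          γᶜ = C.trans (ofReal-− (β ℝ.* β ℝ.- a′ ℝ.* β) b′) (C.+-congʳ
            (C.trans (ofReal-− (β ℝ.* β) (a′ ℝ.* β)) (C.+-cong (ofReal-* β β) (C.-‿cong (ofReal-* a′ β)))))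
          rootα : α *ᶜ (α *ᶜ α -ᶜ A *ᶜ α -ᶜ Bc) ≋ 1ᶜ
          rootα = C.trans (C.*-congˡ (C.+-cong (C.+-congˡ (C.-‿cong (C.*-congʳ (ofReal-fromℤ a)))) (C.-‿cong (ofReal-fromℤ b)))) (root⇒ α-root)

        0<im² : ℝ.0# ℝ.< y ℝ.* y
        0<im² = 0<x*x imα≉0

        Q≈0 : Q ≋ 0ᶜ
        -- As β is real, α - β has imaginary part im α, hence nonzero norm, and can be cancelled.
        Q≈0 = *ᶜ-cancelˡ-≈0 (0<⇒≉0 (<-≤-trans 0<im² (≤-respˡ
          (R.solve 1 (λ y → (y R.:- R.con (+ 0)) R.:* (y R.:- R.con (+ 0)) R.:= y R.:* y) ≡.refl y)
          (∣im∣²≤∣z∣² (α -ᶜ ofReal β))))) [α-β]Q≈0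

      -- The imaginary part of Q = 0 is im α times this expression. The real part then yields
      -- `normSqα≈γ`.
      2re+β-a≈0 : re α ℝ.+ re α ℝ.+ (β ℝ.- a′) ℝ.≈ ℝ.0#
      2re+β-a≈0 = *-cancelˡ-≈0 imα≉0 (ℝ.trans
        (R.solve 3 (λ x y c → y R.:* (x R.:+ x R.:+ c) R.:=
          ((x R.:* y R.:+ y R.:* x) R.:+ (c R.:* y R.:+ R.con (+ 0) R.:* x)) R.:+ R.con (+ 0)) ≡.refl x y (β ℝ.- a′))
        (im≈ Q≈0))

      normSqα≈γ : normSq α ℝ.≈ γ
      normSqα≈γ = ℝ.trans
        (R.solve 4 (λ x y c g → x R.:* x R.:+ y R.:* y R.:=
          g R.:+ x R.:* (x R.:+ x R.:+ c) R.:-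
          (((x R.:* x R.:- y R.:* y) R.:+ (c R.:* x R.:- R.con (+ 0) R.:* y)) R.:+ g)) ≡.refl x y (β ℝ.- a′) γ)
        (ℝ.trans (ℝ.+-cong (ℝ.+-congˡ (ℝ.trans (ℝ.*-congˡ 2re+β-a≈0) (ℝ.zeroʳ x))) (ℝ.-‿cong (re≈ Q≈0)))
          (R.solve 1 (λ g → g R.:+ R.con (+ 0) R.:- R.con (+ 0) R.:= g) ≡.refl γ))

      0<γ : ℝ.0# ℝ.< γ
      0<γ = <-respʳ normSqα≈γ (<-≤-trans 0<im² (∣im∣²≤∣z∣² α))

      0<β : ℝ.0# ℝ.< β
      0<β = inverse-pos 0<γ (ℝ.trans (ℝ.*-comm γ β) βγ≈1)

      γ<β² : γ ℝ.< β ℝ.* β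
      γ<β² with proj₂ β-dominant α α-root
      ... | inj₁ (_ , imα≈0) = ⊥-elim (imα≉0 imα≈0)
      ... | inj₂ ∣α∣<∣β∣     = <-respˡ (ℝ.trans (∣∣-square α) normSqα≈γ)
        (<-respʳ (ℝ.trans (∣∣-square (ofReal β)) (normSq-ofReal β)) (square-mono-< (∣∣-nonNeg α) ∣α∣<∣β∣))

      -- If γ ≥ 1, then βγ = 1 gives β ≤ 1, hence β² ≤ γ. But dominance of β says |α|² = γ < β².
      γ<1 : γ ℝ.< ℝ.1#
      γ<1 = ≰⇒> λ 1≤γ → <⇒≱ γ<β² (≤-trans (β²≤1 1≤γ) 1≤γ)
        where
        β²≤1 : ℝ.1# ℝ.≤ γ → β ℝ.* β ℝ.≤ ℝ.1#
        β²≤1 1≤γ = ≤-respʳ (ℝ.*-identityˡ ℝ.1#) (*-mono-≤ (inj₁ 0<β) β≤1 (inj₁ 0<β) β≤1)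
          where
          β≤1 : β ℝ.≤ ℝ.1#
          β≤1 = ≤-respˡ (ℝ.*-identityʳ β) (≤-respʳ βγ≈1 (*-monoˡ-≤ (inj₁ 0<β) 1≤γ))

      0<∣α∣ : ℝ.0# ℝ.< ∣ α ∣
      0<∣α∣ = square-cancel-< (∣∣-nonNeg α) (<-respˡ (ℝ.sym (ℝ.zeroˡ ℝ.0#))
        (<-respʳ (ℝ.sym (ℝ.trans (∣∣-square α) normSqα≈γ)) 0<γ))

      ∣α∣<1 : ∣ α ∣ ℝ.< ℝ.1#
      ∣α∣<1 = square-cancel-< (inj₁ ℝ.0<1) (<-respˡ (ℝ.sym (ℝ.trans (∣∣-square α) normSqα≈γ))
        (<-respʳ (ℝ.sym (ℝ.*-identityˡ ℝ.1#)) γ<1))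

      private
        ᾱ : ℂ
        ᾱ = x +i (ℝ.- y)

        αᾱ≈γ : α *ᶜ ᾱ ≋ ofReal γ
        αᾱ≈γ = ℝ.trans (R.solve 2 (λ x y → x R.:* x R.:- y R.:* (R.:- y) R.:= x R.:* x R.:+ y R.:* y) ≡.refl x y) normSqα≈γ &
               R.solve 2 (λ x y → x R.:* (R.:- y) R.:+ y R.:* x R.:= R.con (+ 0)) ≡.refl x y

        -- Vieta's formula: the pairwise products of the roots sum to -b.
        b+β[α+ᾱ]+γ≈0 : ofReal b′ +ᶜ ofReal β *ᶜ (α +ᶜ ᾱ) +ᶜ ofReal γ ≋ 0ᶜ
        b+β[α+ᾱ]+γ≈0 =
          ℝ.trans (R.solve 5 (λ x y β a b →
            b R.:+ (β R.:* (x R.:+ x) R.:- R.con (+ 0) R.:* (y R.:+ (R.:- y))) R.:+ (β R.:* β R.:- a R.:* β R.:- b) R.:=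
            β R.:* (x R.:+ x R.:+ (β R.:- a))) ≡.refl x y β a′ b′)
            (ℝ.trans (ℝ.*-congˡ 2re+β-a≈0) (ℝ.zeroʳ β)) &
          R.solve 3 (λ x y β → R.con (+ 0) R.:+ (β R.:* (y R.:+ (R.:- y)) R.:+ R.con (+ 0) R.:* (x R.:+ x)) R.:+ R.con (+ 0) R.:=
            R.con (+ 0)) ≡.refl x y β

        -- Up to conjugation and the factor −(βα)⁻¹, the linear form in 𝒩 sends qθ − g to
        -- q α² + g₁ + (b g₁ + g₂) α.
        scaling : ∀ q g₁ g₂ →
          -ᶜ (ofReal β *ᶜ α *ᶜ ((ᾱ +ᶜ ofReal b′ *ᶜ ofReal γ) *ᶜ (q *ᶜ ofReal γ -ᶜ g₁) +ᶜ
               (q *ᶜ (ofReal γ *ᶜ ofReal γ) -ᶜ g₂) *ᶜ ofReal γ)) ≋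
          q *ᶜ (α *ᶜ α) +ᶜ g₁ +ᶜ (ofReal b′ *ᶜ g₁ +ᶜ g₂) *ᶜ α
        scaling q g₁ g₂ = C.trans
          (solve 8 (λ α ᾱ β γ b q g₁ g₂ →
            :- (β :* α :* ((ᾱ :+ b :* γ) :* (q :* γ :- g₁) :+ (q :* (γ :* γ) :- g₂) :* γ)) :=
            (q :* (α :* α) :+ g₁ :+ (b :* g₁ :+ g₂) :* α) :+
            -- The two sides differ by a combination of αᾱ - γ, βγ - 1 and Vieta's expression, all
            -- of which vanish.
            (g₁ :* β :* (α :* ᾱ :- γ) :+
             (g₂ :* α :+ g₁ :+ g₁ :* b :* α :- q :* (α :* ᾱ :+ α :* b :* γ :+ α :* γ :* γ) :+ q :* α :* (α :+ ᾱ))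
               :* (β :* γ :- con (+ 1)) :-
             q :* α :* γ :* (b :+ β :* (α :+ ᾱ) :+ γ)))
            ≡.refl α ᾱ (ofReal β) (ofReal γ) (ofReal b′) q g₁ g₂)
          (C.trans (C.+-congˡ (C.trans (C.+-cong (C.+-cong
              (C.*-congˡ (C.trans (C.+-congʳ αᾱ≈γ) (C.-‿inverseʳ _)))
              (C.*-congˡ (C.trans (C.+-cong βγ≈1ᶜ (C.-‿cong (C.+-identityʳ 1ᶜ))) (C.-‿inverseʳ 1ᶜ))))
              (C.-‿cong (C.*-congˡ b+β[α+ᾱ]+γ≈0)))
            (solve 3 (λ u v w → u :* con (+ 0) :+ v :* con (+ 0) :- w :* con (+ 0) := con (+ 0)) ≡.refl _ _ _)))
            (C.+-identityʳ _))
          where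
          βγ≈1ᶜ : ofReal β *ᶜ ofReal γ ≋ 1ᶜ
          βγ≈1ᶜ = C.trans (C.sym (ofReal-* β γ)) (ofReal-cong βγ≈1)

      W : ℕ → ℤ × ℤ → ℂ
      W q (g₁ , g₂) = ι (+ q) *ᶜ (α *ᶜ α) +ᶜ ι g₁ +ᶜ (ι b *ᶜ ι g₁ +ᶜ ι g₂) *ᶜ α

      module _ where
        open Approximation β

        private
          β⁻¹≈γ : β ℝ.⁻¹ ℝ.≈ γ
          β⁻¹≈γ = inverse-unique (ℝ.*-inverseʳ (0<⇒≉0 0<β)) βγ≈1

          β²≈ββ : β ℝ.^ 2 ℝ.≈ β ℝ.* β
          β²≈ββ = ℝ.*-congˡ (ℝ.*-identityʳ β)

          β⁻²≈γγ : (β ℝ.^ 2) ℝ.⁻¹ ℝ.≈ γ ℝ.* γ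
          β⁻²≈γγ = inverse-unique (ℝ.*-inverseʳ (0<⇒≉0 (<-respʳ (ℝ.sym β²≈ββ) (ℝ.*-pos 0<β 0<β))))
            (ℝ.trans (ℝ.*-congʳ β²≈ββ) (ℝ.trans
              (R.solve 2 (λ β γ → (β R.:* β) R.:* (γ R.:* γ) R.:= (β R.:* γ) R.:* (β R.:* γ)) ≡.refl β γ)
              (ℝ.trans (ℝ.*-cong βγ≈1 βγ≈1) (ℝ.*-identityˡ ℝ.1#))))

          ofReal-coordinate : ∀ q g {t u} → t ℝ.≈ u →
            ofReal (q ℝ.· t ℝ.- ℝ.fromℤ g) ≋ ι (+ q) *ᶜ ofReal u -ᶜ ι g
          ofReal-coordinate q g {t} {u} t≈u = C.trans (ofReal-− _ _) (C.+-cong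
            (C.trans (ofReal-cong q·t) (C.trans (ofReal-* _ u) (C.*-congʳ (ofReal-n·1 q))))
            (C.-‿cong (ofReal-fromℤ g)))
            where
            open SemiringMult ℝ.semiring using (×-assoc-*; ×-congʳ)
            q·t : q ℝ.· t ℝ.≈ (q ℝ.· ℝ.1#) ℝ.* u
            q·t = ℝ.trans (×-congʳ q (ℝ.trans t≈u (ℝ.sym (ℝ.*-identityˡ u)))) (ℝ.sym (×-assoc-* q ℝ.1# u))

          -- The form 𝒩 is written with α, the identity `scaling` with ᾱ. As all other entries are
          -- real, the two values are conjugate.
          conjugate-form : ∀ u x₁ v →
            normSq ((α +ᶜ ofReal u) *ᶜ ofReal x₁ +ᶜ ofReal v) ℝ.≈ normSq ((ᾱ +ᶜ ofReal u) *ᶜ ofReal x₁ +ᶜ ofReal v)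
          conjugate-form u x₁ v = R.solve 5 (λ x y u x₁ v → let 0′ = R.con (+ 0) in
            ((x R.:+ u) R.:* x₁ R.:- (y R.:+ 0′) R.:* 0′ R.:+ v) R.:* ((x R.:+ u) R.:* x₁ R.:- (y R.:+ 0′) R.:* 0′ R.:+ v) R.:+
            ((x R.:+ u) R.:* 0′ R.:+ (y R.:+ 0′) R.:* x₁ R.:+ 0′) R.:* ((x R.:+ u) R.:* 0′ R.:+ (y R.:+ 0′) R.:* x₁ R.:+ 0′) R.:=
            ((x R.:+ u) R.:* x₁ R.:- ((R.:- y) R.:+ 0′) R.:* 0′ R.:+ v) R.:* ((x R.:+ u) R.:* x₁ R.:- ((R.:- y) R.:+ 0′) R.:* 0′ R.:+ v) R.:+
            ((x R.:+ u) R.:* 0′ R.:+ ((R.:- y) R.:+ 0′) R.:* x₁ R.:+ 0′) R.:* ((x R.:+ u) R.:* 0′ R.:+ ((R.:- y) R.:+ 0′) R.:* x₁ R.:+ 0′))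
            ≡.refl x y u x₁ v

        -- The factor -βα has squared modulus β²γ = β.
        normSq-W : ∀ q g → normSq (W q g) ℝ.≈ β ℝ.* (𝒩 α (q ·² θ -² fromℤ² g) ℝ.* 𝒩 α (q ·² θ -² fromℤ² g))
        normSq-W q g@(g₁ , g₂) = begin
          normSq (W q g)
            ≈⟨ normSq-cong (C.+-congˡ (C.*-congʳ (C.+-congʳ (C.*-congʳ (C.sym (ofReal-fromℤ b)))))) ⟩
          normSq (ι (+ q) *ᶜ (α *ᶜ α) +ᶜ ι g₁ +ᶜ (ofReal b′ *ᶜ ι g₁ +ᶜ ι g₂) *ᶜ α)
            ≈⟨ normSq-cong (scaling (ι (+ q)) (ι g₁) (ι g₂)) ⟨
          normSq (-ᶜ (ofReal β *ᶜ α *ᶜ Z̄′))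
            ≈⟨ R.solve 2 (λ x y → (R.:- x) R.:* (R.:- x) R.:+ (R.:- y) R.:* (R.:- y) R.:= x R.:* x R.:+ y R.:* y) ≡.refl _ _ ⟩
          normSq (ofReal β *ᶜ α *ᶜ Z̄′)
            ≈⟨ ℝ.trans (normSq-* (ofReal β *ᶜ α) Z̄′) (ℝ.*-congʳ (normSq-* (ofReal β) α)) ⟩
          normSq (ofReal β) ℝ.* normSq α ℝ.* normSq Z̄′
            ≈⟨ ℝ.*-cong (ℝ.*-cong (normSq-ofReal β) normSqα≈γ) (normSq-cong (C.sym Z̄≈Z̄′)) ⟩
          β ℝ.* β ℝ.* γ ℝ.* normSq Z̄
            ≈⟨ ℝ.*-congʳ (ℝ.trans (ℝ.*-assoc β β γ) (ℝ.trans (ℝ.*-congˡ βγ≈1) (ℝ.*-identityʳ β))) ⟩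
          β ℝ.* normSq Z̄
            ≈⟨ ℝ.*-congˡ (conjugate-form (b′ ℝ.* β ℝ.⁻¹) x₁ (x₂ ℝ.* β ℝ.⁻¹)) ⟨
          β ℝ.* normSq ((α +ᶜ ofReal (b′ ℝ.* β ℝ.⁻¹)) *ᶜ ofReal x₁ +ᶜ ofReal (x₂ ℝ.* β ℝ.⁻¹))
            ≈⟨ ℝ.*-congˡ (∣∣-square _) ⟨
          β ℝ.* (𝒩 α (x₁ , x₂) ℝ.* 𝒩 α (x₁ , x₂)) ∎
          where
          open ≈-Reasoning
          x₁ x₂ : ℝ.Carrier
          x₁ = proj₁ (q ·² θ -² fromℤ² g)
          x₂ = proj₂ (q ·² θ -² fromℤ² g)
          Z̄ Z̄′ : ℂ
          Z̄  = (ᾱ +ᶜ ofReal (b′ ℝ.* β ℝ.⁻¹)) *ᶜ ofReal x₁ +ᶜ ofReal (x₂ ℝ.* β ℝ.⁻¹)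
          Z̄′ = (ᾱ +ᶜ ofReal b′ *ᶜ ofReal γ) *ᶜ (ι (+ q) *ᶜ ofReal γ -ᶜ ι g₁) +ᶜ
                (ι (+ q) *ᶜ (ofReal γ *ᶜ ofReal γ) -ᶜ ι g₂) *ᶜ ofReal γ
          Z̄≈Z̄′ : Z̄ ≋ Z̄′
          Z̄≈Z̄′ = C.+-cong
            (C.*-cong (C.+-congˡ (C.trans (ofReal-* b′ _) (C.*-congˡ (ofReal-cong β⁻¹≈γ))))
                      (ofReal-coordinate q g₁ β⁻¹≈γ))
            (C.trans (ofReal-* x₂ _) (C.*-cong
              (C.trans (ofReal-coordinate q g₂ β⁻²≈γγ) (C.+-congʳ (C.*-congˡ (ofReal-* γ γ))))
              (ofReal-cong β⁻¹≈γ)))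

        -- The threshold cγ avoids a square root of β: β(cγ)² = c²γ < c², because βγ = 1 and γ < 1.
        𝒩-small⇒∣W∣-small : ∀ {c} → ℝ.0# ℝ.< c → ∀ q g →
          𝒩 α (q ·² θ -² fromℤ² g) ℝ.< c ℝ.* γ → ∣ W q g ∣ ℝ.< c
        𝒩-small⇒∣W∣-small {c} 0<c q g 𝒩<cγ = square-cancel-< (inj₁ 0<c) (begin-strict
          ∣ W q g ∣ ℝ.* ∣ W q g ∣   ≈⟨ ∣∣-square (W q g) ⟩
          normSq (W q g)           ≈⟨ normSq-W q g ⟩
          β ℝ.* (𝒩α ℝ.* 𝒩α)        <⟨ *-monoˡ-< 0<β (square-mono-< (∣∣-nonNeg _) 𝒩<cγ) ⟩
          β ℝ.* (c ℝ.* γ ℝ.* (c ℝ.* γ))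
            ≈⟨ R.solve 3 (λ β c γ → β R.:* (c R.:* γ R.:* (c R.:* γ)) R.:= c R.:* c R.:* (β R.:* γ) R.:* γ) ≡.refl β c γ ⟩
          c ℝ.* c ℝ.* (β ℝ.* γ) ℝ.* γ
            ≈⟨ ℝ.*-congʳ (ℝ.trans (ℝ.*-congˡ βγ≈1) (ℝ.*-identityʳ _)) ⟩
          c ℝ.* c ℝ.* γ            <⟨ *-monoˡ-< (ℝ.*-pos 0<c 0<c) γ<1 ⟩
          c ℝ.* c ℝ.* ℝ.1#         ≈⟨ ℝ.*-identityʳ _ ⟩
          c ℝ.* c                  ∎)
          where
          open ≤-Reasoning
          𝒩α : ℝ.Carrier
          𝒩α = 𝒩 α (q ·² θ -² fromℤ² g)

  open ComplexProperties

  -- Pigeonhole: a solution outside `xs` would give n+1 distinct solutions, but the given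
  -- enumeration has only n indices for them.
  hasExactly⇒∈ : ∀ {A : Set} {P : ℂ → Set} {n} {xs : Vec A n} (g : A → ℂ) → Injective _≡_ _≋_ g →
    HasExactly n P → Unique xs → All (λ x → P (g x)) xs → ∀ x → P (g x) → x ∈ xs
  hasExactly⇒∈ {A} {P} {n} {xs} g g-injective (f , _ , _ , f-onto) unique all-P x Pgx with em {P = x ∈ xs}
  ... | yes x∈xs = x∈xs
  ... | no x∉xs  = ⊥-elim (let i , j , i<j , p = pigeonhole ℕₚ.≤-refl index in no-collision i j i<j p)
    where
    unique′ : Unique (x ∷ xs)
    unique′ = lookup⁻ (λ i eq → x∉xs (≡.subst (_∈ xs) (≡.sym eq) (∈-lookup i xs))) ∷ unique

    listed : ∀ i → ∃ λ j → g (lookup (x ∷ xs) i) ≈ᶜ f j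
    listed i = f-onto _ (lookup⁺ {P = λ x → P (g x)} (Pgx ∷ all-P) i)

    index : Fin (suc n) → Fin n
    index i = proj₁ (listed i)

    no-collision : ∀ i j → i Fin.< j → ¬ (index i ≡ index j)
    no-collision i j i<j p = <⇒≢ i<j (lookup-injective unique′ i j (g-injective
      (C.trans (≈ᶜ⇒≋ (proj₂ (listed i))) (C.trans (C.reflexive (≡.cong f p)) (C.sym (≈ᶜ⇒≋ (proj₂ (listed j))))))))

  module _ (s B : ℕ) where
    open ℝ using () renaming (0# to 0ʳ; 1# to 1ʳ; _<_ to _<ʳ_; _≤_ to _≤ʳ_; _≈_ to _≈ʳ_; _^_ to _^ʳ_)
    open RealProperties
    open GeometricDecay
    open ℂ-Integers
    open Words s B
    open SixVectors B
    open Cubic ℝ a b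
    open I using (solve; _:=_; _:+_; _:*_; _:-_; :-_; con)

    -- Points of the Rauzy fractal

    module AtRoot (α : ℂ) (α-root : α *ᶜ (α *ᶜ α -ᶜ ι a *ᶜ α -ᶜ ι b) ≋ 1ᶜ)
             (0<∣α∣ : 0ʳ <ʳ ∣ α ∣) (∣α∣<1 : ∣ α ∣ <ʳ 1ʳ) (imα≉0 : ¬ (im α ≈ʳ 0ʳ)) where
      open RauzyFractal α

      -- The partial sums Σ_{i<n} e_i α^{i+2}, in Horner form.
      S : Digits → ℕ → ℂ
      S e zero    = 0ᶜ
      S e (suc n) = ι (+ e 0) *ᶜ (α *ᶜ α) +ᶜ α *ᶜ S (tail e) n

      Converges : Digits → ℂ → Set
      Converges e z = ∀ ε → 0ʳ <ʳ ε → ∃ λ N → ∀ n → N ℕ.≤ n → ∣ S e n -ᶜ z ∣ <ʳ ε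

      S-agree : ∀ k {e w} → Agree k e w → S e k ≡ S w k
      S-agree zero    agree = ≡.refl
      S-agree (suc k) agree = ≡.cong₂ (λ d z → ι (+ d) *ᶜ (α *ᶜ α) +ᶜ α *ᶜ z)
        (agree 0 ℕ.z<s) (S-agree k λ j j<k → agree (suc j) (ℕ.s<s j<k))

      ·ᶜ≋ι* : ∀ n z → n ·ᶜ z ≋ ι (+ n) *ᶜ z
      ·ᶜ≋ι* zero    z = C.sym (C.zeroˡ z)
      ·ᶜ≋ι* (suc n) z = C.trans (C.+-cong (C.sym (C.*-identityˡ z)) (·ᶜ≋ι* n z)) (C.sym (C.distribʳ z 1ᶜ (ι (+ n))))

      -- The factor `c` collects the powers of α as the induction passes to tails.
      sumᶜ≋S : ∀ n e c (t : ℕ → ℂ) → t 0 ≋ c *ᶜ (α *ᶜ α) → (∀ i → t (suc i) ≋ α *ᶜ t i) →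
        sumᶜ {n} (λ i → e (toℕ i) ·ᶜ t (toℕ i)) ≋ c *ᶜ S e n
      sumᶜ≋S zero    e c t t₀ t₊ = C.sym (C.zeroʳ c)
      sumᶜ≋S (suc n) e c t t₀ t₊ = C.trans
        (C.+-cong (C.trans (·ᶜ≋ι* (e 0) (t 0)) (C.*-congˡ t₀))
          (sumᶜ≋S n (tail e) (c *ᶜ α) (λ i → t (suc i))
            (C.trans (t₊ 0) (C.trans (C.*-congˡ t₀)
              (solve 2 (λ c α → α :* (c :* (α :* α)) := c :* α :* (α :* α)) ≡.refl c α)))
            (λ i → t₊ (suc i))))
        (solve 4 (λ c α d s → d :* (c :* (α :* α)) :+ c :* α :* s := c :* (d :* (α :* α) :+ α :* s))
          ≡.refl c α (ι (+ e 0)) (S (tail e) n))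

      hasSum-partial : ∀ n (d : Digits) → sumᶜ {n} (λ i → d (2 ℕ.+ toℕ i) ·ᶜ (α ^ᶜ (2 ℕ.+ toℕ i))) ≋ S (λ i → d (2 ℕ.+ i)) n
      hasSum-partial n d = C.trans
        (sumᶜ≋S n (λ i → d (2 ℕ.+ i)) 1ᶜ (λ i → α ^ᶜ (2 ℕ.+ i))
          (C.trans (C.*-congˡ (C.*-identityʳ α)) (C.sym (C.*-identityˡ _))) (λ i → C.refl))
        (C.*-identityˡ _)

      rauzy : ∀ {e z} → Adm e → Converges e z → Rauzy z
      rauzy {e} {z} adm-e conv = (λ i → e (i ∸ 2)) , adm-shift adm-e , λ ε 0<ε → let N , h = conv ε 0<ε in
        N , λ n N≤n → <-respˡ (∣∣-cong (C.+-congʳ (C.sym (hasSum-partial n (λ i → e (i ∸ 2)))))) (h n N≤n)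

      rauzy⁻¹ : ∀ {z} → Rauzy z → ∃ λ e → Adm e × Converges e z
      rauzy⁻¹ {z} (d , adm-d , hasSum) = (λ i → d (2 ℕ.+ i)) , adm-drop 2 adm-d , λ ε 0<ε → let N , h = hasSum ε 0<ε in
        N , λ n N≤n → <-respˡ (∣∣-cong (C.+-congʳ (hasSum-partial n d))) (h n N≤n)

      converges-cong : ∀ {e z w} → z ≋ w → Converges e z → Converges e w
      converges-cong z≈w conv ε 0<ε = let N , h = conv ε 0<ε in
        N , λ n N≤n → <-respˡ (∣∣-cong (C.+-congˡ (C.-‿cong z≈w))) (h n N≤n)

      rauzy-cong : ∀ {z w} → z ≋ w → Rauzy z → Rauzy w
      rauzy-cong z≈w z∈R = let e , adm-e , conv = rauzy⁻¹ z∈R in rauzy adm-e (converges-cong z≈w conv)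

      ∣S-z∣-suc : ∀ e n z →
        ∣ S e (suc n) -ᶜ (ι (+ e 0) *ᶜ (α *ᶜ α) +ᶜ α *ᶜ z) ∣ ≈ʳ ∣ α ∣ ℝ.* ∣ S (tail e) n -ᶜ z ∣
      ∣S-z∣-suc e n z = ℝ.trans (∣∣-cong (solve 4 (λ c α s z →
        (c :+ α :* s) :- (c :+ α :* z) := α :* (s :- z)) ≡.refl (ι (+ e 0) *ᶜ (α *ᶜ α)) α (S (tail e) n) z))
        (∣∣-* α (S (tail e) n -ᶜ z))

      converges-▸ : ∀ {e z} c → Converges e z → Converges (c ▸ e) (ι (+ c) *ᶜ (α *ᶜ α) +ᶜ α *ᶜ z)
      converges-▸ {e} {z} c conv ε 0<ε = let N , h = conv ε 0<ε in suc N , λ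
        { (suc n) (ℕ.s≤s N≤n) → <-respˡ (ℝ.sym (∣S-z∣-suc (c ▸ e) n z)) (≤-<-trans
            (≤-respʳ (ℝ.*-identityˡ _) (*-mono-≤ (∣∣-nonNeg α) (inj₁ ∣α∣<1) (∣∣-nonNeg (S e n -ᶜ z)) ≤-refl))
            (h n N≤n)) }

      -- The error of the tail is that of the word divided by |α| > 0.
      converges-tail : ∀ {e z w} → z ≋ ι (+ e 0) *ᶜ (α *ᶜ α) +ᶜ α *ᶜ w → Converges e z → Converges (tail e) w
      converges-tail {e} {z} z≈ conv ε 0<ε = let N , h = conv (∣ α ∣ ℝ.* ε) (ℝ.*-pos 0<∣α∣ 0<ε) in
        N , λ n N≤n → ≰⇒> λ ε≤ → <⇒≱ (h (suc n) (ℕₚ.m≤n⇒m≤1+n N≤n))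
          (≤-respʳ (ℝ.sym (ℝ.trans (∣∣-cong (C.+-congˡ (C.-‿cong z≈))) (∣S-z∣-suc e n _)))
            (*-monoˡ-≤ (∣∣-nonNeg α) ε≤))

      -- The value of a constant word is the fixed point of the contraction z ↦ cα² + αz. It can
      -- thus be guessed and checked, without summing the series.
      ∣S-repeat∣ : ∀ {c z} → z ≋ ι (+ c) *ᶜ (α *ᶜ α) +ᶜ α *ᶜ z → ∀ n → ∣ S (repeat c) n -ᶜ z ∣ ≈ʳ ∣ α ∣ ^ʳ n ℝ.* ∣ z ∣
      ∣S-repeat∣ {c} {z} z≈ zero = ℝ.trans (∣∣-cong (C.+-identityˡ (-ᶜ z)))
        (ℝ.trans (∣∣-neg z) (ℝ.sym (ℝ.*-identityˡ ∣ z ∣)))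
      ∣S-repeat∣ {c} {z} z≈ (suc n) = ℝ.trans (∣∣-cong (C.+-congˡ (C.-‿cong z≈)))
        (ℝ.trans (∣S-z∣-suc (repeat c) n z) (ℝ.trans (ℝ.*-congˡ (∣S-repeat∣ z≈ n)) (ℝ.sym (ℝ.*-assoc _ _ _))))

      ^-small-* : ∀ {M} → 0ʳ ≤ʳ M → ∀ ε → 0ʳ <ʳ ε → ∃ λ N → ∀ n → N ℕ.≤ n → ∣ α ∣ ^ʳ n ℝ.* M <ʳ ε
      ^-small-* {M} 0≤M ε 0<ε = let N , h = ^-small 0<∣α∣ ∣α∣<1 ε′ 0<ε′ in N , λ n N≤n → begin-strict
          ∣ α ∣ ^ʳ n ℝ.* M               ≤⟨ *-monoˡ-≤ (^-nonNeg 0<∣α∣ ∣α∣<1 n) M≤M+1 ⟩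
          ∣ α ∣ ^ʳ n ℝ.* (M ℝ.+ 1ʳ)      ≈⟨ ℝ.*-comm _ _ ⟩
          (M ℝ.+ 1ʳ) ℝ.* ∣ α ∣ ^ʳ n      <⟨ *-monoˡ-< 0<M+1 (h n N≤n) ⟩
          (M ℝ.+ 1ʳ) ℝ.* ε′              ≈⟨ R.solve 3 (λ m i ε → m R.:* (ε R.:* i) R.:= ε R.:* (m R.:* i)) ≡.refl (M ℝ.+ 1ʳ) _ ε ⟩
          ε ℝ.* ((M ℝ.+ 1ʳ) ℝ.* (M ℝ.+ 1ʳ) ℝ.⁻¹)  ≈⟨ ℝ.trans (ℝ.*-congˡ inverse) (ℝ.*-identityʳ ε) ⟩
          ε                              ∎
        where
        open ≤-Reasoning
        M≤M+1 : M ≤ʳ M ℝ.+ 1ʳ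
        M≤M+1 = ≤-respˡ (ℝ.+-identityʳ M) (+-mono-≤ ≤-refl (inj₁ ℝ.0<1))
        0<M+1 : 0ʳ <ʳ M ℝ.+ 1ʳ
        0<M+1 = 0<x+y 0≤M ℝ.0<1
        inverse : (M ℝ.+ 1ʳ) ℝ.* (M ℝ.+ 1ʳ) ℝ.⁻¹ ≈ʳ 1ʳ
        inverse = ℝ.*-inverseʳ (0<⇒≉0 0<M+1)
        -- Since M may be 0, the division is by M + 1.
        ε′ : ℝ.Carrier
        ε′ = ε ℝ.* (M ℝ.+ 1ʳ) ℝ.⁻¹
        0<ε′ : 0ʳ <ʳ ε′
        0<ε′ = ℝ.*-pos 0<ε (inverse-pos 0<M+1 inverse)

      converges-repeat : ∀ {c z} → z ≋ ι (+ c) *ᶜ (α *ᶜ α) +ᶜ α *ᶜ z → Converges (repeat c) z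
      converges-repeat {z = z} z≈ ε 0<ε = let N , h = ^-small-* (∣∣-nonNeg z) ε 0<ε in
        N , λ n N≤n → <-respˡ (ℝ.sym (∣S-repeat∣ z≈ n)) (h n N≤n)

      converges-zeros : Converges (repeat 0) 0ᶜ
      converges-zeros = converges-repeat (solve 1 (λ α → con (+ 0) := con (+ 0) :* (α :* α) :+ α :* con (+ 0)) ≡.refl α)

      -- The lattice ℤ + ℤα and its discreteness

      lat : ℤ → ℤ → ℂ
      lat m n = ι m +ᶜ ι n *ᶜ α

      lat-+ : ∀ m n m′ n′ → lat (m ℤ.+ m′) (n ℤ.+ n′) ≋ lat m n +ᶜ lat m′ n′
      lat-+ m n m′ n′ = C.trans (C.+-cong (I.+-homo m m′) (C.*-congʳ (I.+-homo n n′)))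
        (solve 5 (λ m n m′ n′ α → (m :+ m′) :+ (n :+ n′) :* α := (m :+ n :* α) :+ (m′ :+ n′ :* α)) ≡.refl (ι m) (ι n) (ι m′) (ι n′) α)

      lat-neg : ∀ m n → lat (ℤ.- m) (ℤ.- n) ≋ -ᶜ lat m n
      lat-neg m n = C.trans (C.+-cong (I.neg-homo m) (C.*-congʳ (I.neg-homo n)))
        (solve 3 (λ m n α → :- m :+ (:- n) :* α := :- (m :+ n :* α)) ≡.refl (ι m) (ι n) α)

      lat-− : ∀ m n m′ n′ → lat (m ℤ.- m′) (n ℤ.- n′) ≋ lat m n -ᶜ lat m′ n′
      lat-− m n m′ n′ = C.trans (lat-+ m n (ℤ.- m′) (ℤ.- n′)) (C.+-congˡ (lat-neg m′ n′))

      lattice-gap : ℝ.Carrier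
      lattice-gap = ∣ ofReal (im α) ∣

      private
        gap² : lattice-gap ℝ.* lattice-gap ≈ʳ im α ℝ.* im α
        gap² = ℝ.trans (∣∣-square _) (normSq-ofReal (im α))

      0<gap : 0ʳ <ʳ lattice-gap
      0<gap = square-cancel-< (∣∣-nonNeg _) (<-respˡ (ℝ.sym (ℝ.zeroˡ 0ʳ)) (<-respʳ (ℝ.sym gap²) (0<x*x imα≉0)))

      -- For n ≠ 0 the imaginary part n·im α is already large enough. For n = 0 the modulus is |m| ≥
      -- 1, and |im α| ≤ |α| < 1.
      gap≤∣lat∣ : ∀ m n → ¬ (m ≡ + 0 × n ≡ + 0) → lattice-gap ≤ʳ ∣ lat m n ∣
      gap≤∣lat∣ m n nonzero = square-cancel-≤ (∣∣-nonNeg _)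
        (≤-respˡ (ℝ.sym gap²) (≤-respʳ (ℝ.sym (∣∣-square (lat m n))) (by-cases (n ℤₚ.≟ + 0))))
        where
        x : ℝ.Carrier
        x = im α ℝ.* im α
        lat-components : lat m n ≋ (R.⟦ m ⟧ℤ ℝ.+ R.⟦ n ⟧ℤ ℝ.* re α) +i (R.⟦ n ⟧ℤ ℝ.* im α)
        lat-components = C.trans (C.+-cong (C.sym (ι′ m)) (C.*-congʳ (C.sym (ι′ n))))
          ( R.solve 4 (λ m n x y → m R.:+ (n R.:* x R.:- R.con (+ 0) R.:* y) R.:= m R.:+ n R.:* x) ≡.refl R.⟦ m ⟧ℤ R.⟦ n ⟧ℤ (re α) (im α)
          & R.solve 3 (λ n x y → R.con (+ 0) R.:+ (n R.:* y R.:+ R.con (+ 0) R.:* x) R.:= n R.:* y) ≡.refl R.⟦ n ⟧ℤ (re α) (im α))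
          where
          ι′ : ∀ i → ofReal R.⟦ i ⟧ℤ ≋ ι i
          ι′ i = ≡.subst (λ x → ofReal x ≋ ι i) (fromℤ≡⟦⟧ i) (ofReal-fromℤ i)
        x≤1 : x ≤ʳ 1ʳ
        x≤1 = ≤-trans (∣im∣²≤∣z∣² α) (≤-respˡ (∣∣-square α) (≤-respʳ (ℝ.*-identityˡ 1ʳ)
          (*-mono-≤ (∣∣-nonNeg α) (inj₁ ∣α∣<1) (∣∣-nonNeg α) (inj₁ ∣α∣<1))))
        by-cases : Dec (n ≡ + 0) → x ≤ʳ normSq (lat m n)
        by-cases (no n≢0) = ≤-respʳ (ℝ.sym (normSq-cong lat-components)) (≤-trans
          (≤-respˡ (ℝ.*-identityʳ x) (≤-respʳ
            (R.solve 2 (λ n y → y R.:* y R.:* (n R.:* n) R.:= (n R.:* y) R.:* (n R.:* y)) ≡.refl R.⟦ n ⟧ℤ (im α))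
            (*-monoˡ-≤ (0≤x*x (im α)) (1≤⟦i⟧² n≢0))))
          (∣im∣²≤∣z∣² _))
        by-cases (yes n≡0) = ≤-respʳ (ℝ.sym (normSq-cong lat-components)) (≤-trans (≤-trans x≤1 (1≤⟦i⟧² λ m≡0 → nonzero (m≡0 , n≡0)))
          (≤-respˡ (ℝ.*-cong drop drop) (∣re∣²≤∣z∣² _)))
          where
          drop : R.⟦ m ⟧ℤ ℝ.+ R.⟦ n ⟧ℤ ℝ.* re α ≈ʳ R.⟦ m ⟧ℤ
          drop = ℝ.trans (ℝ.+-congˡ (ℝ.trans (ℝ.*-congʳ (ℝ.reflexive (≡.cong R.⟦_⟧ℤ n≡0))) (ℝ.zeroˡ _))) (ℝ.+-identityʳ _)

      ∣lat∣<gap⇒≡0 : ∀ m n → ∣ lat m n ∣ <ʳ lattice-gap → m ≡ + 0 × n ≡ + 0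
      ∣lat∣<gap⇒≡0 m n small with m ℤₚ.≟ + 0 | n ℤₚ.≟ + 0
      ... | yes p | yes q = p , q
      ... | no p  | _     = ⊥-elim (<⇒≱ small (gap≤∣lat∣ m n λ (m≡0 , _) → p m≡0))
      ... | yes _ | no q  = ⊥-elim (<⇒≱ small (gap≤∣lat∣ m n λ (_ , n≡0) → q n≡0))

      lat-injective : ∀ {m n m′ n′} → lat m n ≋ lat m′ n′ → m ≡ m′ × n ≡ n′
      lat-injective {m} {n} {m′} {n′} p = let m-m′≡0 , n-n′≡0 = ∣lat∣<gap⇒≡0 (m ℤ.- m′) (n ℤ.- n′)
                                                (<-respˡ (ℝ.sym ∣lat∣≈0) 0<gap) in
        ℤₚ.i-j≡0⇒i≡j m m′ m-m′≡0 , ℤₚ.i-j≡0⇒i≡j n n′ n-n′≡0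
        where
        ∣lat∣≈0 : ∣ lat (m ℤ.- m′) (n ℤ.- n′) ∣ ≈ʳ 0ʳ
        ∣lat∣≈0 = ∣∣-unique _ ≤-refl (ℝ.trans
          (normSq-cong (C.trans (lat-− m n m′ n′) (C.trans (C.+-congʳ p) (C.-‿inverseʳ _)))) (normSq-ofReal 0ʳ))

      -- Compactness

      adm⇒≤top : ∀ {e} → Adm e → ∀ j → e j ℕ.≤ top
      adm⇒≤top (digits , _) j = ℤₚ.drop‿+≤+ (digits j tt)

      private
        -- `D` bounds one term dα², and `M` is the sum of the geometric series D + rD + r²D + ⋯,
        -- used through M = D + rM.
        r D i M : ℝ.Carrier
        r = ∣ α ∣
        D = (top ℝ.· 1ʳ) ℝ.* ∣ α *ᶜ α ∣
        i = (1ʳ ℝ.- r) ℝ.⁻¹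
        M = D ℝ.* i

        0≤D : 0ʳ ≤ʳ D
        0≤D = *-nonNeg (0≤n·1 top) (∣∣-nonNeg _)

        0<1-r : 0ʳ <ʳ 1ʳ ℝ.- r
        0<1-r = x<y⇒0<y-x ∣α∣<1

        [1-r]i≈1 : (1ʳ ℝ.- r) ℝ.* i ≈ʳ 1ʳ
        [1-r]i≈1 = ℝ.*-inverseʳ (0<⇒≉0 0<1-r)

        0≤M : 0ʳ ≤ʳ M
        0≤M = *-nonNeg 0≤D (inj₁ (inverse-pos 0<1-r [1-r]i≈1))

        D+rM≈M : D ℝ.+ r ℝ.* M ≈ʳ M
        D+rM≈M = begin
          D ℝ.+ r ℝ.* M                          ≈⟨ ℝ.+-congʳ (ℝ.trans (ℝ.sym (ℝ.*-identityʳ D)) (ℝ.*-congˡ (ℝ.sym [1-r]i≈1))) ⟩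
          D ℝ.* ((1ʳ ℝ.- r) ℝ.* i) ℝ.+ r ℝ.* M   ≈⟨ R.solve 4 (λ d r i o → d R.:* ((o R.:- r) R.:* i) R.:+ r R.:* (d R.:* i) R.:= o R.:* (d R.:* i)) ≡.refl D r i 1ʳ ⟩
          1ʳ ℝ.* M                               ≈⟨ ℝ.*-identityˡ M ⟩
          M                                      ∎
          where open ≈-Reasoning

      ∣ι+∣ : ∀ n → ∣ ι (+ n) ∣ ≈ʳ n ℝ.· 1ʳ
      ∣ι+∣ n = ∣∣-unique _ (0≤n·1 n) (ℝ.trans (normSq-cong (C.sym (ofReal-n·1 n))) (normSq-ofReal _))

      S-bounded : ∀ {e} → (∀ j → e j ℕ.≤ top) → ∀ n → ∣ S e n ∣ ≤ʳ M
      S-bounded e≤ zero = ≤-respˡ (ℝ.sym (∣∣-unique _ ≤-refl (normSq-ofReal 0ʳ))) 0≤M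
      S-bounded {e} e≤ (suc n) = ≤-respʳ D+rM≈M (≤-trans (∣∣-triangle _ _) (+-mono-≤
        (≤-respˡ (ℝ.sym (ℝ.trans (∣∣-* (ι (+ e 0)) (α *ᶜ α)) (ℝ.*-congʳ (∣ι+∣ (e 0)))))
          (*-mono-≤ (0≤n·1 (e 0)) (n·1-mono-≤ (e≤ 0)) (∣∣-nonNeg _) ≤-refl))
        (≤-respˡ (ℝ.sym (∣∣-* α _)) (*-monoˡ-≤ (∣∣-nonNeg α) (S-bounded (λ j → e≤ (suc j)) n)))))

      S-cauchy : ∀ {e} → (∀ j → e j ℕ.≤ top) → ∀ k n → ∣ S e (k ℕ.+ n) -ᶜ S e k ∣ ≤ʳ r ^ʳ k ℝ.* M
      S-cauchy {e} e≤ zero n = ≤-respˡ (∣∣-cong (solve 1 (λ z → z := z :- con (+ 0)) ≡.refl (S e n)))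
        (≤-respʳ (ℝ.sym (ℝ.*-identityˡ M)) (S-bounded e≤ n))
      S-cauchy {e} e≤ (suc k) n = ≤-respˡ (ℝ.sym (∣S-z∣-suc e (k ℕ.+ n) (S (tail e) k)))
        (≤-respʳ (ℝ.sym (ℝ.*-assoc r (r ^ʳ k) M)) (*-monoˡ-≤ (∣∣-nonNeg α) (S-cauchy (λ j → e≤ (suc j)) k n)))

      -- Closeness of the value of a word to a lattice point, phrased by partial sums so that no
      -- limit needs to exist.
      Near : ℝ.Carrier → Digits → ℤ → ℤ → Set
      Near ε e m n = ∃ λ N → ∀ k → N ℕ.≤ k → ∣ S e k -ᶜ lat m n ∣ <ʳ ε

      near-mono : ∀ {ε ε′ e m n} → ε ≤ʳ ε′ → Near ε e m n → Near ε′ e m n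
      near-mono ε≤ε′ (N , h) = N , λ k N≤k → <-≤-trans (h k N≤k) ε≤ε′

      ∣z-w∣≈∣w-z∣ : ∀ z w → ∣ z -ᶜ w ∣ ≈ʳ ∣ w -ᶜ z ∣
      ∣z-w∣≈∣w-z∣ z w = ℝ.trans (ℝ.sym (∣∣-neg (z -ᶜ w)))
        (∣∣-cong (solve 2 (λ z w → :- (z :- w) := w :- z) ≡.refl z w))

      ∣∣-triangle₃ : ∀ u v w z → ∣ u -ᶜ z ∣ ≤ʳ ∣ v -ᶜ u ∣ ℝ.+ ∣ v -ᶜ w ∣ ℝ.+ ∣ w -ᶜ z ∣
      ∣∣-triangle₃ u v w z = ≤-respˡ
        (∣∣-cong (solve 4 (λ u v w z → (u :- v) :+ (v :- w) :+ (w :- z) := u :- z) ≡.refl u v w z))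
        (≤-trans (∣∣-triangle _ _) (+-mono-≤
          (≤-trans (∣∣-triangle _ _) (+-mono-≤ (inj₂ (∣z-w∣≈∣w-z∣ u v)) ≤-refl)) ≤-refl))

      module _ (P : ℤ → ℤ → Set) (avoid : ∀ m n → Rauzy (lat m n) → ¬ P m n) where

        Approximable : Digits → ℕ → ℝ.Carrier → Set
        Approximable w k ε = ∃ λ e → ∃ λ m → ∃ λ n → Adm e × P m n × Agree k e w × Near ε e m n

        -- The invariant of the König argument. The word continuing the prefix and the lattice point
        -- in `P` may both depend on the precision.
        Extendable : Digits → ℕ → Set
        Extendable w k = ∀ ε → 0ʳ <ʳ ε → Approximable w k ε

        approximable-mono : ∀ {w k ε ε′} → ε ≤ʳ ε′ → Approximable w k ε → Approximable w k ε′
        approximable-mono ε≤ε′ (e , m , n , adm-e , p , agree , near) =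
          e , m , n , adm-e , p , agree , near-mono {m = m} {n} ε≤ε′ near

        ¬extendable⇒ : ∀ {w k} → ¬ Extendable w k → ∃ λ ε → 0ʳ <ʳ ε × ¬ Approximable w k ε
        ¬extendable⇒ {w} {k} ¬ext with em {P = ∃ λ ε → 0ʳ <ʳ ε × ¬ Approximable w k ε}
        ... | yes p   = p
        ... | no none = ⊥-elim (¬ext λ ε 0<ε → stable ε 0<ε em)
          where
          stable : ∀ ε → 0ʳ <ʳ ε → Dec (Approximable w k ε) → Approximable w k ε
          stable ε 0<ε (yes p) = p
          stable ε 0<ε (no ¬p) = ⊥-elim (none (ε , 0<ε , ¬p))

        uniform : ∀ (Q : ℕ → ℝ.Carrier → Set) → (∀ {d ε ε′} → ε ≤ʳ ε′ → Q d ε → Q d ε′) →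
          (∀ d → ∃ λ ε → 0ʳ <ʳ ε × ¬ Q d ε) → ∀ n → ∃ λ ε → 0ʳ <ʳ ε × (∀ d → d ℕ.≤ n → ¬ Q d ε)
        uniform Q mono h zero = let ε , 0<ε , ¬q = h 0 in ε , 0<ε , λ { _ ℕ.z≤n → ¬q }
        uniform Q mono h (suc n) with uniform Q mono h n | h (suc n)
        ... | ε , 0<ε , ¬q | ε′ , 0<ε′ , ¬q′ = ε″ , 0<ε″ , ¬q″
          where
          smaller : ∃ λ δ → 0ʳ <ʳ δ × δ ≤ʳ ε × δ ≤ʳ ε′
          smaller with em {P = ε ≤ʳ ε′}
          ... | yes ε≤ε′ = ε , 0<ε , ≤-refl , ε≤ε′
          ... | no ε≰ε′  = ε′ , 0<ε′ , inj₁ (≰⇒> ε≰ε′) , ≤-refl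
          ε″ : ℝ.Carrier
          ε″ = proj₁ smaller
          0<ε″ : 0ʳ <ʳ ε″
          0<ε″ = proj₁ (proj₂ smaller)
          ¬q″ : ∀ d → d ℕ.≤ suc n → ¬ Q d ε″
          ¬q″ d d≤1+n q with ℕₚ.m≤n⇒m<n∨m≡n d≤1+n
          ... | inj₁ d<1+n  = ¬q d (ℕₚ.≤-pred d<1+n) (mono (proj₁ (proj₂ (proj₂ smaller))) q)
          ... | inj₂ ≡.refl = ¬q′ (mono (proj₂ (proj₂ (proj₂ smaller))) q)

        -- If no digit worked, each of 0, ..., `top` would fail at some precision, and by `uniform`
        -- all would fail at the smallest of these. But the word found at that precision has some
        -- next digit, which is at most `top`.
        extend : ∀ {w k} → Extendable w k → ∃ λ d → Extendable (update w k d) (suc k)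
        extend {w} {k} ext with em {P = ∃ λ d → Extendable (update w k d) (suc k)}
        ... | yes p   = p
        ... | no none = ⊥-elim (
          let ε , 0<ε , ¬q = uniform (λ d ε → Approximable (update w k d) (suc k) ε) approximable-mono
                               (λ d → ¬extendable⇒ λ ext′ → none (d , ext′)) top
              e , m , n , adm-e , p , agree , near = ext ε 0<ε
          in ¬q (e k) (adm⇒≤top adm-e k) (e , m , n , adm-e , p , agree-update agree , near))

        module _ (ext₀ : Extendable (repeat 0) 0) where

          stage : ∀ k → ∃ λ w → Extendable w k
          stage zero    = repeat 0 , ext₀
          stage (suc k) = let w , ext = stage k ; d , ext′ = extend ext in update w k d , ext′

          -- The diagonal of the stages: digit k is chosen in passing to stage k+1 and never changes
          -- afterwards.
          branch : Digits
          branch k = proj₁ (stage (suc k)) k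

          stage-agree : ∀ k → Agree k (proj₁ (stage k)) branch
          stage-agree (suc k) i i<1+k with ℕₚ.m≤n⇒m<n∨m≡n (ℕₚ.≤-pred i<1+k)
          ... | inj₁ i<k    = ≡.trans (update-≢ _ k _ (ℕₚ.<⇒≢ i<k)) (stage-agree k i i<k)
          ... | inj₂ ≡.refl = ≡.refl

          branch-extendable : ∀ k → Extendable branch k
          branch-extendable k ε 0<ε = let e , m , n , adm-e , p , agree , near = proj₂ (stage k) ε 0<ε in
            e , m , n , adm-e , p , (λ i i<k → ≡.trans (agree i i<k) (stage-agree k i i<k)) , near

          adm-branch : Adm branch
          adm-branch = adm-agree λ k → let e , _ , _ , adm-e , _ , agree , _ = branch-extendable k 1ʳ ℝ.0<1 in
            e , adm-e , agree

          ^-pos : ∀ k → 0ʳ <ʳ r ^ʳ k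
          ^-pos zero    = ℝ.0<1
          ^-pos (suc k) = ℝ.*-pos 0<∣α∣ (^-pos k)

          -- The precision r^k is of the same order as the distance, at most r^k M, between the
          -- prefix of length k and later partial sums of the same word.
          branch-near : ∀ k → ∃ λ m → ∃ λ n → P m n × (∣ S branch k -ᶜ lat m n ∣ ≤ʳ r ^ʳ k ℝ.* (M ℝ.+ 1ʳ))
          branch-near k = let e , m , n , adm-e , p , agree , N , near = branch-extendable k (r ^ʳ k) (^-pos k) in
            m , n , p , ≡.subst (λ z → ∣ z -ᶜ lat m n ∣ ≤ʳ r ^ʳ k ℝ.* (M ℝ.+ 1ʳ)) (S-agree k agree) (begin
              ∣ S e k -ᶜ lat m n ∣
                ≈⟨ ∣∣-cong (solve 3 (λ u v z → (u :- z) := (u :- v) :+ (v :- z)) ≡.refl (S e k) (S e (k ℕ.+ N)) (lat m n)) ⟩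
              ∣ (S e k -ᶜ S e (k ℕ.+ N)) +ᶜ (S e (k ℕ.+ N) -ᶜ lat m n) ∣
                ≤⟨ ∣∣-triangle _ _ ⟩
              ∣ S e k -ᶜ S e (k ℕ.+ N) ∣ ℝ.+ ∣ S e (k ℕ.+ N) -ᶜ lat m n ∣
                ≤⟨ +-mono-≤ (≤-respˡ (∣z-w∣≈∣w-z∣ _ _) (S-cauchy (adm⇒≤top adm-e) k N)) (inj₁ (near (k ℕ.+ N) (ℕₚ.m≤n+m N k))) ⟩
              r ^ʳ k ℝ.* M ℝ.+ r ^ʳ k
                ≈⟨ ℝ.+-congˡ (ℝ.*-identityʳ _) ⟨
              r ^ʳ k ℝ.* M ℝ.+ r ^ʳ k ℝ.* 1ʳ
                ≈⟨ ℝ.distribˡ _ _ _ ⟨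
              r ^ʳ k ℝ.* (M ℝ.+ 1ʳ) ∎)
            where open ≤-Reasoning

          private
            K : ℝ.Carrier
            -- The three errors in comparing the lattice points at stages k and N: from point k to
            -- the k-th partial sum, on to the N-th, and on to point N.
            K = (M ℝ.+ 1ʳ) ℝ.+ M ℝ.+ (M ℝ.+ 1ʳ)

            0≤M+1 : 0ʳ ≤ʳ M ℝ.+ 1ʳ
            0≤M+1 = 0≤x+y 0≤M (inj₁ ℝ.0<1)

            settled : ∃ λ N → ∀ k → N ℕ.≤ k → r ^ʳ k ℝ.* K <ʳ lattice-gap
            settled = ^-small-* (0≤x+y (0≤x+y 0≤M+1 0≤M) 0≤M+1) lattice-gap 0<gap

            N : ℕ
            N = proj₁ settled

            m₀ n₀ : ℤ
            m₀ = proj₁ (branch-near N)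
            n₀ = proj₁ (proj₂ (branch-near N))

          -- The lattice points found at stages k ≥ N and N differ by at most r^N K, which is below
          -- `lattice-gap`; so they coincide.
          branch-settles : ∀ k → N ℕ.≤ k → ∣ S branch k -ᶜ lat m₀ n₀ ∣ ≤ʳ r ^ʳ k ℝ.* (M ℝ.+ 1ʳ)
          branch-settles k N≤k = let m , n , _ , near = branch-near k
                                     m≡ , n≡ = same m n near in
            ≡.subst₂ (λ m n → ∣ S branch k -ᶜ lat m n ∣ ≤ʳ r ^ʳ k ℝ.* (M ℝ.+ 1ʳ)) m≡ n≡ near
            where
            open ≤-Reasoning
            same : ∀ m n → ∣ S branch k -ᶜ lat m n ∣ ≤ʳ r ^ʳ k ℝ.* (M ℝ.+ 1ʳ) → m ≡ m₀ × n ≡ n₀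
            same m n near = let p , q = ∣lat∣<gap⇒≡0 (m ℤ.- m₀) (n ℤ.- n₀) small in
              ℤₚ.i-j≡0⇒i≡j m m₀ p , ℤₚ.i-j≡0⇒i≡j n n₀ q
              where
              small : ∣ lat (m ℤ.- m₀) (n ℤ.- n₀) ∣ <ʳ lattice-gap
              small = begin-strict
                ∣ lat (m ℤ.- m₀) (n ℤ.- n₀) ∣
                  ≈⟨ ∣∣-cong (lat-− m n m₀ n₀) ⟩
                ∣ lat m n -ᶜ lat m₀ n₀ ∣
                  ≤⟨ ∣∣-triangle₃ _ (S branch k) (S branch N) _ ⟩
                ∣ S branch k -ᶜ lat m n ∣ ℝ.+ ∣ S branch k -ᶜ S branch N ∣ ℝ.+ ∣ S branch N -ᶜ lat m₀ n₀ ∣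
                  ≤⟨ +-mono-≤ (+-mono-≤
                       (≤-trans near (*-mono-≤ (inj₁ (^-pos k)) (^-antitone 0<∣α∣ ∣α∣<1 N≤k) 0≤M+1 ≤-refl))
                       (≡.subst (λ j → ∣ S branch j -ᶜ S branch N ∣ ≤ʳ r ^ʳ N ℝ.* M) (ℕₚ.m+[n∸m]≡n N≤k)
                         (S-cauchy (adm⇒≤top adm-branch) N (k ∸ N))))
                       (proj₂ (proj₂ (proj₂ (branch-near N)))) ⟩
                r ^ʳ N ℝ.* (M ℝ.+ 1ʳ) ℝ.+ r ^ʳ N ℝ.* M ℝ.+ r ^ʳ N ℝ.* (M ℝ.+ 1ʳ)
                  ≈⟨ R.solve 3 (λ x u v → x R.:* u R.:+ x R.:* v R.:+ x R.:* u R.:= x R.:* (u R.:+ v R.:+ u)) ≡.refl (r ^ʳ N) (M ℝ.+ 1ʳ) M ⟩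
                r ^ʳ N ℝ.* K
                  <⟨ proj₂ settled N ℕₚ.≤-refl ⟩
                lattice-gap ∎

          branch-converges : Converges branch (lat m₀ n₀)
          branch-converges ε 0<ε = let N′ , small = ^-small-* 0≤M+1 ε 0<ε in
            N ℕ.+ N′ , λ k N+N′≤k → ≤-<-trans (branch-settles k (ℕₚ.m+n≤o⇒m≤o N N+N′≤k)) (small k (ℕₚ.m+n≤o⇒n≤o N N+N′≤k))

          contradiction : ⊥
          contradiction = avoid m₀ n₀ (rauzy adm-branch branch-converges) (proj₁ (proj₂ (proj₂ (branch-near N))))

        separation : ∃ λ c → 0ʳ <ʳ c × (∀ e m n → Adm e → P m n → ¬ Near c e m n)
        separation = let c , 0<c , ¬q = ¬extendable⇒ contradiction in
          -- A prefix of length 0 imposes nothing, so failure at precision c concerns every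
          -- admissible word.
          c , 0<c , λ e m n adm-e p near → ¬q (e , m , n , adm-e , p , (λ _ ()) , near)

      -- Neighbours and lattice points

      private
        x y : ℂ
        x = ι (+ s)
        y = ι (+ B)

        ιa≈ : ι a ≋ ι (+ 3) +ᶜ (x +ᶜ y)
        ιa≈ = C.trans (I.+-homo (+ 3) (+ (s ℕ.+ B))) (C.+-congˡ (I.+-homo (+ s) (+ B)))

        ιtop≈ : ι (+ top) ≋ ι (+ 2) +ᶜ (x +ᶜ y)
        ιtop≈ = C.trans (I.+-homo (+ 2) (+ (s ℕ.+ B))) (C.+-congˡ (I.+-homo (+ s) (+ B)))

        ιb≈ : ι b ≋ -ᶜ (ι (+ 2) +ᶜ y)
        ιb≈ = C.-‿cong (I.+-homo (+ 2) (+ B))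

        -- The cubic at α in terms of s and B. An identity that holds modulo the cubic is proved as
        -- a ring identity with a summand ±ρ, which `+ρ` and `-ρ` then remove.
        ρ : ℂ
        ρ = α *ᶜ (α *ᶜ α) -ᶜ ((ι (+ 3) +ᶜ (x +ᶜ y)) *ᶜ (α *ᶜ α) -ᶜ (ι (+ 2) +ᶜ y) *ᶜ α +ᶜ ι (+ 1))

        ρ≈0 : ρ ≋ 0ᶜ
        ρ≈0 = C.trans
          (solve 3 (λ α x y → α :* (α :* α) :- ((con (+ 3) :+ (x :+ y)) :* (α :* α) :- (con (+ 2) :+ y) :* α :+ con (+ 1)) :=
            α :* (α :* α :- (con (+ 3) :+ (x :+ y)) :* α :- (:- (con (+ 2) :+ y))) :- con (+ 1)) ≡.refl α x y)
          (C.trans (C.+-cong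
            (C.trans (C.*-congˡ (C.+-cong (C.+-congˡ (C.-‿cong (C.*-congʳ (C.sym ιa≈)))) (C.-‿cong (C.sym ιb≈)))) α-root)
            (C.-‿cong (C.+-identityʳ 1ᶜ))) (C.-‿inverseʳ 1ᶜ))

        +ρ : ∀ z → z +ᶜ ρ ≋ z
        +ρ z = C.trans (C.+-congˡ ρ≈0) (C.+-identityʳ z)

        -ρ : ∀ z → z -ᶜ ρ ≋ z
        -ρ z = C.trans (C.+-congˡ (C.trans (C.-‿cong ρ≈0) -0#≈0#)) (C.+-identityʳ z)
          where open RingProperties C.ring using (-0#≈0#)

        -- `κ` is u* - α², the value of the constant word with digit a+b = 1+s.
        u* κ : ℂ
        u* = lat -[1+ 0 ] (+ suc B)
        κ  = ι -[1+ 0 ] +ᶜ (ι (+ 1) +ᶜ y) *ᶜ α -ᶜ α *ᶜ α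

        u*≈ : u* ≋ ι -[1+ 0 ] +ᶜ (ι (+ 1) +ᶜ y) *ᶜ α
        u*≈ = C.+-congˡ (C.*-congʳ (I.+-homo (+ 1) (+ B)))

        κ-fixed : κ ≋ ι (+ suc s) *ᶜ (α *ᶜ α) +ᶜ α *ᶜ κ
        κ-fixed = C.trans
          (solve 3 (λ α x y → let κ = con -[1+ 0 ] :+ (con (+ 1) :+ y) :* α :- α :* α in
            κ := ((con (+ 1) :+ x) :* (α :* α) :+ α :* κ) :+
              (α :* (α :* α) :- ((con (+ 3) :+ (x :+ y)) :* (α :* α) :- (con (+ 2) :+ y) :* α :+ con (+ 1)))) ≡.refl α x y)
          (C.trans (+ρ _) (C.+-congʳ (C.*-congʳ (C.sym (I.+-homo (+ 1) (+ s))))))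

        converges-u* : Converges u*-digits u*
        converges-u* = converges-cong
          (C.trans (C.+-congʳ (C.*-congʳ (I.+-homo (+ 2) (+ s)))) (C.trans
            (solve 3 (λ α x y → let v = con -[1+ 0 ] :+ (con (+ 1) :+ y) :* α in
              (con (+ 2) :+ x) :* (α :* α) :+ α :* (v :- α :* α) := v :-
              (α :* (α :* α) :- ((con (+ 3) :+ (x :+ y)) :* (α :* α) :- (con (+ 2) :+ y) :* α :+ con (+ 1)))) ≡.refl α x y)
            (C.trans (-ρ _) (C.sym u*≈))))
          (converges-▸ (2 ℕ.+ s) (converges-repeat κ-fixed))

        rauzy-u* : Rauzy u*
        rauzy-u* = rauzy (adm-u* 0) converges-u*

        rauzy-αu* : Rauzy (α *ᶜ u*)
        rauzy-αu* = rauzy (adm-u* 1) (converges-cong (shift-value u*) (converges-▸ 0 converges-u*))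
          where
          shift-value : ∀ z → 0ᶜ *ᶜ (α *ᶜ α) +ᶜ α *ᶜ z ≋ α *ᶜ z
          shift-value z = solve 2 (λ α z → con (+ 0) :* (α :* α) :+ α :* z := α :* z) ≡.refl α z

        rauzy-ααu* : Rauzy (α *ᶜ (α *ᶜ u*))
        rauzy-ααu* = rauzy (adm-u* 2) (converges-cong
          (solve 2 (λ α z → con (+ 0) :* (α :* α) :+ α :* (con (+ 0) :* (α :* α) :+ α :* z) := α :* (α :* z)) ≡.refl α u*)
          (converges-▸ 0 (converges-▸ 0 converges-u*)))

        rauzy-0 : Rauzy (lat (+ 0) (+ 0))
        rauzy-0 = rauzy adm-zeros (converges-cong (solve 1 (λ α → con (+ 0) := con (+ 0) :+ con (+ 0) :* α) ≡.refl α) converges-zeros)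

      neighbour : ∀ {z w} m n → Rauzy z → Rauzy w → z -ᶜ w ≋ lat m n → ¬ ((m , n) ≡ (+ 0 , + 0)) → Neighbour (lat m n)
      neighbour {z} {w} m n z∈R w∈R z-w≈ nonzero =
        (m , n , ≋⇒≈ᶜ (C.+-cong (C.sym (ofReal-fromℤ m)) (C.*-congʳ (C.sym (ofReal-fromℤ n))))) ,
        (λ lat≈0 → nonzero (let p , q = lat-injective (C.trans (≈ᶜ⇒≋ lat≈0) 0≈lat) in ≡.cong₂ _,_ p q)) ,
        z , z∈R , rauzy-cong (C.trans (solve 2 (λ z w → w := z :- (z :- w)) ≡.refl z w) (C.+-congˡ (C.-‿cong z-w≈))) w∈R
        where
        0≈lat : 0ᶜ ≋ lat (+ 0) (+ 0)
        0≈lat = solve 1 (λ α → con (+ 0) := con (+ 0) :+ con (+ 0) :* α) ≡.refl α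

      difference-neighbour : ∀ m n m′ n′ → Rauzy (lat m n) → Rauzy (lat m′ n′) →
        ¬ ((m ℤ.- m′ , n ℤ.- n′) ≡ (+ 0 , + 0)) → Neighbour (lat (m ℤ.- m′) (n ℤ.- n′))
      difference-neighbour m n m′ n′ p q = neighbour _ _ p q (C.sym (lat-− m n m′ n′))

      private
        -- Points that show α and u*+α to be differences of points of R: (B+1)α² = α + αu*, and
        -- (a-1)α² + Bα³ = (u*+α) + α²u*, the latter from u*+α = aα² - α³. Multiplying u* by α
        -- prepends a digit 0.
        z₁ z₃ : ℂ
        z₁ = ι (+ suc B) *ᶜ (α *ᶜ α) +ᶜ α *ᶜ 0ᶜ
        z₃ = ι (+ top) *ᶜ (α *ᶜ α) +ᶜ α *ᶜ (y *ᶜ (α *ᶜ α) +ᶜ α *ᶜ 0ᶜ)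

        r₁ : Rauzy z₁
        r₁ = rauzy adm-[B-1] (converges-▸ (1 ℕ.+ B) converges-zeros)

        r₃ : Rauzy z₃
        r₃ = rauzy adm-[a-1][B-2] (converges-▸ top (converges-▸ B converges-zeros))

        e₁ : z₁ -ᶜ α *ᶜ u* ≋ lat (+ 0) (+ 1)
        e₁ = solve 2 (λ α y → (y :* (α :* α) :+ α :* con (+ 0)) :- α :* (con -[1+ 0 ] :+ y :* α) :=
          con (+ 0) :+ con (+ 1) :* α) ≡.refl α (ι (+ suc B))

        e₂ : u* -ᶜ lat (+ 0) (+ 0) ≋ u*
        e₂ = solve 2 (λ α z → z :- (con (+ 0) :+ con (+ 0) :* α) := z) ≡.refl α u*

        e₃ : z₃ -ᶜ α *ᶜ (α *ᶜ u*) ≋ lat -[1+ 0 ] (+ suc (suc B))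
        e₃ = C.trans (C.+-cong (C.+-congʳ (C.*-congʳ ιtop≈)) (C.-‿cong (C.*-congˡ (C.*-congˡ u*≈)))) (C.trans
          (solve 3 (λ α x y →
            ((con (+ 2) :+ (x :+ y)) :* (α :* α) :+ α :* (y :* (α :* α) :+ α :* con (+ 0)))
              :- α :* (α :* (con -[1+ 0 ] :+ (con (+ 1) :+ y) :* α)) :=
            (con -[1+ 0 ] :+ (con (+ 2) :+ y) :* α) :-
              (α :* (α :* α) :- ((con (+ 3) :+ (x :+ y)) :* (α :* α) :- (con (+ 2) :+ y) :* α :+ con (+ 1)))) ≡.refl α x y)
          (C.trans (-ρ _) (C.+-congˡ (C.*-congʳ (C.sym (I.+-homo (+ 2) (+ B)))))))

      neighbour± : ∀ {z w} m n → Rauzy z → Rauzy w → z -ᶜ w ≋ lat m n → ¬ ((m , n) ≡ (+ 0 , + 0)) →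
        Neighbour (lat m n) × Neighbour (lat (ℤ.- m) (ℤ.- n))
      neighbour± {z} {w} m n z∈R w∈R z-w≈ nonzero = neighbour m n z∈R w∈R z-w≈ nonzero ,
        neighbour (ℤ.- m) (ℤ.- n) w∈R z∈R (C.trans (solve 2 (λ z w → w :- z := :- (z :- w)) ≡.refl z w)
          (C.trans (C.-‿cong z-w≈) (C.sym (lat-neg m n))))
          λ p → nonzero (≡.cong₂ _,_ (ℤₚ.neg-injective (≡.cong proj₁ p)) (ℤₚ.neg-injective (≡.cong proj₂ p)))

      neighbour-α : Neighbour (lat (+ 0) (+ 1)) × Neighbour (lat (+ 0) -[1+ 0 ])
      neighbour-α = neighbour± (+ 0) (+ 1) r₁ rauzy-αu* e₁ λ ()

      neighbour-u* : Neighbour (lat -[1+ 0 ] (+ suc B)) × Neighbour (lat (+ 1) -[1+ B ])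
      neighbour-u* = neighbour± -[1+ 0 ] (+ suc B) rauzy-u* rauzy-0 e₂ λ ()

      neighbour-u*+α : Neighbour (lat -[1+ 0 ] (+ suc (suc B))) × Neighbour (lat (+ 1) -[1+ suc B ])
      neighbour-u*+α = neighbour± -[1+ 0 ] (+ suc (suc B)) r₃ rauzy-ααu* e₃ λ ()

      sixVectors-neighbours : All (λ (m , n) → Neighbour (lat m n)) sixVectors
      sixVectors-neighbours = proj₁ neighbour-α ∷ proj₂ neighbour-α ∷ proj₁ neighbour-u* ∷ proj₂ neighbour-u* ∷
        proj₁ neighbour-u*+α ∷ proj₂ neighbour-u*+α ∷ []

      module _ (exactly-six : HasExactly 6 Neighbour) where

        neighbour⇒∈sixVectors : ∀ m n → Neighbour (lat m n) → (m , n) ∈ sixVectors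
        neighbour⇒∈sixVectors m n =
          hasExactly⇒∈ (λ (m , n) → lat m n) (λ p → let p₁ , p₂ = lat-injective p in ≡.cong₂ _,_ p₁ p₂)
            exactly-six sixVectors-unique sixVectors-neighbours (m , n)

        rauzy-differences : ∀ m n m′ n′ → Rauzy (lat m n) → Rauzy (lat m′ n′) →
          ¬ ((m ℤ.- m′ , n ℤ.- n′) ≡ (+ 0 , + 0)) → (m ℤ.- m′ , n ℤ.- n′) ∈ sixVectors
        rauzy-differences m n m′ n′ p q nonzero =
          neighbour⇒∈sixVectors _ _ (difference-neighbour m n m′ n′ p q nonzero)

        rauzy-nonzero : ∀ m n → Rauzy (lat m n) → ¬ ((m , n) ≡ (+ 0 , + 0)) → (m , n) ∈ sixVectors
        rauzy-nonzero m n p nonzero = neighbour⇒∈sixVectors m n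
          (neighbour m n p rauzy-0 (solve 2 (λ α z → z :- (con (+ 0) :+ con (+ 0) :* α) := z) ≡.refl α (lat m n)) nonzero)

        -- Otherwise lat 1 n and u* would differ by a neighbour with first coordinate 2.
        ¬rauzy-1 : ∀ n → ¬ Rauzy (lat (+ 1) n)
        ¬rauzy-1 n p = 2∉sixVectors _ (rauzy-differences (+ 1) n -[1+ 0 ] (+ suc B) p rauzy-u* (λ ()))

        ¬rauzy-positive : ∀ k n → ¬ Rauzy (lat (+ suc k) n)
        ¬rauzy-positive k n p = ¬rauzy-1 n (≡.subst (λ k → Rauzy (lat (+ suc k) n))
          (positive∈sixVectors k n (rauzy-nonzero (+ suc k) n p (λ ()))) p)

        -- ±α = d₂α² + ⋯ leaves the tail ±1 − d₂α.
        ¬rauzy-α : ¬ Rauzy (lat (+ 0) (+ 1))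
        ¬rauzy-α p = let e , adm-e , conv = rauzy⁻¹ p in
          ¬rauzy-1 (ℤ.- + e 0) (rauzy (adm-tail adm-e) (converges-tail (split (e 0)) conv))
          where
          split : ∀ d → lat (+ 0) (+ 1) ≋ ι (+ d) *ᶜ (α *ᶜ α) +ᶜ α *ᶜ lat (+ 1) (ℤ.- + d)
          split d = C.sym (C.trans (C.+-congˡ (C.*-congˡ (C.+-congˡ (C.*-congʳ (I.neg-homo (+ d))))))
            (solve 2 (λ α d → d :* (α :* α) :+ α :* (con (+ 1) :+ :- d :* α) := con (+ 0) :+ con (+ 1) :* α) ≡.refl α (ι (+ d))))

        ¬rauzy--α : ¬ Rauzy (lat (+ 0) -[1+ 0 ])
        ¬rauzy--α p = let e , adm-e , conv = rauzy⁻¹ p in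
          -- The tail -1 - d₂α has second coordinate at most 0, whereas the two listed vectors with
          -- first coordinate -1 have it positive.
          -1,-d∉sixVectors (e 0) (rauzy-nonzero -[1+ 0 ] (ℤ.- + e 0)
            (rauzy (adm-tail adm-e) (converges-tail (split (e 0)) conv)) (λ ()))
          where
          split : ∀ d → lat (+ 0) -[1+ 0 ] ≋ ι (+ d) *ᶜ (α *ᶜ α) +ᶜ α *ᶜ lat -[1+ 0 ] (ℤ.- + d)
          split d = C.sym (C.trans (C.+-congˡ (C.*-congˡ (C.+-congˡ (C.*-congʳ (I.neg-homo (+ d))))))
            (solve 2 (λ α d → d :* (α :* α) :+ α :* (con -[1+ 0 ] :+ :- d :* α) := con (+ 0) :+ con -[1+ 0 ] :* α) ≡.refl α (ι (+ d))))

        -- u* + α = aα² − α³ = d₂α² + d₃α³ + ⋯ leaves the tail (a−d₂) − (d₃+1)α.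
        ¬rauzy-u*+α : ¬ Rauzy (lat -[1+ 0 ] (+ suc (suc B)))
        ¬rauzy-u*+α p = let e , adm-e , conv = rauzy⁻¹ p
                            k , top≡ = ℕₚ.m≤n⇒∃[o]m+o≡n (ℤₚ.drop‿+≤+ (proj₁ adm-e 0 tt)) in
          ¬rauzy-positive k (ℤ.- + suc (e 1)) (rauzy (adm-tail (adm-tail adm-e))
            (converges-tail (split₂ k (e 1)) (converges-tail (split₁ (e 0) k top≡) conv)))
          where
          split₁ : ∀ d k → d ℕ.+ k ≡ top → lat -[1+ 0 ] (+ suc (suc B)) ≋
            ι (+ d) *ᶜ (α *ᶜ α) +ᶜ α *ᶜ (ι (+ suc k) *ᶜ α -ᶜ α *ᶜ α)
          split₁ d k top≡ = C.sym (C.trans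
            (C.+-congˡ (C.*-congˡ (C.+-congʳ (C.*-congʳ (I.+-homo (+ 1) (+ k)))))) (C.trans
            (solve 5 (λ α x y d k →
              d :* (α :* α) :+ α :* ((con (+ 1) :+ k) :* α :- α :* α) :=
              (con -[1+ 0 ] :+ (con (+ 2) :+ y) :* α) :+ ((d :+ k) :- (con (+ 2) :+ (x :+ y))) :* (α :* α) :-
                (α :* (α :* α) :- ((con (+ 3) :+ (x :+ y)) :* (α :* α) :- (con (+ 2) :+ y) :* α :+ con (+ 1))))
              ≡.refl α x y (ι (+ d)) (ι (+ k)))
            (C.trans (-ρ _) (C.trans (C.+-congˡ (C.trans (C.*-congʳ d+k≈) (C.zeroˡ _))) (C.trans (C.+-identityʳ _)
              (C.+-congˡ (C.*-congʳ (C.sym (I.+-homo (+ 2) (+ B))))))))))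
            where
            d+k≈ : (ι (+ d) +ᶜ ι (+ k)) -ᶜ (ι (+ 2) +ᶜ (x +ᶜ y)) ≋ 0ᶜ
            d+k≈ = C.trans (C.+-cong
              (C.trans (C.sym (I.+-homo (+ d) (+ k))) (C.reflexive (≡.cong (λ n → ι (+ n)) top≡)))
              (C.-‿cong (C.sym ιtop≈))) (C.-‿inverseʳ (ι (+ top)))

          split₂ : ∀ k d → ι (+ suc k) *ᶜ α -ᶜ α *ᶜ α ≋ ι (+ d) *ᶜ (α *ᶜ α) +ᶜ α *ᶜ lat (+ suc k) (ℤ.- + suc d)
          split₂ k d = C.sym (C.trans
            (C.+-congˡ (C.*-congˡ (C.+-congˡ (C.*-congʳ (C.-‿cong (I.+-homo (+ 1) (+ d)))))))
            (solve 3 (λ α k d → d :* (α :* α) :+ α :* (k :+ :- (con (+ 1) :+ d) :* α) := k :* α :- α :* α)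
              ≡.refl α (ι (+ suc k)) (ι (+ d))))

        rauzy-lattice-points : ∀ m n → Rauzy (lat m n) → ((m , n) ≡ (+ 0 , + 0)) ⊎ ((m , n) ≡ (-[1+ 0 ] , + suc B))
        rauzy-lattice-points m n p with em {P = (m , n) ≡ (+ 0 , + 0)}
        ... | yes zero≡  = inj₁ zero≡
        ... | no nonzero = inj₂ (sixVectors-elim (λ m n → Rauzy (lat m n) → (m , n) ≡ (-[1+ 0 ] , + suc B))
          (λ q → ⊥-elim (¬rauzy-α q)) (λ q → ⊥-elim (¬rauzy--α q)) (λ _ → ≡.refl)
          (λ n q → ⊥-elim (¬rauzy-1 n q)) (λ q → ⊥-elim (¬rauzy-u*+α q)) m n (rauzy-nonzero m n p nonzero) p)

    -- Approximations

    fromℤ-+ : ∀ i j → ℝ.fromℤ (i ℤ.+ j) ≈ʳ ℝ.fromℤ i ℝ.+ ℝ.fromℤ j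
    fromℤ-+ i j rewrite fromℤ≡⟦⟧ (i ℤ.+ j) | fromℤ≡⟦⟧ i | fromℤ≡⟦⟧ j = R.+-homo i j

    x-z≈x-y-w : ∀ {w x y z} → z ≈ʳ y ℝ.+ w → x ℝ.- z ≈ʳ x ℝ.- y ℝ.- w
    x-z≈x-y-w {w} {x} {y} z≈ = ℝ.trans (ℝ.+-congˡ (ℝ.-‿cong z≈))
      (R.solve 3 (λ w x y → x R.:- (y R.:+ w) R.:= x R.:- y R.:- w) ≡.refl w x y)

    *0+ : ∀ y z → y ℤ.* + 0 ℤ.+ z ≡ z
    *0+ y z = ≡.trans (≡.cong (ℤ._+ z) (ℤₚ.*-zeroʳ y)) (ℤₚ.+-identityˡ z)

    -- With T₋₁ = T₋₂ = 0 the recurrence holds from T₁ on, and both shifted sums can be indexed like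
    -- the sum for q.
    T₋₁ T₋₂ : ℕ → ℤ
    T₋₁ zero    = + 0
    T₋₁ (suc j) = T j
    T₋₂ zero    = + 0
    T₋₂ (suc j) = T₋₁ j

    T-suc : ∀ j → T (suc j) ≡ a ℤ.* T j ℤ.+ b ℤ.* T₋₁ j ℤ.+ T₋₂ j
    T-suc 0 = rearrange a b
      where
      rearrange : ∀ a b → a ≡ a ℤ.* + 1 ℤ.+ b ℤ.* + 0 ℤ.+ + 0
      rearrange = ℤ-Solver.solve-∀
    T-suc 1 = rearrange a b
      where
      rearrange : ∀ a b → a ℤ.* a ℤ.+ b ≡ a ℤ.* a ℤ.+ b ℤ.* + 1 ℤ.+ + 0
      rearrange = ℤ-Solver.solve-∀
    T-suc (suc (suc j)) = ≡.refl

    module _ (β : ℝ.Carrier) (β-dominant : IsDominantRoot β)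
             (α : ℂ) (α-root : IsRoot α) (imα≉0 : ¬ (im α ≈ʳ 0ʳ)) where
      private module Rt = Roots a b

      private
        α-root′ : α *ᶜ (α *ᶜ α -ᶜ ι a *ᶜ α -ᶜ ι b) ≋ 1ᶜ
        α-root′ = Rt.root⇒ α-root

        0<∣α∣ : 0ʳ <ʳ ∣ α ∣
        0<∣α∣ = Rt.0<∣α∣ β β-dominant α α-root imα≉0

        ∣α∣<1 : ∣ α ∣ <ʳ 1ʳ
        ∣α∣<1 = Rt.∣α∣<1 β β-dominant α α-root imα≉0

      open AtRoot α α-root′ 0<∣α∣ ∣α∣<1 imα≉0
      open RauzyFractal α
      open Approximation β

      -- The expression `W` with an arbitrary integer in place of q, so that the expansion of q can
      -- be summed term by term.
      comb : ℤ → ℤ → ℤ → ℂ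
      comb t t₁ t₂ = ι t *ᶜ (α *ᶜ α) +ᶜ ι t₁ +ᶜ (ι b *ᶜ ι t₁ +ᶜ ι t₂) *ᶜ α

      comb-affine : ∀ d t t₁ t₂ u u₁ u₂ →
        comb (d ℤ.* t ℤ.+ u) (d ℤ.* t₁ ℤ.+ u₁) (d ℤ.* t₂ ℤ.+ u₂) ≋ ι d *ᶜ comb t t₁ t₂ +ᶜ comb u u₁ u₂
      comb-affine d t t₁ t₂ u u₁ u₂ = C.trans
        (C.+-cong (C.+-cong (C.*-congʳ (h t u)) (h t₁ u₁)) (C.*-congʳ (C.+-cong (C.*-congˡ (h t₁ u₁)) (h t₂ u₂))))
        (solve 9 (λ α b d t t₁ t₂ u u₁ u₂ →
          (d :* t :+ u) :* (α :* α) :+ (d :* t₁ :+ u₁) :+ (b :* (d :* t₁ :+ u₁) :+ (d :* t₂ :+ u₂)) :* α :=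
          d :* (t :* (α :* α) :+ t₁ :+ (b :* t₁ :+ t₂) :* α) :+ (u :* (α :* α) :+ u₁ :+ (b :* u₁ :+ u₂) :* α))
          ≡.refl α (ι b) (ι d) (ι t) (ι t₁) (ι t₂) (ι u) (ι u₁) (ι u₂))
        where
        h : ∀ t u → ι (d ℤ.* t ℤ.+ u) ≋ ι d *ᶜ ι t +ᶜ ι u
        h t u = C.trans (I.+-homo (d ℤ.* t) u) (C.+-congʳ (I.*-homo d t))

      comb-sum : ∀ n (e : Digits) c (t t₁ t₂ : ℕ → ℤ) → comb (t 0) (t₁ 0) (t₂ 0) ≋ c *ᶜ (α *ᶜ α) →
        (∀ j → comb (t (suc j)) (t₁ (suc j)) (t₂ (suc j)) ≋ α *ᶜ comb (t j) (t₁ j) (t₂ j)) →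
        comb (Σℤ n λ j → + e j ℤ.* t j) (Σℤ n λ j → + e j ℤ.* t₁ j) (Σℤ n λ j → + e j ℤ.* t₂ j) ≋ c *ᶜ S e n
      comb-sum zero e c t t₁ t₂ start step =
        solve 3 (λ α b c → con (+ 0) :* (α :* α) :+ con (+ 0) :+ (b :* con (+ 0) :+ con (+ 0)) :* α := c :* con (+ 0)) ≡.refl α (ι b) c
      comb-sum (suc n) e c t t₁ t₂ start step = C.trans
        (comb-affine (+ e 0) (t 0) (t₁ 0) (t₂ 0) (Σℤ n λ j → + e (suc j) ℤ.* t (suc j))
          (Σℤ n λ j → + e (suc j) ℤ.* t₁ (suc j)) (Σℤ n λ j → + e (suc j) ℤ.* t₂ (suc j)))
        (C.trans (C.+-cong (C.*-congˡ start)
          (comb-sum n (tail e) (c *ᶜ α) (λ j → t (suc j)) (λ j → t₁ (suc j)) (λ j → t₂ (suc j))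
            (C.trans (step 0) (C.trans (C.*-congˡ start)
              (solve 2 (λ α c → α :* (c :* (α :* α)) := c :* α :* (α :* α)) ≡.refl α c)))
            (λ j → step (suc j))))
          (solve 4 (λ α c d s → d :* (c :* (α :* α)) :+ c :* α :* s := c :* (d :* (α :* α) :+ α :* s)) ≡.refl α c (ι (+ e 0)) (S (tail e) n)))

      -- α^{j+2} = T_j α² + T_{j−1} + (b T_{j−1} + T_{j−2}) α.
      comb-T-suc : ∀ j → comb (T (suc j)) (T₋₁ (suc j)) (T₋₂ (suc j)) ≋ α *ᶜ comb (T j) (T₋₁ j) (T₋₂ j)
      comb-T-suc j = C.trans
        (C.+-congʳ (C.+-congʳ (C.*-congʳ (C.trans (C.reflexive (≡.cong ι (T-suc j)))
          (C.trans (I.+-homo (a ℤ.* T j ℤ.+ b ℤ.* T₋₁ j) (T₋₂ j)) (C.+-congʳ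
            (C.trans (I.+-homo (a ℤ.* T j) (b ℤ.* T₋₁ j)) (C.+-cong (I.*-homo a (T j)) (I.*-homo b (T₋₁ j))))))))))
        (C.trans
          (solve 6 (λ α a b t t₁ t₂ →
            (a :* t :+ b :* t₁ :+ t₂) :* (α :* α) :+ t :+ (b :* t :+ t₁) :* α :=
            α :* (t :* (α :* α) :+ t₁ :+ (b :* t₁ :+ t₂) :* α) :- t :* (α :* (α :* α :- a :* α :- b) :- con (+ 1)))
            ≡.refl α (ι a) (ι b) (ι (T j)) (ι (T₋₁ j)) (ι (T₋₂ j)))
          (C.trans (C.+-congˡ (C.-‿cong (C.*-congˡ (C.trans (C.+-cong α-root′ (C.-‿cong (C.+-identityʳ 1ᶜ))) (C.-‿inverseʳ 1ᶜ)))))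
            (solve 2 (λ z t → z :- t :* con (+ 0) := z) ≡.refl _ (ι (T j)))))

      comb-T-0 : comb (T 0) (T₋₁ 0) (T₋₂ 0) ≋ 1ᶜ *ᶜ (α *ᶜ α)
      comb-T-0 = C.trans
        (solve 2 (λ α b → con (+ 1) :* (α :* α) :+ con (+ 0) :+ (b :* con (+ 0) :+ con (+ 0)) :* α := con (+ 1) :* (α :* α)) ≡.refl α (ι b))
        (C.*-congʳ (C.+-identityʳ 1ᶜ))

      S-zeros : ∀ {e} → (∀ i → e i ≡ 0) → ∀ n → S e n ≋ 0ᶜ
      S-zeros zeros zero = C.refl
      S-zeros {e} zeros (suc n) = begin
        ι (+ e 0) *ᶜ (α *ᶜ α) +ᶜ α *ᶜ S (tail e) n
          ≈⟨ C.+-cong (C.*-congʳ (C.reflexive (≡.cong (λ d → ι (+ d)) (zeros 0))))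
                      (C.*-congˡ (S-zeros {tail e} (λ i → zeros (suc i)) n)) ⟩
        0ᶜ *ᶜ (α *ᶜ α) +ᶜ α *ᶜ 0ᶜ
          ≈⟨ C.+-cong (C.zeroˡ _) (C.zeroʳ α) ⟩
        0ᶜ +ᶜ 0ᶜ
          ≈⟨ C.+-identityˡ 0ᶜ ⟩
        0ᶜ ∎
        where open ≈ᶜ-Reasoning

      S-vanishing : ∀ N {e} → (∀ i → N ℕ.≤ i → e i ≡ 0) → ∀ n → N ℕ.≤ n → S e n ≋ S e N
      S-vanishing zero {e} zeros n _ = S-zeros {e} (λ i → zeros i ℕ.z≤n) n
      S-vanishing (suc N) {e} zeros (suc n) (ℕ.s≤s N≤n) =
        C.+-congˡ (C.*-congˡ (S-vanishing N {tail e} (λ i N≤i → zeros (suc i) (ℕ.s≤s N≤i)) n N≤n))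

      module _ {q : ℕ} (rep : TRepresentation q) where
        open TRepresentation rep

        representation-value : Rt.W β β-dominant α α-root imα≉0 q (shift₁ , shift₂) ≋ S d (suc k)
        representation-value = C.trans
          (C.reflexive (≡.trans (≡.cong (λ t → comb t shift₁ shift₂) value)
            (≡.cong₂ (comb (Σℤ (suc k) λ j → + d j ℤ.* T j)) (≡.sym shift₁≡) (≡.sym (shift₂≡ k)))))
          (C.trans (comb-sum (suc k) d 1ᶜ T T₋₁ T₋₂ comb-T-0 comb-T-suc) (C.*-identityˡ _))
          where
          shift₁≡ : Σℤ (suc k) (λ j → + d j ℤ.* T₋₁ j) ≡ shift₁
          shift₁≡ = *0+ (+ d 0) shift₁

          shift₂≡ : ∀ k → Σℤ (suc k) (λ j → + d j ℤ.* T₋₂ j) ≡ Σℤ (k ∸ 1) (λ i → + d (2 ℕ.+ i) ℤ.* T i)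
          shift₂≡ zero    = *0+ (+ d 0) (+ 0)
          shift₂≡ (suc k) = ≡.trans (*0+ (+ d 0) _) (*0+ (+ d 1) _)

        S-truncate : ∀ n → suc k ℕ.≤ n → S (truncate k d) n ≋ S d (suc k)
        S-truncate n k<n = C.trans (S-vanishing (suc k) (λ i k<i → truncate-> {d = d} k<i) n k<n)
          (C.reflexive (S-agree (suc k) {truncate k d} {d} λ i i≤k → truncate-≤ {d = d} (ℕₚ.≤-pred i≤k)))

      -- `W` is affine in g, and at g = p it is the point x of R. Its change from p to g is the
      -- lattice vector u.
      W-difference : ∀ q p₁ p₂ g₁ g₂ → let W = Rt.W β β-dominant α α-root imα≉0 q in
        W (p₁ , p₂) -ᶜ lat (p₁ ℤ.- g₁) (b ℤ.* (p₁ ℤ.- g₁) ℤ.+ (p₂ ℤ.- g₂)) ≋ W (g₁ , g₂)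
      W-difference q p₁ p₂ g₁ g₂ = C.trans
        (C.+-congˡ (C.-‿cong (C.+-cong (minus p₁ g₁) (C.*-congʳ (C.trans (I.+-homo (b ℤ.* (p₁ ℤ.- g₁)) (p₂ ℤ.- g₂))
          (C.+-cong (C.trans (I.*-homo b (p₁ ℤ.- g₁)) (C.*-congˡ (minus p₁ g₁))) (minus p₂ g₂)))))))
        (solve 7 (λ α b q p₁ p₂ g₁ g₂ →
          (q :* (α :* α) :+ p₁ :+ (b :* p₁ :+ p₂) :* α) :- ((p₁ :- g₁) :+ (b :* (p₁ :- g₁) :+ (p₂ :- g₂)) :* α) :=
          q :* (α :* α) :+ g₁ :+ (b :* g₁ :+ g₂) :* α) ≡.refl α (ι b) (ι (+ q)) (ι p₁) (ι p₂) (ι g₁) (ι g₂))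
        where
        minus : ∀ i j → ι (i ℤ.- j) ≋ ι i -ᶜ ι j
        minus i j = C.trans (I.+-homo i (ℤ.- j)) (C.+-congˡ (I.neg-homo j))

      module _ (exactly-six : HasExactly 6 Neighbour) where
        Exceptional : ℤ → ℤ → Set
        Exceptional m n = ¬ ((m , n) ≡ (+ 0 , + 0)) × ¬ ((m , n) ≡ (-[1+ 0 ] , + suc B))

        separated : ∃ λ c → 0ʳ <ʳ c × (∀ e m n → Adm e → Exceptional m n →
          ¬ (∃ λ N → ∀ k → N ℕ.≤ k → ∣ S e k -ᶜ lat m n ∣ <ʳ c))
        separated = separation Exceptional λ m n p (≢0 , ≢u*) →
          [ ≢0 , ≢u* ]′ (rauzy-lattice-points exactly-six m n p)

        ¬exceptional⇒ : ∀ m n → ¬ Exceptional m n →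
          ((m , n) ≡ (+ 0 , + 0)) ⊎ ((m , n) ≡ (-[1+ 0 ] , + suc B))
        ¬exceptional⇒ m n ¬exceptional = by-cases em em
          where
          by-cases : Dec ((m , n) ≡ (+ 0 , + 0)) → Dec ((m , n) ≡ (-[1+ 0 ] , + suc B)) →
            ((m , n) ≡ (+ 0 , + 0)) ⊎ ((m , n) ≡ (-[1+ 0 ] , + suc B))
          by-cases (yes p) _       = inj₁ p
          by-cases (no _)  (yes q) = inj₂ q
          by-cases (no ¬p) (no ¬q) = ⊥-elim (¬exceptional (¬p , ¬q))

        Alternatives : ∀ {q} → TRepresentation q → ℤ × ℤ → Set
        Alternatives {q} r g =
          (q ·² θ -² fromℤ² g ≈² δ r) ⊎ (q ·² θ -² fromℤ² g ≈² δ r -² fromℤ² (+ 1 , + 1))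

        approximation : ∃ λ c → 0ʳ <ʳ c × (∀ q → 1 ℕ.≤ q → ∀ (r : TRepresentation q) g →
          𝒩 α (q ·² θ -² fromℤ² g) <ʳ c → Alternatives r g)
        approximation = c ℝ.* γ , ℝ.*-pos 0<c (Rt.0<γ β β-dominant α α-root imα≉0) , λ q _ → conclude q
          where
          c γ : ℝ.Carrier
          c = proj₁ separated
          γ = Rt.γ β β-dominant α α-root imα≉0

          0<c : 0ʳ <ʳ c
          0<c = proj₁ (proj₂ separated)

          conclude : ∀ q (r : TRepresentation q) (g : ℤ × ℤ) → 𝒩 α (q ·² θ -² fromℤ² g) <ʳ c ℝ.* γ → Alternatives r g
          conclude q r g@(g₁ , g₂) small = cases (¬exceptional⇒ m n λ exceptional →
              proj₂ (proj₂ separated) (truncate k d) m n (adm-truncate admissible) exceptional (suc k , near))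
            where
            open TRepresentation r
            m n : ℤ
            m = shift₁ ℤ.- g₁
            n = b ℤ.* m ℤ.+ (shift₂ ℤ.- g₂)

            near : ∀ j → suc k ℕ.≤ j → ∣ S (truncate k d) j -ᶜ lat m n ∣ <ʳ c
            -- From index k+1 on, the partial sums of the truncated word are constantly x, so the
            -- difference is exactly x - u.
            near j k<j = <-respˡ (∣∣-cong (C.sym (C.trans
              (C.+-congʳ (C.trans (S-truncate r j k<j) (C.sym (representation-value r))))
              (W-difference q shift₁ shift₂ g₁ g₂))))
              (Rt.𝒩-small⇒∣W∣-small β β-dominant α α-root imα≉0 0<c q g small)

            shifted : ∀ p g → p ℤ.- g ≡ -[1+ 0 ] → g ≡ p ℤ.+ + 1
            shifted p g eq = ≡.trans (rearrange p g) (≡.cong (λ z → p ℤ.- z) eq)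
              where
              rearrange : ∀ p g → g ≡ p ℤ.- (p ℤ.- g)
              rearrange = ℤ-Solver.solve-∀

            cases : ((m , n) ≡ (+ 0 , + 0)) ⊎ ((m , n) ≡ (-[1+ 0 ] , + suc B)) → Alternatives r g
            cases (inj₁ eq) = inj₁
              ( ℝ.+-congˡ (ℝ.-‿cong (ℝ.reflexive (≡.cong ℝ.fromℤ (≡.sym p₁≡g₁))))
              , ℝ.+-congˡ (ℝ.-‿cong (ℝ.reflexive (≡.cong ℝ.fromℤ (≡.sym p₂≡g₂)))))
              where
              m≡0 : m ≡ + 0
              m≡0 = ≡.cong proj₁ eq

              p₁≡g₁ : shift₁ ≡ g₁
              p₁≡g₁ = ℤₚ.i-j≡0⇒i≡j shift₁ g₁ m≡0

              p₂≡g₂ : shift₂ ≡ g₂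
              p₂≡g₂ = ℤₚ.i-j≡0⇒i≡j shift₂ g₂ (≡.trans (≡.sym (≡.trans
                (≡.cong (λ m → b ℤ.* m ℤ.+ (shift₂ ℤ.- g₂)) m≡0) (*0+ b (shift₂ ℤ.- g₂)))) (≡.cong proj₂ eq))
            -- Here m = -1 and B+1 = n = bm + (shift₂ - g₂) with bm = B+2; so shift₂ - g₂ = -1 as
            -- well.
            cases (inj₂ eq) = inj₂
              ( x-z≈x-y-w (ℝ.trans (ℝ.reflexive (≡.cong ℝ.fromℤ (shifted shift₁ g₁ m≡-1))) (fromℤ-+ shift₁ (+ 1)))
              , x-z≈x-y-w (ℝ.trans (ℝ.reflexive (≡.cong ℝ.fromℤ (shifted shift₂ g₂ p₂-g₂≡-1))) (fromℤ-+ shift₂ (+ 1))))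
              where
              m≡-1 : m ≡ -[1+ 0 ]
              m≡-1 = ≡.cong proj₁ eq

              rearrange : ∀ z y → z ≡ (ℤ.- (+ 2 ℤ.+ y) ℤ.* -[1+ 0 ] ℤ.+ z) ℤ.- (+ 2 ℤ.+ y)
              rearrange = ℤ-Solver.solve-∀

              p₂-g₂≡-1 : shift₂ ℤ.- g₂ ≡ -[1+ 0 ]
              p₂-g₂≡-1 = ≡.trans (rearrange (shift₂ ℤ.- g₂) (+ B)) (≡.trans
                (≡.cong (ℤ._- (+ 2 ℤ.+ + B)) (≡.trans
                  (≡.cong (λ m → b ℤ.* m ℤ.+ (shift₂ ℤ.- g₂)) (≡.sym m≡-1)) (≡.cong proj₂ eq)))
                (rearrange′ (+ B)))
                where
                rearrange′ : ∀ y → (+ 1 ℤ.+ y) ℤ.- (+ 2 ℤ.+ y) ≡ -[1+ 0 ]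
                rearrange′ = ℤ-Solver.solve-∀

-- The conclusion as a predicate of a and b, the motive for `parameters-elim`.
Approximation-property : CompleteOrderedField → ℤ → ℤ → Set
Approximation-property ℝ a b =
  let open CompleteOrderedField ℝ
      open ComplexNumbers ℝ
      open Cubic ℝ a b
  in
  (β : Carrier) → IsDominantRoot β →
  (α : ℂ) → IsRoot α → ¬ (im α ≈ 0#) →
  let open RauzyFractal α
      open Approximation β
  in
  HasExactly 6 Neighbour →
  ∃ λ (c : Carrier) → (0# < c) ×
    ((q : ℕ) → 1 ℕ.≤ q → (r : TRepresentation q) → (g : ℤ × ℤ) →
      𝒩 α (q ·² θ -² fromℤ² g) < c →
      (q ·² θ -² fromℤ² g ≈² δ r) ⊎
      (q ·² θ -² fromℤ² g ≈² δ r -² fromℤ² (+ 1 , + 1)))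

theorem3p1 :
  ExcludedMiddle 0ℓ →
  (ℝ : CompleteOrderedField) →
  let open CompleteOrderedField ℝ
      open ComplexNumbers ℝ
  in
  (a b : ℤ) →
  (ℤ.- a) ℤ.+ + 1 ℤ.≤ b → b ℤ.≤ -[1+ 1 ] →
  let open Cubic ℝ a b in
  (β : Carrier) → IsDominantRoot β →
  (α : ℂ) → IsRoot α → ¬ (im α ≈ 0#) →
  let open RauzyFractal α
      open Approximation β
  in
  HasExactly 6 Neighbour →
  ∃ λ (c : Carrier) → (0# < c) ×
    ((q : ℕ) → 1 ℕ.≤ q → (r : TRepresentation q) → (g : ℤ × ℤ) →
      𝒩 α (q ·² θ -² fromℤ² g) < c →
      (q ·² θ -² fromℤ² g ≈² δ r) ⊎
      (q ·² θ -² fromℤ² g ≈² δ r -² fromℤ² (+ 1 , + 1)))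
theorem3p1 em ℝ a b -a+1≤b b≤-2 =
  parameters-elim (Approximation-property ℝ) (approximation em ℝ) (⇒parameters a b -a+1≤b b≤-2)
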